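{- Let $H$ be either the diamond, the $1$-pan, or the $2$-pan. Then the class of $H$-subdivisions has the induced Erdős–Pósa property with a polynomial bounding function; that is, there is a polynomial $f\colon \mathbb{N}\to\mathbb{R}$ such that for every graph $G$ and every positive integer $k$, either $G$ contains $k$ pairwise vertex-disjoint induced subgraphs each of which is a subdivision of $H$, or there is a set $X\subseteq V(G)$ with $|X|\le f(k)$ such that $G-X$ contains no induced subgraph that is a subdivision of $H$.
   Context: All graphs are finite, simple and without loops. A subdivision of $H$ ($H$-subdivision) is a graph obtained from $H$ by repeatedly replacing an edge by a path of length two through a new vertex. A class $\mathcal{F}$ of graphs has the induced Erdős–Pósa property with bounding function $f$ if for every graph $G$ and every positive integer $k$, $G$ contains either $k$ pairwise vertex-disjoint induced subgraphs belonging to $\mathcal{F}$, or a vertex set of size at most $f(k)$ meeting every induced subgraph of $G$ belonging to $\mathcal{F}$. The diamond is $K_4$ minus one edge. For a positive integer $n$, the $n$-pan is obtained from the disjoint union of a triangle $K_3$ and a path with $n$ edges by identifying one endpoint of the path with a vertex of the triangle. -}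

module Defs where

open import Data.Nat using (ℕ; zero; suc; _≤_; _≡ᵇ_)
open import Data.Fin using (Fin; zero; suc; toℕ; _≟_)
open import Data.Bool using (Bool; true; false; _∧_; _∨_; not)
open import Data.List using (List; []; _∷_; length)
open import Data.Bool.ListAction using (any)
open import Data.List.Membership.Propositional using (_∈_)
open import Data.Product using (Σ; ∃; _×_; _,_)
open import Relation.Nullary using (¬_)
open import Relation.Nullary.Decidable using (⌊_⌋)
open import Relation.Binary.PropositionalEquality using (_≡_; _≢_)
open import Function.Definitions using (Injective)

record Graph : Set where
  constructor mkGraph
  field
    n   : ℕ
    adj : Fin n → Fin n → Bool
open Graph public

record IsSimple (G : Graph) : Set where
  field
    symm  : ∀ i j → adj G i j ≡ adj G j i
    irref : ∀ i → adj G i i ≡ false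

subdivide : (S : Graph) → Fin (n S) → Fin (n S) → Graph
subdivide S u v = mkGraph (suc (n S)) a
  where
  end : Fin (n S) → Bool
  end i = ⌊ i ≟ u ⌋ ∨ ⌊ i ≟ v ⌋
  isUV : Fin (n S) → Fin (n S) → Bool
  isUV i j = (⌊ i ≟ u ⌋ ∧ ⌊ j ≟ v ⌋) ∨ (⌊ i ≟ v ⌋ ∧ ⌊ j ≟ u ⌋)
  a : Fin (suc (n S)) → Fin (suc (n S)) → Bool
  a zero zero = false
  a zero (suc j) = end j
  a (suc i) zero = end i
  a (suc i) (suc j) = adj S i j ∧ not (isUV i j)

-- Subdiv H S : S is obtained from H by repeatedly subdividing edges
-- (up to isomorphism, which is irrelevant below since we only use
-- induced embeddings of S).
data Subdiv (H : Graph) : Graph → Set where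
  base : Subdiv H H
  step : ∀ {S} → Subdiv H S → (u v : Fin (n S)) → adj S u v ≡ true →
         Subdiv H (subdivide S u v)

record InducedEmb (S G : Graph) : Set where
  field
    φ     : Fin (n S) → Fin (n G)
    inj   : Injective _≡_ _≡_ φ
    pres  : ∀ i j → adj G (φ i) (φ j) ≡ adj S i j
open InducedEmb public

record InducedSubdiv (H G : Graph) : Set where
  field
    sub    : Graph
    isSub  : Subdiv H sub
    emb    : InducedEmb sub G
open InducedSubdiv public

DisjointPacking : (H G : Graph) (k : ℕ) → Set
DisjointPacking H G k =
  Σ (Fin k → InducedSubdiv H G) λ P →
    ∀ a b → a ≢ b → ∀ i j → φ (emb (P a)) i ≢ φ (emb (P b)) j

Hits : (H G : Graph) → List (Fin (n G)) → Set
Hits H G X = ∀ (c : InducedSubdiv H G) → ∃ λ i → φ (emb c) i ∈ X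

fromEdges : (m : ℕ) → List (ℕ × ℕ) → Graph
fromEdges m es = mkGraph m (λ i j → any (λ { (a , b) →
  ((toℕ i ≡ᵇ a) ∧ (toℕ j ≡ᵇ b)) ∨ ((toℕ i ≡ᵇ b) ∧ (toℕ j ≡ᵇ a)) }) es)

diamond : Graph
diamond = fromEdges 4 ((0 , 1) ∷ (0 , 2) ∷ (0 , 3) ∷ (1 , 2) ∷ (1 , 3) ∷ [])

pan1 : Graph
pan1 = fromEdges 4 ((0 , 1) ∷ (0 , 2) ∷ (1 , 2) ∷ (0 , 3) ∷ [])

pan2 : Graph
pan2 = fromEdges 5 ((0 , 1) ∷ (0 , 2) ∷ (1 , 2) ∷ (0 , 3) ∷ (3 , 4) ∷ [])

data WhichH : Set where
  isDiamond isPan1 isPan2 : WhichH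

graphOf : WhichH → Graph
graphOf isDiamond = diamond
graphOf isPan1 = pan1
graphOf isPan2 = pan2

Fin' : Graph → Set
Fin' G = Fin (n G)

{-# OPTIONS --safe #-}
-- Induction on k. If F is an object, either k - 1 further objects avoid F, or a bounded set Y meets
-- all objects avoiding F, so that the objects avoiding Y all meet F. Up to its two ends, F is an
-- induced path P. For each cut of P into a left and a right part apply Menger's theorem. If for some
-- cut there are many disjoint paths between the parts, then they and P contain many disjoint
-- ladders, by splitting repeatedly at medians of the end points, and every ladder contains an
-- object. Otherwise every cut has a small separator. At the first cut for which some object c
-- avoiding the separator meets the left part, removing this separator, the previous one and one
-- vertex of P leaves only objects disjoint from c, and one repeats with these.
--
-- A ladder spans a 2-connected graph with a vertex of degree at least three and a long piece of P.
-- For the diamond, a shortest hole and an ear on it give an induced theta. For the pans take a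
-- shortest cycle C: if C is long then a vertex outside has at most one neighbour on C, and if it is
-- short then some vertex of P is far from C, and the way from it to C yields the tail.
--
-- For the 2-pan this last step fails at vertices adjacent to all of P (the join of a graph with a
-- complete graph need not contain further 2-pans). Small 2-pans are removed greedily beforehand, and
-- F is chosen with as few such dense vertices as possible; then no object meeting P uses one of them.
module Submission where

open import Defs
open import Data.Nat using (ℕ; zero; suc; _≤_; _<_; _+_; z≤n; s≤s; _*_; _^_; _<?_; _≤?_; _∸_)
open import Data.Nat.Properties using (≤-refl; ≤-trans; ≤-reflexive; n≤1+n; +-suc; <-irrefl; ≰⇒>; ≮⇒≥; <⇒≤; ≤-antisym; +-cancelˡ-≤; +-mono-≤; +-monoˡ-≤; +-monoʳ-≤; +-identityʳ; m≤n⇒m≤1+n; +-comm; <-≤-trans; m≤m+n; m+[n∸m]≡n; ∸-monoˡ-≤; <-trans; suc-injective; m<n⇒m<1+n; n<1+n; ≤-<-trans; +-monoʳ-<; ≤-pred; ≤∧≢⇒<; <-cmp; +-∸-assoc; m∸n≤m; ∸-monoʳ-<; m∸[m∸n]≡n; anyUpTo?; ≤-total; m≤n+m; *-monoˡ-≤; *-monoʳ-≤; *-mono-≤; m^n>0; m≤n⇒m⊓n≡m; *-identityʳ; n≮0; m∸n+n≡m; ∸-monoʳ-≤; m≤n+o⇒m∸n≤o; allUpTo?)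
open import Data.List using (List; []; _∷_; length; _++_; filter; map; tabulate; applyUpTo; allFin; cartesianProduct; take; lookup)
open import Data.List.Properties using (length-++; filter-all; ++-assoc; length-tabulate; tabulate-cong; length-map; filter-notAll; length-applyUpTo; length-take)
open import Data.List.Membership.Propositional using (_∈_; _∉_; find; lose)
open import Data.List.Membership.Propositional.Properties using (∈-∃++; ∈-++⁺ˡ; ∈-++⁺ʳ; ∈-++⁻; ∈-filter⁻; ∈-map⁺; ∈-map⁻; ∈-tabulate⁻; ∈-tabulate⁺; ∈-applyUpTo⁺; ∈-applyUpTo⁻; ∈-filter⁺; ∈-allFin; ∈-cartesianProduct⁺; ∈-lookup)
open import Data.List.Relation.Binary.Subset.Propositional using (_⊆_)
open import Data.List.Relation.Unary.Any using (Any; here; there; any?)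
open import Data.List.Relation.Unary.All using (All; []; _∷_; all?)
open import Data.List.Relation.Unary.AllPairs using (AllPairs; []; _∷_)
open import Data.List.Relation.Unary.Unique.Propositional using (Unique)
open import Data.Product using (Σ; ∃; _×_; _,_; proj₁; proj₂)
open import Data.Sum using (_⊎_; inj₁; inj₂)
open import Data.Empty using (⊥; ⊥-elim)
open import Relation.Nullary using (¬_; Dec; yes; no)
open import Relation.Binary using (DecidableEquality; Symmetric; tri<; tri≈; tri>)
open import Relation.Binary.PropositionalEquality using (_≡_; _≢_; refl; sym; trans; cong; subst; cong₂; subst₂)
open import Relation.Nullary.Decidable using (¬?; _⊎-dec_; _×-dec_; from-yes; _→-dec_; map′; toWitness)
open import Relation.Unary using (Decidable)
open import Data.Fin using (Fin; _≟_; zero; suc; #_)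
open import Data.Bool using (true; false; Bool)
open import Data.List.Relation.Unary.Unique.Propositional.Properties using (tabulate⁺; map⁺; allFin⁺; filter⁺)
open import Data.Product.Properties using (≡-dec)
open import Function using (_∘_; id)
open import Data.Vec using (Vec; []; _∷_)
open import Data.Vec.Properties using (lookup∘tabulate)
import Data.List.Relation.Unary.All as All
import Data.List.Relation.Unary.AllPairs.Properties as AP
import Data.List.Relation.Unary.AllPairs as AllP
import Data.List.Relation.Unary.All.Properties as AllProps
import Data.Bool.Properties as Bool
import Data.Sum as Sum
import Data.Fin.Properties as Fin
import Data.Nat as ℕ
import Data.Vec as Vec
open import Data.List.Membership.DecPropositional ℕ._≟_ using () renaming (_∈?_ to _∈ℕ?_)

-- Why a path: each of the three graphs has a Hamiltonian path such that every other edge is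
-- incident with one of its ends, and subdividing keeps this shape. So an object without its two end
-- vertices is an induced path of the graph, and the cuts of this path are linearly ordered, as the
-- search for the first bad cut requires. Why medians: a path from left to right is recorded by the
-- positions of its two feet, a point in the plane. Ladders are disjoint if their points are
-- separated in both coordinates. Each split halves the problem but keeps only a quarter of the
-- points, so 2^J boxes of r points need r times 4^J points. This gives degree four: at most k
-- rounds, at most 2k repetitions of Menger's theorem along P in each, and separators of order
-- (2k)^2. The argument is constructive: an object of G arises by at most as many subdivisions as G
-- has vertices, so the existence of an object with a decidable property is decidable.

-- Lists, walks and reachability

card : ∀ {A : Set} {us vs : List A} → Unique us → us ⊆ vs → length us ≤ length vs
card {us = []} _ _ = z≤n
card {us = u ∷ us} (u∉ ∷ uniq) sub with ∈-∃++ (sub (here refl))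
... | ys , zs , refl = ≤-trans (s≤s (card uniq sub′)) (≤-reflexive eq)
  where
  sub′ : us ⊆ ys ++ zs
  sub′ {w} w∈ with ∈-++⁻ ys (sub (there w∈))
  ... | inj₁ p = ∈-++⁺ˡ p
  ... | inj₂ (here refl) = ⊥-elim (All.lookup u∉ w∈ refl)
  ... | inj₂ (there p) = ∈-++⁺ʳ ys p
  eq : suc (length (ys ++ zs)) ≡ length (ys ++ u ∷ zs)
  eq rewrite length-++ ys {zs} | length-++ ys {u ∷ zs} = sym (+-suc (length ys) (length zs))

allPairs-lookup : ∀ {A : Set} {R : A → A → Set} → Symmetric R → {xs : List A} → AllPairs R xs →
                  ∀ {a b} → a ∈ xs → b ∈ xs → a ≡ b ⊎ R a b
allPairs-lookup sy (_ ∷ _) (here refl) (here refl) = inj₁ refl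
allPairs-lookup sy (rs ∷ _) (here refl) (there q) = inj₂ (All.lookup rs q)
allPairs-lookup sy (rs ∷ _) (there p) (here refl) = inj₂ (sy (All.lookup rs p))
allPairs-lookup sy (_ ∷ ap) (there p) (there q) = allPairs-lookup sy ap p q

Disjoint : ∀ {A : Set} → List A → List A → Set
Disjoint l l′ = ∀ {v} → v ∈ l → v ∈ l′ → ⊥

disjoint-sym : ∀ {A : Set} {l l′ : List A} → Disjoint l l′ → Disjoint l′ l
disjoint-sym d a b = d b a

-- These are walks: the list contains both ends and may repeat vertices. Simple and induced paths
-- are singled out by `Unique` and `IPath`.
data Path {V : Set} (R : V → V → Set) : V → List V → V → Set where
  [_] : ∀ x → Path R x (x ∷ []) x
  _∷_ : ∀ {x y z l} → R x y → Path R y l z → Path R x (x ∷ l) z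

data Reach {V : Set} (R : V → V → Set) (W : V → Set) : V → V → Set where
  stop : ∀ {x} → W x → Reach R W x x
  step : ∀ {x y z} → W x → R x y → Reach R W y z → Reach R W x z

module _ {V : Set} {R : V → V → Set} where

  head∈ : ∀ {x l y} → Path R x l y → x ∈ l
  head∈ [ _ ] = here refl
  head∈ (_ ∷ _) = here refl

  last∈ : ∀ {x l y} → Path R x l y → y ∈ l
  last∈ [ _ ] = here refl
  last∈ (_ ∷ p) = there (last∈ p)

  ++-path : ∀ {x l y z l′ w} → Path R x l y → R y z → Path R z l′ w → Path R x (l ++ l′) w
  ++-path [ x ] r q = r ∷ q
  ++-path (r′ ∷ p) r q = r′ ∷ ++-path p r q

  join : ∀ {x l y l′ z} → Path R x l y → Path R y l′ z →
         Σ (List V) λ m → Path R x m z × (∀ {v} → v ∈ m → v ∈ l ⊎ v ∈ l′)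
  join [ _ ] q = _ , q , inj₂
  join (r ∷ p) q with join p q
  ... | m , pq , f = _ , r ∷ pq , λ { (here refl) → inj₁ (here refl)
                                    ; (there v∈) → Data.Sum.map₁ there (f v∈) }
    where import Data.Sum

  path⇒reach : ∀ {W : V → Set} {x l y} → Path R x l y → (∀ {v} → v ∈ l → W v) → Reach R W x y
  path⇒reach [ _ ] w = stop (w (here refl))
  path⇒reach (r ∷ p) w = step (w (here refl)) r (path⇒reach p (λ v∈ → w (there v∈)))

  reach⇒path : ∀ {W : V → Set} {x y} → Reach R W x y → Σ (List V) λ l → Path R x l y × (∀ {v} → v ∈ l → W v)
  reach⇒path (stop w) = _ , [ _ ] , λ { (here refl) → w }
  reach⇒path (step w r p) with reach⇒path p
  ... | l , q , f = _ , r ∷ q , λ { (here refl) → w ; (there v∈) → f v∈ }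

  reach-trans : ∀ {W : V → Set} {x y z} → Reach R W x y → Reach R W y z → Reach R W x z
  reach-trans (stop _) q = q
  reach-trans (step w r p) q = step w r (reach-trans p q)

  reach-mono : ∀ {W W′ : V → Set} {x y} → (∀ {v} → W v → W′ v) → Reach R W x y → Reach R W′ x y
  reach-mono f (stop w) = stop (f w)
  reach-mono f (step w r p) = step (f w) r (reach-mono f p)

  reach-start : ∀ {W : V → Set} {x y} → Reach R W x y → W x
  reach-start (stop w) = w
  reach-start (step w _ _) = w

  reach-end : ∀ {W : V → Set} {x y} → Reach R W x y → W y
  reach-end (stop w) = w
  reach-end (step _ _ p) = reach-end p

  reach-sym : Symmetric R → ∀ {W : V → Set} {x y} → Reach R W x y → Reach R W y x
  reach-sym sy (stop w) = stop w
  reach-sym sy (step w r p) = reach-trans (reach-sym sy p) (step (reach-start p) (sy r) (stop w))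

-- Menger's theorem
module Menger {V : Set} (_≟_ : DecidableEquality V) where

  open import Data.List.Membership.DecPropositional _≟_ using (_∈?_)
  open import Data.List using (map; filter; take; deduplicate)
  open import Data.List.Properties using (length-take; length-map)
  open import Data.Nat using (_<?_; _≤?_)
  open import Data.Nat.Properties using (≰⇒>; m≤n⇒m⊓n≡m; <-irrefl; ≮⇒≥; suc-injective; ≤-antisym)
  open import Data.List.Relation.Unary.Any.Properties using (map⁻)
  open import Data.List.Membership.Propositional.Properties using (∈-map⁺; ∈-map⁻; ∈-filter⁻; ∈-filter⁺; ∈-deduplicate⁺; ∈-deduplicate⁻)
  import Data.List.Relation.Unary.AllPairs.Properties as AP
  import Data.List.Relation.Unary.AllPairs as AllP
  open import Data.List.Relation.Unary.Unique.DecPropositional.Properties _≟_ using (deduplicate-!)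

  Edges : List (V × V) → V → V → Set
  Edges E x y = (x , y) ∈ E

  EPath : List (V × V) → V → List V → V → Set
  EPath E = Path (Edges E)

  Separates : List (V × V) → List V → List V → List V → Set
  Separates E A B Z = ∀ {a l b} → a ∈ A → b ∈ B → EPath E a l b → ∃ λ z → z ∈ l × z ∈ Z

  record Link (E : List (V × V)) (A B : List V) : Set where
    constructor mkLink
    field
      {src tgt} : V
      {verts}   : List V
      path      : EPath E src verts tgt
      src∈      : src ∈ A
      tgt∈      : tgt ∈ B
  open Link public

  Linkage : List (V × V) → List V → List V → ℕ → Set
  Linkage E A B k = Σ (List (Link E A B)) λ Ls →
    length Ls ≡ k × AllPairs (λ p q → Disjoint (verts p) (verts q)) Ls

  -- The walk is cut at its first vertex in B. The last component records that any other vertex on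
  -- it is reached from a by a walk missing B; `Glue` needs this to contradict a separator.
  firstHit : ∀ {E a l b} (B : List V) → EPath E a l b → b ∈ B →
    Σ V λ b′ → Σ (List V) λ l′ → EPath E a l′ b′ × b′ ∈ B × l′ ⊆ l ×
    (∀ {z} → z ∈ l′ → z ≡ b′ ⊎ Σ (List V) λ l″ → EPath E a l″ z × (∀ {v} → v ∈ l″ → v ∈ l′ × v ∉ B))
  firstHit {a = a} B p b∈ with a ∈? B
  ... | yes a∈ = a , a ∷ [] , [ a ] , a∈ , (λ { (here refl) → head∈ p }) , λ { (here refl) → inj₁ refl }
  firstHit B [ x ] b∈ | no a∉ = ⊥-elim (a∉ b∈)
  firstHit {a = a} B (r ∷ p) b∈ | no a∉ with firstHit B p b∈
  ... | b′ , l′ , p′ , b′∈ , sub , f = b′ , a ∷ l′ , r ∷ p′ , b′∈ ,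
        (λ { (here refl) → here refl ; (there v) → there (sub v) }) , g
    where
    g : ∀ {z} → z ∈ a ∷ l′ → z ≡ b′ ⊎ Σ (List V) λ l″ → EPath _ a l″ z × (∀ {v} → v ∈ l″ → v ∈ a ∷ l′ × v ∉ B)
    g (here refl) = inj₂ (a ∷ [] , [ a ] , λ { (here refl) → here refl , a∉ })
    g (there z∈) with f z∈
    ... | inj₁ e = inj₁ e
    ... | inj₂ (l″ , q , h) = inj₂ (a ∷ l″ , r ∷ q , λ { (here refl) → here refl , a∉
                                                       ; (there v) → there (proj₁ (h v)) , proj₂ (h v) })

  lastHit : ∀ {E a l b} (A : List V) → EPath E a l b → Any (_∈ A) l →
    Σ V λ a′ → Σ (List V) λ l′ → EPath E a′ l′ b × a′ ∈ A × l′ ⊆ l ×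
    (∀ {z} → z ∈ l′ → z ≡ a′ ⊎ Σ (List V) λ l″ → EPath E z l″ b × (∀ {v} → v ∈ l″ → v ∈ l′ × v ∉ A))
  lastHit A [ x ] (here x∈) = x , x ∷ [] , [ x ] , x∈ , (λ v → v) , λ { (here refl) → inj₁ refl }
  lastHit A (_∷_ {x = x} {l = l} r p) any with any? (_∈? A) l
  ... | yes q with lastHit A p q
  ...   | a′ , l′ , p′ , a′∈ , sub , f = a′ , l′ , p′ , a′∈ , (λ v → there (sub v)) , f
  lastHit A (r ∷ p) (there any) | no ¬q = ⊥-elim (¬q any)
  lastHit {E} {b = b} A (_∷_ {x = x} {l = l} r p) (here x∈) | no ¬q =
    x , _ , r ∷ p , x∈ , (λ v → v) , λ { (here refl) → inj₁ refl ; (there z∈) → inj₂ (suffix p ¬q z∈) }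
    where
    suffix : ∀ {y l z} → EPath E y l b → ¬ Any (_∈ A) l → z ∈ l →
             Σ (List V) λ l″ → EPath E z l″ b × (∀ {v} → v ∈ l″ → v ∈ x ∷ l × v ∉ A)
    suffix p ¬q (here refl) with p
    ... | [ _ ] = _ , p , λ { (here refl) → there (here refl) , λ m → ¬q (here m) }
    ... | _ ∷ _ = _ , p , λ v → there v , λ m → ¬q (lose v m)
      where open import Data.List.Membership.Propositional using (lose)
    suffix (r ∷ p) ¬q (there z∈) with suffix p (λ a → ¬q (there a)) z∈
    ... | l″ , q , h = l″ , q , λ v → weaken (proj₁ (h v)) , proj₂ (h v)
      where
      weaken : ∀ {v y m} → v ∈ x ∷ m → v ∈ x ∷ y ∷ m
      weaken (here e) = here e
      weaken (there m) = there (there m)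

  -- If the new edge is used at all, the walk is cut before its first use; `dropEdge-suffix` cuts it
  -- after the last one.
  dropEdge-prefix : ∀ {E x y a l b} → EPath ((x , y) ∷ E) a l b →
    EPath E a l b ⊎ Σ (List V) λ l′ → EPath E a l′ x × l′ ⊆ l
  dropEdge-prefix [ a ] = inj₁ [ a ]
  dropEdge-prefix (here refl ∷ p) = inj₂ (_ , [ _ ] , λ { (here refl) → here refl })
  dropEdge-prefix (there r ∷ p) with dropEdge-prefix p
  ... | inj₁ q = inj₁ (r ∷ q)
  ... | inj₂ (l′ , q , s) = inj₂ (_ , r ∷ q , λ { (here refl) → here refl ; (there v) → there (s v) })

  dropEdge-suffix : ∀ {E x y a l b} → EPath ((x , y) ∷ E) a l b →
    EPath E a l b ⊎ Σ (List V) λ l′ → EPath E y l′ b × l′ ⊆ l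
  dropEdge-suffix [ a ] = inj₁ [ a ]
  dropEdge-suffix (r ∷ p) with dropEdge-suffix p
  ... | inj₂ (l′ , q , s) = inj₂ (l′ , q , λ v → there (s v))
  dropEdge-suffix (here refl ∷ p) | inj₁ q = inj₂ (_ , q , there)
  dropEdge-suffix (there r ∷ p) | inj₁ q = inj₁ (r ∷ q)

  prefixTo : ∀ {E a l b z} → EPath E a l b → z ∈ l → Σ (List V) λ l′ → EPath E a l′ z × l′ ⊆ l
  prefixTo [ a ] (here refl) = _ , [ a ] , λ v → v
  prefixTo (r ∷ p) (here refl) = _ , [ _ ] , λ { (here refl) → here refl }
  prefixTo (r ∷ p) (there z∈) with prefixTo p z∈
  ... | l′ , q , s = _ , r ∷ q , λ { (here refl) → here refl ; (there v) → there (s v) }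

  suffixFrom : ∀ {E a l b z} → EPath E a l b → z ∈ l → Σ (List V) λ l′ → EPath E z l′ b × l′ ⊆ l
  suffixFrom p@([ a ]) (here refl) = _ , p , λ v → v
  suffixFrom p@(r ∷ _) (here refl) = _ , p , λ v → v
  suffixFrom (r ∷ p) (there z∈) with suffixFrom p z∈
  ... | l′ , q , s = l′ , q , λ v → there (s v)

  -- Pigeonhole. In `Glue` it shows that every vertex of x ∷ S is the end of a path of the first
  -- linkage, and every vertex of y ∷ S the start of one of the second.
  covered : ∀ {us vs : List V} → Unique us → us ⊆ vs → length vs ≤ length us → vs ⊆ us
  covered {us} {vs} uniq sub le {v} v∈ with v ∈? us
  ... | yes p = p
  ... | no v∉ with ∈-∃++ v∈
  ... | ys , zs , refl = ⊥-elim (<-irrefl refl (≤-trans (≤-trans (≤-reflexive eq) le) (card uniq sub′)))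
    where
    sub′ : us ⊆ ys ++ zs
    sub′ w∈ with ∈-++⁻ ys (sub w∈)
    ... | inj₁ p = ∈-++⁺ˡ p
    ... | inj₂ (here refl) = ⊥-elim (v∉ w∈)
    ... | inj₂ (there p) = ∈-++⁺ʳ ys p
    eq : suc (length (ys ++ zs)) ≡ length (ys ++ v ∷ zs)
    eq rewrite length-++ ys {zs} | length-++ ys {v ∷ zs} = sym (+-suc (length ys) (length zs))

  weakenE : ∀ {e E a l b} → EPath E a l b → EPath (e ∷ E) a l b
  weakenE [ a ] = [ a ]
  weakenE (r ∷ p) = there r ∷ weakenE p

  -- The step of the induction on edges: S separates A from B once the edge (x , y) is dropped, and
  -- has one vertex too few; the paths of the two linkages meet only in S, where they are glued,
  -- and the two paths at x and y are glued along the edge.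
  module Glue {E A B S x y} {k : ℕ} (sep : Separates E A B S) (len : suc (length S) ≡ k)
              (Ps : Linkage E A (x ∷ S) k) (Qs : Linkage E (y ∷ S) B k) where

    L₁ = proj₁ Ps
    L₂ = proj₁ Qs

    disj₁ : ∀ {p q} → p ∈ L₁ → q ∈ L₁ → tgt p ≢ tgt q → Disjoint (verts p) (verts q)
    disj₁ p∈ q∈ ne with allPairs-lookup (λ {p} {q} → disjoint-sym {l = verts p} {verts q}) (proj₂ (proj₂ Ps)) p∈ q∈
    ... | inj₁ refl = ⊥-elim (ne refl)
    ... | inj₂ d = d

    disj₂ : ∀ {p q} → p ∈ L₂ → q ∈ L₂ → src p ≢ src q → Disjoint (verts p) (verts q)
    disj₂ p∈ q∈ ne with allPairs-lookup (λ {p} {q} → disjoint-sym {l = verts p} {verts q}) (proj₂ (proj₂ Qs)) p∈ q∈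
    ... | inj₁ refl = ⊥-elim (ne refl)
    ... | inj₂ d = d

    ends : List V
    ends = map tgt L₁

    starts : List V
    starts = map src L₂

    ends! : Unique ends
    ends! = AP.map⁺ (AllP.map (λ {p} {q} d e → d (last∈ (path p)) (subst (_∈ verts q) (sym e) (last∈ (path q)))) (proj₂ (proj₂ Ps)))

    starts! : Unique starts
    starts! = AP.map⁺ (AllP.map (λ {p} {q} d e → d (head∈ (path p)) (subst (_∈ verts q) (sym e) (head∈ (path q)))) (proj₂ (proj₂ Qs)))

    ends⊆ : ends ⊆ x ∷ S
    ends⊆ v∈ with ∈-map⁻ tgt v∈
    ... | p , _ , refl = tgt∈ p

    starts⊆ : starts ⊆ y ∷ S
    starts⊆ v∈ with ∈-map⁻ src v∈
    ... | p , _ , refl = src∈ p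

    ends-len : length ends ≡ suc (length S)
    ends-len = trans (length-map tgt L₁) (trans (proj₁ (proj₂ Ps)) (sym len))

    starts-len : length starts ≡ suc (length S)
    starts-len = trans (length-map src L₂) (trans (proj₁ (proj₂ Qs)) (sym len))

    -- Otherwise the k distinct ends would all lie in S, which has only k - 1 vertices.
    x∉S : x ∉ S
    x∉S x∈ = <-irrefl refl (subst (_≤ length S) ends-len (card ends! (λ v∈ → f (ends⊆ v∈))))
      where
      f : ∀ {v} → v ∈ x ∷ S → v ∈ S
      f (here refl) = x∈
      f (there p) = p

    y∉S : y ∉ S
    y∉S y∈ = <-irrefl refl (subst (_≤ length S) starts-len (card starts! (λ v∈ → f (starts⊆ v∈))))
      where
      f : ∀ {v} → v ∈ y ∷ S → v ∈ S
      f (here refl) = y∈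
      f (there p) = p

    endOf : ∀ {v} → v ∈ x ∷ S → ∃ λ p → p ∈ L₁ × v ≡ tgt p
    endOf v∈ = ∈-map⁻ tgt (covered ends! ends⊆ (≤-reflexive (sym ends-len)) v∈)

    startOf : ∀ {v} → v ∈ y ∷ S → ∃ λ q → q ∈ L₂ × v ≡ src q
    startOf v∈ = ∈-map⁻ src (covered starts! starts⊆ (≤-reflexive (sym starts-len)) v∈)

    hit₁ : (p : Link E A (x ∷ S)) → _
    hit₁ p = firstHit (x ∷ S) (path p) (tgt∈ p)

    hit₂ : (q : Link E (y ∷ S) B) → _
    hit₂ q = lastHit (y ∷ S) (path q) (lose (head∈ (path q)) (src∈ q))
      where open import Data.List.Membership.Propositional using (lose)

    cut₁ : Link E A (x ∷ S) → List V
    cut₁ p = proj₁ (proj₂ (hit₁ p))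

    cut₂ : Link E (y ∷ S) B → List V
    cut₂ q = proj₁ (proj₂ (hit₂ q))

    cut₁⊆ : ∀ p → cut₁ p ⊆ verts p
    cut₁⊆ p = proj₁ (proj₂ (proj₂ (proj₂ (proj₂ (hit₁ p)))))

    cut₂⊆ : ∀ q → cut₂ q ⊆ verts q
    cut₂⊆ q = proj₁ (proj₂ (proj₂ (proj₂ (proj₂ (hit₂ q)))))

    -- A first hit other than its own target would be the target of another path of the linkage, but
    -- the paths are disjoint.
    tgt-cut : ∀ {p} → p ∈ L₁ → proj₁ (hit₁ p) ≡ tgt p
    tgt-cut {p} p∈ with hit₁ p
    ... | b , l , pa , b∈ , sub , _ with endOf b∈
    ... | p′ , p′∈ , refl with tgt p′ ≟ tgt p
    ... | yes e = e
    ... | no ne = ⊥-elim (disj₁ p′∈ p∈ ne (last∈ (path p′)) (sub (last∈ pa)))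

    src-cut : ∀ {q} → q ∈ L₂ → proj₁ (hit₂ q) ≡ src q
    src-cut {q} q∈ with hit₂ q
    ... | b , l , pa , b∈ , sub , _ with startOf b∈
    ... | q′ , q′∈ , refl with src q′ ≟ src q
    ... | yes e = e
    ... | no ne = ⊥-elim (disj₂ q′∈ q∈ ne (head∈ (path q′)) (sub (head∈ pa)))

    side₁ : ∀ {p z} → p ∈ L₁ → z ∈ cut₁ p →
      (z ≡ tgt p × z ∈ S) ⊎ (z ∉ S × Σ (List V) λ l → EPath E (src p) l z × (∀ {v} → v ∈ l → v ∉ S))
    side₁ {p} {z} p∈ z∈ with hit₁ p | tgt-cut p∈ | z∈
    ... | b , l , pa , b∈ , sub , f | e | z∈ with f z∈
    ...   | inj₂ (l″ , q , g) = inj₂ ((λ m → proj₂ (g (last∈ q)) (there m)) , l″ , q , λ v m → proj₂ (g v) (there m))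
    ...   | inj₁ refl with b∈
    ...     | there m = inj₁ (e , m)
    ...     | here refl = inj₂ (x∉S , l , pa , clean)
      where
      clean : ∀ {v} → v ∈ l → v ∉ S
      clean v∈ m with f v∈
      ... | inj₁ refl = x∉S m
      ... | inj₂ (l″ , q , g) = proj₂ (g (last∈ q)) (there m)

    side₂ : ∀ {q z} → q ∈ L₂ → z ∈ cut₂ q →
      (z ≡ src q × z ∈ S) ⊎ (z ∉ S × Σ (List V) λ l → EPath E z l (tgt q) × (∀ {v} → v ∈ l → v ∉ S))
    side₂ {q} {z} q∈ z∈ with hit₂ q | src-cut q∈ | z∈
    ... | b , l , pa , b∈ , sub , f | e | z∈ with f z∈
    ...   | inj₂ (l″ , q , g) = inj₂ ((λ m → proj₂ (g (head∈ q)) (there m)) , l″ , q , λ v m → proj₂ (g v) (there m))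
    ...   | inj₁ refl with b∈
    ...     | there m = inj₁ (e , m)
    ...     | here refl = inj₂ (y∉S , l , pa , clean)
      where
      clean : ∀ {v} → v ∈ l → v ∉ S
      clean v∈ m with f v∈
      ... | inj₁ refl = y∉S m
      ... | inj₂ (l″ , q , g) = proj₂ (g (head∈ q)) (there m)

    -- If the two paths met outside S, the part of one before the meeting point and the part of the
    -- other after it would join to a walk from A to B in E that misses S.
    cross : ∀ {p q z} → p ∈ L₁ → q ∈ L₂ → z ∈ cut₁ p → z ∈ cut₂ q → z ≡ tgt p × z ≡ src q × z ∈ S
    cross {p} {q} p∈ q∈ z₁ z₂ with side₁ p∈ z₁ | side₂ q∈ z₂
    ... | inj₁ (e , m) | inj₁ (e′ , _) = e , e′ , m
    ... | inj₁ (_ , m) | inj₂ (m′ , _) = ⊥-elim (m′ m)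
    ... | inj₂ (m′ , _) | inj₁ (_ , m) = ⊥-elim (m′ m)
    ... | inj₂ (_ , l , pa , f) | inj₂ (_ , l′ , pa′ , f′) with join pa pa′
    ...   | m , pq , g with sep (src∈ p) (tgt∈ q) pq
    ...     | v , v∈ , vS with g v∈
    ...       | inj₁ h = ⊥-elim (f h vS)
    ...       | inj₂ h = ⊥-elim (f′ h vS)

    record Glued (p : Link E A (x ∷ S)) : Set where
      field
        partner : Link E (y ∷ S) B
        partner∈ : partner ∈ L₂
        match : (tgt p ≡ x × src partner ≡ y) ⊎ (tgt p ≡ src partner × tgt p ∈ S)
        link : Link ((x , y) ∷ E) A B
        from : ∀ {v} → v ∈ verts link → v ∈ cut₁ p ⊎ v ∈ cut₂ partner
    open Glued

    glue : ∀ {p} → p ∈ L₁ → Glued p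
    glue {p} p∈ with tgt∈ p in eqt
    ... | here e with startOf (here refl)
    ...   | q , q∈ , y≡ = record
      { partner = q ; partner∈ = q∈ ; match = inj₁ (e , sym y≡)
      ; link = mkLink (++-path (weakenE (proj₁ (proj₂ (proj₂ (hit₁ p)))))
                 (here (Data.Product.Properties.×-≡,≡→≡ (trans (tgt-cut p∈) e , trans (src-cut q∈) (sym y≡))))
                 (weakenE (proj₁ (proj₂ (proj₂ (hit₂ q)))))) (src∈ p) (tgt∈ q)
      ; from = ∈-++⁻ (cut₁ p) }
      where import Data.Product.Properties
    glue {p} p∈ | there m with startOf (there m)
    ... | q , q∈ , t≡ with join (subst (EPath E (src p) (cut₁ p)) (trans (tgt-cut p∈) (trans t≡ (sym (src-cut q∈)))) (proj₁ (proj₂ (proj₂ (hit₁ p)))))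
                              (proj₁ (proj₂ (proj₂ (hit₂ q))))
    ...   | l , pq , f = record { partner = q ; partner∈ = q∈ ; match = inj₂ (t≡ , m)
                                ; link = mkLink (weakenE pq) (src∈ p) (tgt∈ q) ; from = f }

    -- First halves are disjoint, and so are second halves. A first half meets a second one only in
    -- S, by `cross`, and there they are the two halves of the same glued path.
    glued-disjoint : ∀ {p p′} (p∈ : p ∈ L₁) (p′∈ : p′ ∈ L₁) → Disjoint (verts p) (verts p′) →
      Disjoint (verts (link (glue p∈))) (verts (link (glue p′∈)))
    glued-disjoint {p} {p′} p∈ p′∈ d v∈ v∈′ = go (from g v∈) (from g′ v∈′)
      where
      g = glue p∈
      g′ = glue p′∈
      tgt≢ : tgt p ≢ tgt p′
      tgt≢ e = d (last∈ (path p)) (subst (_∈ verts p′) (sym e) (last∈ (path p′)))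
      src≢ : src (partner g) ≢ src (partner g′)
      src≢ e with match g | match g′
      ... | inj₁ (a , _) | inj₁ (b , _) = tgt≢ (trans a (sym b))
      ... | inj₁ (_ , a) | inj₂ (b , m) = y∉S (subst (_∈ S) (trans b (trans (sym e) a)) m)
      ... | inj₂ (b , m) | inj₁ (_ , a) = y∉S (subst (_∈ S) (trans b (trans e a)) m)
      ... | inj₂ (a , _) | inj₂ (b , _) = tgt≢ (trans a (trans e (sym b)))
      mixed : ∀ {r r′ v} (r∈ : r ∈ L₁) (G : Glued r′) → tgt r ≢ tgt r′ → v ∈ cut₁ r → v ∈ cut₂ (partner G) → ⊥
      mixed r∈ G ne v₁ v₂ with cross r∈ (partner∈ G) v₁ v₂ | match G
      ... | a , b , m | inj₁ (_ , e) = y∉S (subst (_∈ S) (trans b e) m)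
      ... | a , b , m | inj₂ (e , _) = ne (trans (sym a) (trans b (sym e)))
      go : ∀ {v} → v ∈ cut₁ p ⊎ v ∈ cut₂ (partner g) → v ∈ cut₁ p′ ⊎ v ∈ cut₂ (partner g′) → ⊥
      go (inj₁ a) (inj₁ b) = d (cut₁⊆ p a) (cut₁⊆ p′ b)
      go (inj₁ a) (inj₂ b) = mixed p∈ g′ tgt≢ a b
      go (inj₂ a) (inj₁ b) = mixed p′∈ g (λ e → tgt≢ (sym e)) b a
      go (inj₂ a) (inj₂ b) = disj₂ (partner∈ g) (partner∈ g′) src≢ (cut₂⊆ (partner g) a) (cut₂⊆ (partner g′) b)

    glueAll : ∀ L → (∀ {p} → p ∈ L → p ∈ L₁) → AllPairs (λ p q → Disjoint (verts p) (verts q)) L →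
      Linkage ((x , y) ∷ E) A B (length L)
    glueAll L i ap = proj₁ r , proj₁ (proj₂ r) , proj₁ (proj₂ (proj₂ r))
      where
      go : ∀ L (i : ∀ {p} → p ∈ L → p ∈ L₁) → AllPairs (λ p q → Disjoint (verts p) (verts q)) L →
        Σ (List (Link ((x , y) ∷ E) A B)) λ Ls → length Ls ≡ length L ×
          AllPairs (λ p q → Disjoint (verts p) (verts q)) Ls ×
          (∀ {g} → g ∈ Ls → ∃ λ p → Σ (p ∈ L) λ p∈ → g ≡ link (glue (i p∈)))
      go [] i _ = [] , refl , [] , λ ()
      go (p ∷ L) i (ds ∷ ap) with go L (λ m → i (there m)) ap
      ... | Ls , e , ap′ , f = link (glue (i (here refl))) ∷ Ls , cong suc e ,
            All.tabulate (λ g∈ → h (f g∈)) ∷ ap′ ,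
            λ { (here refl) → p , here refl , refl ; (there g∈) → let (p′ , m , e′) = f g∈ in p′ , there m , e′ }
        where
        h : ∀ {g} → (∃ λ p′ → Σ (p′ ∈ L) λ p∈ → g ≡ link (glue (i (there p∈)))) →
            Disjoint (verts (link (glue (i (here refl))))) (verts g)
        h (p′ , m , refl) = glued-disjoint (i (here refl)) (i (there m)) (All.lookup ds m)
      r = go L i ap

    result : Linkage ((x , y) ∷ E) A B k
    result = subst (Linkage ((x , y) ∷ E) A B) (proj₁ (proj₂ Ps)) (glueAll L₁ (λ m → m) (proj₂ (proj₂ Ps)))

  -- Induction on the directed edges. Let S separate A from B without the edge. Either x fits into
  -- S, or S is just one vertex too small; then a small separator of A from x ∷ S, or of y ∷ S from
  -- B, also separates A from B, and without such separators there are two linkages to glue.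
  menger : ∀ E A B k → Linkage E A B k ⊎ Σ (List V) λ Z → length Z < k × Separates E A B Z
  menger [] A B k with k ≤? length (deduplicate _≟_ (filter (_∈? B) A))
  ... | no k≰ = inj₂ (_ , ≰⇒> k≰ , λ { a∈ b∈ [ a ] → a , here refl , ∈-deduplicate⁺ _≟_ (∈-filter⁺ (_∈? B) a∈ b∈) ; _ _ (() ∷ _) })
  ... | yes k≤ = inj₁ (subst (Linkage [] A B) (trans (length-take k C) (m≤n⇒m⊓n≡m k≤))
                        (triv (take k C) (AP.take⁺ k (deduplicate-! _)) (λ m → ok (take⊆ k m))))
    where
    C = deduplicate _≟_ (filter (_∈? B) A)
    ok : ∀ {v} → v ∈ C → v ∈ A × v ∈ B
    ok m = ∈-filter⁻ (_∈? B) (∈-deduplicate⁻ _≟_ (filter (_∈? B) A) m)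
    take⊆ : ∀ n {l : List V} {v} → v ∈ take n l → v ∈ l
    take⊆ (suc n) {_ ∷ _} (here e) = here e
    take⊆ (suc n) {_ ∷ _} (there m) = there (take⊆ n m)
    triv : ∀ l → Unique l → (∀ {v} → v ∈ l → v ∈ A × v ∈ B) → Linkage [] A B (length l)
    triv l u f = let (Ls , e , ap , _) = go l u f in Ls , e , ap
      where
      go : ∀ l → Unique l → (∀ {v} → v ∈ l → v ∈ A × v ∈ B) → Σ (List (Link [] A B)) λ Ls →
        length Ls ≡ length l × AllPairs (λ p q → Disjoint (verts p) (verts q)) Ls ×
        (∀ {p} → p ∈ Ls → ∀ {v} → v ∈ verts p → v ∈ l)
      go [] _ _ = [] , refl , [] , λ ()
      go (v ∷ l) (ne ∷ u) f with go l u (λ m → f (there m))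
      ... | Ls , e , ap , g = mkLink [ v ] (proj₁ (f (here refl))) (proj₂ (f (here refl))) ∷ Ls , cong suc e ,
            All.tabulate (λ p∈ → λ { (here refl) m → All.lookup ne (g p∈ m) refl }) ∷ ap ,
            λ { (here refl) (here refl) → here refl ; (there p∈) m → there (g p∈ m) }
  menger ((x , y) ∷ E) A B k with menger E A B k
  ... | inj₁ (Ls , e , ap) = inj₁ (Data.List.map wk Ls , trans (length-map wk Ls) e , AP.map⁺ ap)
    where
    import Data.List
    wk : Link E A B → Link ((x , y) ∷ E) A B
    wk p = mkLink (weakenE (path p)) (src∈ p) (tgt∈ p)
  ... | inj₂ (S , lt , sep) with suc (length S) <? k
  ...   | yes lt′ = inj₂ (x ∷ S , lt′ , sep′)
    where
    sep′ : Separates ((x , y) ∷ E) A B (x ∷ S)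
    sep′ a∈ b∈ p with dropEdge-prefix p
    ... | inj₁ q = let (z , z∈ , zS) = sep a∈ b∈ q in z , z∈ , there zS
    ... | inj₂ (l′ , q , s) = x , s (last∈ q) , here refl
  ...   | no ≮ with menger E A (x ∷ S) k | menger E (y ∷ S) B k
  -- A walk from A to B that uses the edge reaches x before, and one that does not meets S. In both
  -- cases an initial part ends in x ∷ S, so it meets Z.
  ...     | inj₂ (Z , ltZ , sepZ) | _ = inj₂ (Z , ltZ , sep′)
    where
    sep′ : Separates ((x , y) ∷ E) A B Z
    sep′ a∈ b∈ p with dropEdge-prefix p
    ... | inj₂ (l′ , q , s) = let (z , z∈ , zZ) = sepZ a∈ (here refl) q in z , s z∈ , zZ
    ... | inj₁ q with sep a∈ b∈ q
    ...   | v , v∈ , vS with prefixTo q v∈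
    ...     | l′ , q′ , s = let (z , z∈ , zZ) = sepZ a∈ (there vS) q′ in z , s z∈ , zZ
  ...     | inj₁ _ | inj₂ (Z , ltZ , sepZ) = inj₂ (Z , ltZ , sep′)
    where
    sep′ : Separates ((x , y) ∷ E) A B Z
    sep′ a∈ b∈ p with dropEdge-suffix p
    ... | inj₂ (l′ , q , s) = let (z , z∈ , zZ) = sepZ (here refl) b∈ q in z , s z∈ , zZ
    ... | inj₁ q with sep a∈ b∈ q
    ...   | v , v∈ , vS with suffixFrom q v∈
    ...     | l′ , q′ , s = let (z , z∈ , zZ) = sepZ (there vS) b∈ q′ in z , s z∈ , zZ
  ...     | inj₁ Ps | inj₁ Qs = inj₁ (Glue.result sep (≤-antisym lt (≮⇒≥ ≮)) Ps Qs)

-- Separated boxes of points in the plane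

-- Opaque, so that case distinctions on it also rewrite the calls of filter.
abstract
  _lt?_ : ∀ m n → Dec (m < n)
  _lt?_ = _<?_

filter-split : ∀ {A : Set} {P : A → Set} (P? : Decidable P) (l : List A) →
               length (filter P? l) + length (filter (λ a → ¬? (P? a)) l) ≡ length l
filter-split P? [] = refl
filter-split P? (a ∷ l) with P? a
... | yes _ = cong suc (filter-split P? l)
... | no _ = trans (+-suc _ _) (cong suc (filter-split P? l))

module Threshold {A : Set} (f : A → ℕ) where

  Distinct : List A → Set
  Distinct = AllPairs (λ a b → f a ≢ f b)

  below : ℕ → List A → List A
  below t = filter (λ a → f a lt? t)

  above : ℕ → List A → List A
  above t = filter (λ a → ¬? (f a lt? t))

  -- Each value is taken at most once, so raising the threshold by one gains at most one element.
  -- Hence `threshold` attains every count in between.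
  below-suc : ∀ t l → Distinct l → length (below (suc t) l) ≤ suc (length (below t l))
  below-suc t [] _ = z≤n
  below-suc t (a ∷ l) (ne ∷ d) with f a lt? suc t | f a lt? t
  ... | yes _ | yes _ = s≤s (below-suc t l d)
  ... | no _ | no _ = below-suc t l d
  ... | no ¬p | yes p = ⊥-elim (¬p (m≤n⇒m≤1+n p))
  ... | yes (s≤s p) | no ¬p = s≤s (≤-reflexive (cong length (same l ne)))
    where
    fa≡ : f a ≡ t
    fa≡ = ≤-antisym p (≮⇒≥ ¬p)
    same : ∀ l → All (λ b → f a ≢ f b) l → below (suc t) l ≡ below t l
    same [] _ = refl
    same (b ∷ l) (ne ∷ nes) with f b lt? suc t | f b lt? t
    ... | yes _ | yes _ = cong (b ∷_) (same l nes)
    ... | no _ | no _ = same l nes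
    ... | no ¬p | yes p = ⊥-elim (¬p (m≤n⇒m≤1+n p))
    ... | yes (s≤s p) | no ¬p = ⊥-elim (ne (trans fa≡ (sym (≤-antisym p (≮⇒≥ ¬p)))))

  threshold : ∀ {l q B} → Distinct l → (∀ {a} → a ∈ l → f a < B) → q ≤ length l →
              ∃ λ t → length (below t l) ≡ q
  threshold {l} {q} {B} d bd q≤ = go B (subst (λ m → q ≤ length m) (sym (filter-all (λ a → f a lt? B) (All.tabulate bd))) q≤)
    where
    none : ∀ l → length (below 0 l) ≡ 0
    none [] = refl
    none (a ∷ l) with f a lt? 0
    ... | no _ = none l
    go : ∀ t → q ≤ length (below t l) → ∃ λ t → length (below t l) ≡ q
    go zero q≤ = 0 , ≤-antisym (≤-trans (≤-reflexive (none l)) z≤n) q≤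
    go (suc t) q≤ with q ≤? length (below t l)
    ... | yes p = go t p
    ... | no ¬p = suc t , ≤-antisym (≤-trans (below-suc t l d) (≰⇒> ¬p)) q≤

module Boxes {A : Set} (x y : A → ℕ) where

  Apart : (A → ℕ) → List A → List A → Set
  Apart f b b′ = (∀ {u v} → u ∈ b → v ∈ b′ → f u < f v) ⊎ (∀ {u v} → u ∈ b → v ∈ b′ → f v < f u)

  -- For rungs this makes the segments of P spanned by the feet disjoint on both sides of the cut.
  Sep : List A → List A → Set
  Sep b b′ = Apart x b b′ × Apart y b b′

  -- A split leaves two boxes, each with only a quarter of the points; `need-eq` has the closed
  -- form.
  need : ℕ → ℕ → ℕ
  need r zero = r
  need r (suc j) = (need r j + need r j) + (need r j + need r j)

  open Threshold

  Box : ℕ → List A → List A → Set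
  Box r l b = r ≤ length b × b ⊆ l × Distinct x b × Distinct y b

  widen : ∀ {r l m b} → m ⊆ l → Box r m b → Box r l b
  widen s (a , b , c) = a , (λ v → s (b v)) , c

  record Quadrants (q : ℕ) (l : List A) : Set where
    field
      m m′ : List A
      box : Box q l m
      box′ : Box q l m′
      sep : Sep m m′

  below⁻ : ∀ {f : A → ℕ} {u t} l → u ∈ below f t l → u ∈ l × f u < t
  below⁻ {f} {t = t} l = ∈-filter⁻ (λ a → f a lt? t) {xs = l}

  above⁻ : ∀ {f : A → ℕ} {u t} l → u ∈ above f t l → u ∈ l × t ≤ f u
  above⁻ {f} {t = t} l m = let (a , b) = ∈-filter⁻ (λ a → ¬? (f a lt? t)) {xs = l} m in a , ≮⇒≥ b

  length-above : ∀ {f : A → ℕ} {t p q} l → p + q ≤ length l → length (below f t l) ≤ p → q ≤ length (above f t l)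
  length-above {f} {t} {p} {q} l le e = +-cancelˡ-≤ p _ _ (≤-trans le (≤-trans (≤-reflexive (sym (filter-split (λ a → f a lt? t) l))) (+-monoˡ-≤ (length (above f t l)) e)))

  -- Split at the x-median, then at the y-median of the left half: one of the two diagonals
  -- keeps a quarter of the points in each of its two quadrants.
  quadrants : ∀ q l {B C} → Distinct x l → Distinct y l → (∀ {a} → a ∈ l → x a < B) → (∀ {a} → a ∈ l → y a < C) →
              (q + q) + (q + q) ≤ length l → Quadrants q l
  quadrants q l dx dy bx by le = cut-x (threshold x dx bx (≤-trans (m≤m+n (q + q) (q + q)) le))
    where
    cut-y : ∀ t s → length (below x t l) ≡ q + q → length (below y s (below x t l)) ≡ q → Quadrants q l
    cut-y t s ex ey = choose (q ≤? length (above y s l₂))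
      where
      l₁ l₂ : List A
      l₁ = below x t l
      l₂ = above x t l
      choose : Dec (q ≤ length (above y s l₂)) → Quadrants q l
      choose (yes p) = record
        { m = below y s l₁ ; m′ = above y s l₂
        ; box = ≤-reflexive (sym ey) , (λ m → proj₁ (below⁻ {x} l (proj₁ (below⁻ {y} l₁ m)))) , AP.filter⁺ _ (AP.filter⁺ _ dx) , AP.filter⁺ _ (AP.filter⁺ _ dy)
        ; box′ = p , (λ m → proj₁ (above⁻ {x} l (proj₁ (above⁻ {y} l₂ m)))) , AP.filter⁺ _ (AP.filter⁺ _ dx) , AP.filter⁺ _ (AP.filter⁺ _ dy)
        ; sep = inj₁ (λ m m′ → <-≤-trans (proj₂ (below⁻ {x} l (proj₁ (below⁻ {y} l₁ m)))) (proj₂ (above⁻ {x} l (proj₁ (above⁻ {y} l₂ m′)))))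
              , inj₁ (λ m m′ → <-≤-trans (proj₂ (below⁻ {y} l₁ m)) (proj₂ (above⁻ {y} l₂ m′))) }
      choose (no ¬p) = record
        { m = above y s l₁ ; m′ = below y s l₂
        ; box = length-above {y} l₁ (≤-reflexive (sym ex)) (≤-reflexive ey) , (λ m → proj₁ (below⁻ {x} l (proj₁ (above⁻ {y} l₁ m)))) , AP.filter⁺ _ (AP.filter⁺ _ dx) , AP.filter⁺ _ (AP.filter⁺ _ dy)
        ; box′ = few-above , (λ m → proj₁ (above⁻ {x} l (proj₁ (below⁻ {y} l₂ m)))) , AP.filter⁺ _ (AP.filter⁺ _ dx) , AP.filter⁺ _ (AP.filter⁺ _ dy)
        ; sep = inj₁ (λ m m′ → <-≤-trans (proj₂ (below⁻ {x} l (proj₁ (above⁻ {y} l₁ m)))) (proj₂ (above⁻ {x} l (proj₁ (below⁻ {y} l₂ m′)))))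
              , inj₂ (λ m m′ → <-≤-trans (proj₂ (below⁻ {y} l₂ m′)) (proj₂ (above⁻ {y} l₁ m))) }
        where
        few-above : q ≤ length (below y s l₂)
        few-above = +-cancelˡ-≤ q _ _ (≤-trans (length-above {x} l le (≤-reflexive ex)) (≤-trans (≤-reflexive (sym (filter-split (λ a → y a lt? s) l₂)))
                      (≤-trans (+-monoʳ-≤ (length (below y s l₂)) (<⇒≤ (≰⇒> ¬p))) (≤-reflexive (+-comm (length (below y s l₂)) q)))))
    cut-x : (∃ λ t → length (below x t l) ≡ q + q) → Quadrants q l
    cut-x (t , ex) = let (s , ey) = threshold y (AP.filter⁺ _ dy) (λ m → by (proj₁ (below⁻ {x} l m))) (≤-trans (m≤m+n q q) (≤-reflexive (sym ex))) in cut-y t s ex ey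

  boxes : ∀ r j l {B C} → Distinct x l → Distinct y l → (∀ {a} → a ∈ l → x a < B) → (∀ {a} → a ∈ l → y a < C) →
          need r j ≤ length l →
          Σ (List (List A)) λ bs → length bs ≡ 2 ^ j × All (Box r l) bs × AllPairs Sep bs
  boxes r zero l dx dy _ _ le = (l ∷ []) , refl , ((le , (λ m → m) , dx , dy) ∷ []) , ([] ∷ [])
  boxes r (suc j) l dx dy bx by le with quadrants (need r j) l dx dy bx by le
  ... | record { m = m ; m′ = m′ ; box = (q≤ , sub , dx₁ , dy₁) ; box′ = (q≤′ , sub′ , dx₂ , dy₂) ; sep = (ax , ay) }
    with boxes r j m dx₁ dy₁ (λ a → bx (sub a)) (λ a → by (sub a)) q≤ | boxes r j m′ dx₂ dy₂ (λ a → bx (sub′ a)) (λ a → by (sub′ a)) q≤′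
  ...   | bs , e , al , ap | bs′ , e′ , al′ , ap′ =
      bs ++ bs′ , trans (length-++ bs) (trans (cong (_+ length bs′) e) (cong (2 ^ j +_) (trans e′ (sym (+-identityʳ _))))) ,
      AllProps.++⁺ (All.map (widen sub) al) (All.map (widen sub′) al′) ,
      AP.++⁺ ap ap′ (All.tabulate λ b∈ → All.tabulate λ b∈′ →
        let s₁ = proj₁ (proj₂ (All.lookup al b∈)) ; s₂ = proj₁ (proj₂ (All.lookup al′ b∈′)) in
        restrict x s₁ s₂ ax , restrict y s₁ s₂ ay)
    where
    restrict : ∀ (f : A → ℕ) {b b′ : List A} → b ⊆ m → b′ ⊆ m′ → Apart f m m′ → Apart f b b′
    restrict f s₁ s₂ (inj₁ h) = inj₁ (λ u v → h (s₁ u) (s₂ v))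
    restrict f s₁ s₂ (inj₂ h) = inj₂ (λ u v → h (s₁ u) (s₂ v))

  need-eq : ∀ r j → need r j ≡ r * (2 ^ j * 2 ^ j)
  need-eq r zero = sym (Data.Nat.Properties.*-identityʳ r)
    where import Data.Nat.Properties
  need-eq r (suc j) rewrite need-eq r j = lem r (2 ^ j)
    where
    open import Data.Nat.Tactic.RingSolver using (solve-∀)
    lem : ∀ r p → (r * (p * p) + r * (p * p)) + (r * (p * p) + r * (p * p)) ≡ r * ((p + (p + 0)) * (p + (p + 0)))
    lem = solve-∀

module _ {A : Set} (f : A → ℕ) where

  argmin : ∀ (a : A) l → ∃ λ m → m ∈ a ∷ l × (∀ {u} → u ∈ a ∷ l → f m ≤ f u)
  argmin a [] = a , here refl , λ { (here refl) → ≤-refl }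
  argmin a (b ∷ l) with argmin b l
  ... | m , m∈ , h with f a ≤? f m
  ... | yes p = a , here refl , λ { (here refl) → ≤-refl ; (there u) → ≤-trans p (h u) }
  ... | no ¬p = m , there m∈ , λ { (here refl) → <⇒≤ (≰⇒> ¬p) ; (there u) → h u }

  argmax : ∀ (a : A) l → ∃ λ m → m ∈ a ∷ l × (∀ {u} → u ∈ a ∷ l → f u ≤ f m)
  argmax a [] = a , here refl , λ { (here refl) → ≤-refl }
  argmax a (b ∷ l) with argmax b l
  ... | m , m∈ , h with f m ≤? f a
  ... | yes p = a , here refl , λ { (here refl) → ≤-refl ; (there u) → ≤-trans (h u) p }
  ... | no ¬p = m , there m∈ , λ { (here refl) → <⇒≤ (≰⇒> ¬p) ; (there u) → h u }

-- Subdivisions and their models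

module _ {S : Graph} {u v : Fin (n S)} where

  IsUV : Fin (n S) → Fin (n S) → Set
  IsUV i j = (i ≡ u × j ≡ v) ⊎ (i ≡ v × j ≡ u)

  subdivide-old⁺ : ∀ {i j} → adj S i j ≡ true → ¬ IsUV i j → adj (subdivide S u v) (suc i) (suc j) ≡ true
  subdivide-old⁺ {i} {j} e ¬uv with adj S i j | i ≟ u | j ≟ v | i ≟ v | j ≟ u
  ... | true | yes p | yes q | _ | _ = ⊥-elim (¬uv (inj₁ (p , q)))
  ... | true | yes _ | no _ | yes p | yes q = ⊥-elim (¬uv (inj₂ (p , q)))
  ... | true | yes _ | no _ | yes p | no q = refl
  ... | true | yes _ | no _ | no p | _ = refl
  ... | true | no _ | _ | yes p | yes q = ⊥-elim (¬uv (inj₂ (p , q)))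
  ... | true | no _ | _ | yes p | no q = refl
  ... | true | no _ | _ | no p | _ = refl

  subdivide-old⁻ : ∀ {i j} → adj (subdivide S u v) (suc i) (suc j) ≡ true → adj S i j ≡ true × ¬ IsUV i j
  subdivide-old⁻ {i} {j} e with adj S i j | i ≟ u | j ≟ v | i ≟ v | j ≟ u | e
  ... | true | yes p | yes q | _ | _ | ()
  ... | true | yes _ | no _ | yes p | yes q | ()
  ... | true | yes _ | no q | yes _ | no q′ | _ = refl , λ { (inj₁ (_ , x)) → q x ; (inj₂ (_ , x)) → q′ x }
  ... | true | yes _ | no q | no p | _ | _ = refl , λ { (inj₁ (_ , x)) → q x ; (inj₂ (x , _)) → p x }
  ... | true | no p | _ | yes _ | yes _ | ()
  ... | true | no p | _ | yes _ | no q | _ = refl , λ { (inj₁ (x , _)) → p x ; (inj₂ (_ , x)) → q x }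
  ... | true | no p | _ | no p′ | _ | _ = refl , λ { (inj₁ (x , _)) → p x ; (inj₂ (x , _)) → p′ x }

  subdivide-new⁺ : ∀ {j} → j ≡ u ⊎ j ≡ v → adj (subdivide S u v) zero (suc j) ≡ true
  subdivide-new⁺ {j} e with j ≟ u | j ≟ v
  ... | yes _ | _ = refl
  ... | no _ | yes _ = refl
  ... | no p | no q = ⊥-elim (Sum.[ p , q ] e)

  subdivide-new⁻ : ∀ {j} → adj (subdivide S u v) zero (suc j) ≡ true → j ≡ u ⊎ j ≡ v
  subdivide-new⁻ {j} e with j ≟ u | j ≟ v | e
  ... | yes p | _ | _ = inj₁ p
  ... | no _ | yes p | _ = inj₂ p
  ... | no _ | no _ | ()

module _ {A : Set} where

  EdgeIn : List (A × A) → A → A → Set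
  EdgeIn es x y = (x , y) ∈ es ⊎ (y , x) ∈ es

  -- The edges of the path with ends u and v and interior l, each directed from u to v; for u = v
  -- they form a cycle.
  chain : A → List A → A → List (A × A)
  chain u [] v = (u , v) ∷ []
  chain u (z ∷ l) v = (u , z) ∷ chain z l v

  edgeIn-map : ∀ {es es′ : List (A × A)} → es ⊆ es′ → ∀ {x y} → EdgeIn es x y → EdgeIn es′ x y
  edgeIn-map s = Sum.map s s

  edgeIn-sym : ∀ {es : List (A × A)} {x y} → EdgeIn es x y → EdgeIn es y x
  edgeIn-sym = Sum.swap

  Within : List A → List (A × A) → Set
  Within vs es = ∀ {x y} → (x , y) ∈ es → x ∈ vs × y ∈ vs

-- A Model is a copy in V of a subdivision of H whose edges are those listed in es.
module Models (H : Graph) {V : Set} where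

  record Model (vs : List V) (es : List (V × V)) : Set where
    field
      S : Graph
      isSubdiv : Subdiv H S
      place : Fin (n S) → V
      place-inj : ∀ {i j} → place i ≡ place j → i ≡ j
      place∈ : ∀ i → place i ∈ vs
      covers : ∀ {x} → x ∈ vs → ∃ λ i → place i ≡ x
      edge⁺ : ∀ {i j} → adj S i j ≡ true → EdgeIn es (place i) (place j)
      edge⁻ : ∀ {i j} → EdgeIn es (place i) (place j) → adj S i j ≡ true
      within : Within vs es

  reorder : ∀ {vs es es′} → es ⊆ es′ → es′ ⊆ es → Model vs es → Model vs es′
  reorder s s′ m = record
    { S = S ; isSubdiv = isSubdiv ; place = place ; place-inj = place-inj ; place∈ = place∈ ; covers = covers
    ; edge⁺ = λ e → edgeIn-map s (edge⁺ e) ; edge⁻ = λ e → edge⁻ (edgeIn-map s′ e) ; within = λ e → within (s′ e) }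
    where open Model m

  -- Subdividing deletes the edge u v, so no second entry for it may be left in es, in either
  -- direction.
  subdivideEdge : ∀ {vs es u v} z → z ∉ vs → ¬ EdgeIn es u v → Model vs ((u , v) ∷ es) →
                  Model (z ∷ vs) ((u , z) ∷ (z , v) ∷ es)
  subdivideEdge {vs} {es} {u} {v} z z∉ ¬dup m with Model.covers m (proj₁ (Model.within m (here refl))) | Model.covers m (proj₂ (Model.within m (here refl)))
  ... | iu , eu | iv , ev = record
    { S = subdivide S iu iv
    ; isSubdiv = step isSubdiv iu iv (edge⁻ (inj₁ (here (cong₂ _,_ eu ev))))
    ; place = pl ; place-inj = λ {i} {j} → pl-inj {i} {j} ; place∈ = λ { zero → here refl ; (suc i) → there (place∈ i) }
    ; covers = λ { (here refl) → zero , refl ; (there x∈) → let (i , e) = covers x∈ in suc i , e }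
    ; edge⁺ = λ {i} {j} → e⁺ {i} {j} ; edge⁻ = λ {i} {j} → e⁻ {i} {j}
    ; within = λ { (here refl) → there u∈ , here refl ; (there (here refl)) → here refl , there v∈
                 ; (there (there e)) → let (a , b) = within (there e) in there a , there b } }
    where
    open Model m
    pl : Fin (suc (n S)) → V
    pl zero = z
    pl (suc i) = place i
    z≢ : ∀ i → z ≢ place i
    z≢ i e = z∉ (subst (_∈ vs) (sym e) (place∈ i))
    pl-inj : ∀ {i j} → pl i ≡ pl j → i ≡ j
    pl-inj {zero} {zero} e = refl
    pl-inj {zero} {suc j} e = ⊥-elim (z≢ j e)
    pl-inj {suc i} {zero} e = ⊥-elim (z≢ i (sym e))
    pl-inj {suc i} {suc j} e = cong suc (place-inj e)
    new = (u , z) ∷ (z , v) ∷ es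
    u∈ : u ∈ vs
    u∈ = proj₁ (within (here refl))
    v∈ : v ∈ vs
    v∈ = proj₂ (within (here refl))
    z≢u : z ≢ u
    z≢u refl = z∉ u∈
    z≢v : z ≢ v
    z≢v refl = z∉ v∈
    e⁺0 : ∀ {j} → j ≡ iu ⊎ j ≡ iv → EdgeIn new z (place j)
    e⁺0 (inj₁ refl) = inj₂ (here (cong (_, z) eu))
    e⁺0 (inj₂ refl) = inj₁ (there (here (cong (z ,_) ev)))
    e⁺ : ∀ {i j} → adj (subdivide S iu iv) i j ≡ true → EdgeIn new (pl i) (pl j)
    e⁺ {zero} {suc j} e = e⁺0 (subdivide-new⁻ {S} {iu} {iv} e)
    e⁺ {suc i} {zero} e = edgeIn-sym {es = new} (e⁺0 (subdivide-new⁻ {S} {iu} {iv} e))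
    e⁺ {suc i} {suc j} e with subdivide-old⁻ {S} {iu} {iv} e
    ... | e′ , ¬uv with edge⁺ e′
    ...   | inj₁ (here eq) = ⊥-elim (¬uv (inj₁ (place-inj (trans (cong proj₁ eq) (sym eu)) , place-inj (trans (cong proj₂ eq) (sym ev)))))
    ...   | inj₂ (here eq) = ⊥-elim (¬uv (inj₂ (place-inj (trans (cong proj₂ eq) (sym ev)) , place-inj (trans (cong proj₁ eq) (sym eu)))))
    ...   | inj₁ (there m) = inj₁ (there (there m))
    ...   | inj₂ (there m) = inj₂ (there (there m))
    z-edge : ∀ {x} → EdgeIn new z x → x ≡ u ⊎ x ≡ v
    z-edge (inj₁ (here eq)) = ⊥-elim (z≢u (cong proj₁ eq))
    z-edge (inj₁ (there (here eq))) = inj₂ (cong proj₂ eq)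
    z-edge (inj₁ (there (there e))) = ⊥-elim (z∉ (proj₁ (within (there e))))
    z-edge (inj₂ (here eq)) = inj₁ (cong proj₁ eq)
    z-edge (inj₂ (there (here eq))) = ⊥-elim (z≢v (cong proj₂ eq))
    z-edge (inj₂ (there (there e))) = ⊥-elim (z∉ (proj₂ (within (there e))))
    old-edge : ∀ {i j} → EdgeIn new (place i) (place j) → EdgeIn es (place i) (place j)
    old-edge (inj₁ (here eq)) = ⊥-elim (z≢ _ (sym (cong proj₂ eq)))
    old-edge (inj₁ (there (here eq))) = ⊥-elim (z≢ _ (sym (cong proj₁ eq)))
    old-edge (inj₁ (there (there e))) = inj₁ e
    old-edge (inj₂ (here eq)) = ⊥-elim (z≢ _ (sym (cong proj₂ eq)))
    old-edge (inj₂ (there (here eq))) = ⊥-elim (z≢ _ (sym (cong proj₁ eq)))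
    old-edge (inj₂ (there (there e))) = inj₂ e
    e⁻ : ∀ {i j} → EdgeIn new (pl i) (pl j) → adj (subdivide S iu iv) i j ≡ true
    e⁻ {zero} {zero} e = ⊥-elim (Sum.[ z≢u , z≢v ] (z-edge e))
    e⁻ {zero} {suc j} e = subdivide-new⁺ {S} {iu} {iv} (Sum.map (λ e → place-inj (trans e (sym eu))) (λ e → place-inj (trans e (sym ev))) (z-edge e))
    e⁻ {suc i} {zero} e = subdivide-new⁺ {S} {iu} {iv} (Sum.map (λ e → place-inj (trans e (sym eu))) (λ e → place-inj (trans e (sym ev))) (z-edge (edgeIn-sym {es = new} e)))
    e⁻ {suc i} {suc j} e with old-edge e
    ... | e′ = subdivide-old⁺ {S} {iu} {iv} (edge⁻ (edgeIn-map there e′))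
          λ { (inj₁ (refl , refl)) → ¬dup (subst₂ (EdgeIn es) eu ev e′)
            ; (inj₂ (refl , refl)) → ¬dup (edgeIn-sym {es = es} (subst₂ (EdgeIn es) ev eu e′)) }

  -- The interior is inserted from u towards v: after z has been placed, the edge to subdivide next
  -- is (z , v), and u ≢ v together with freshness ensures that it is listed only once.
  subdividePath : ∀ {vs es u v} l → Unique l → (∀ {z} → z ∈ l → z ∉ vs) → u ≢ v → ¬ EdgeIn es u v →
                  Model vs ((u , v) ∷ es) → Model (l ++ vs) (chain u l v ++ es)
  subdividePath [] _ _ _ _ m = m
  subdividePath {vs} {es} {u} {v} (z ∷ l) (z∉l ∷ ul) fresh u≢v ¬dup m =
    widen-vs (reorder r₁ r₂ rec)
    where
    m₁ : Model (z ∷ vs) ((z , v) ∷ (u , z) ∷ es)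
    m₁ = reorder sw sw (subdivideEdge z (fresh (here refl)) ¬dup m)
      where
      sw : ∀ {a b : V × V} {es} → (a ∷ b ∷ es) ⊆ (b ∷ a ∷ es)
      sw (here e) = there (here e)
      sw (there (here e)) = here e
      sw (there (there e)) = there (there e)
    u∈ : u ∈ vs
    u∈ = proj₁ (Model.within m (here refl))
    v∈ : v ∈ vs
    v∈ = proj₂ (Model.within m (here refl))
    z≢v : z ≢ v
    z≢v refl = fresh (here refl) v∈
    ¬dup′ : ¬ EdgeIn ((u , z) ∷ es) z v
    ¬dup′ (inj₁ (here eq)) = z≢v (sym (cong proj₂ eq))
    ¬dup′ (inj₂ (here eq)) = u≢v (sym (cong proj₁ eq))
    ¬dup′ (inj₁ (there e)) = fresh (here refl) (proj₁ (Model.within m (there e)))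
    ¬dup′ (inj₂ (there e)) = fresh (here refl) (proj₂ (Model.within m (there e)))
    rec : Model (l ++ z ∷ vs) (chain z l v ++ (u , z) ∷ es)
    rec = subdividePath l ul (λ { w∈ (here refl) → All.lookup z∉l w∈ refl ; w∈ (there w) → fresh (there w∈) w }) z≢v ¬dup′ m₁
    r₁ : (chain z l v ++ (u , z) ∷ es) ⊆ ((u , z) ∷ chain z l v ++ es)
    r₁ e with ∈-++⁻ (chain z l v) e
    ... | inj₁ a = there (∈-++⁺ˡ a)
    ... | inj₂ (here a) = here a
    ... | inj₂ (there a) = there (∈-++⁺ʳ (chain z l v) a)
    r₂ : ((u , z) ∷ chain z l v ++ es) ⊆ (chain z l v ++ (u , z) ∷ es)
    r₂ (here a) = ∈-++⁺ʳ (chain z l v) (here a)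
    r₂ (there e) with ∈-++⁻ (chain z l v) e
    ... | inj₁ a = ∈-++⁺ˡ a
    ... | inj₂ a = ∈-++⁺ʳ (chain z l v) (there a)
    v₁ : (l ++ z ∷ vs) ⊆ (z ∷ l ++ vs)
    v₁ e with ∈-++⁻ l e
    ... | inj₁ a = there (∈-++⁺ˡ a)
    ... | inj₂ (here a) = here a
    ... | inj₂ (there a) = there (∈-++⁺ʳ l a)
    v₂ : (z ∷ l ++ vs) ⊆ (l ++ z ∷ vs)
    v₂ (here a) = ∈-++⁺ʳ l (here a)
    v₂ (there e) with ∈-++⁻ l e
    ... | inj₁ a = ∈-++⁺ˡ a
    ... | inj₂ a = ∈-++⁺ʳ l (there a)
    widen-vs : ∀ {es} → Model (l ++ z ∷ vs) es → Model (z ∷ l ++ vs) es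
    widen-vs m = record
      { S = S ; isSubdiv = isSubdiv ; place = place ; place-inj = place-inj ; place∈ = λ i → v₁ (place∈ i)
      ; covers = λ x∈ → covers (v₂ x∈) ; edge⁺ = edge⁺ ; edge⁻ = edge⁻
      ; within = λ e → let (a , b) = within e in v₁ a , v₁ b }
      where open Model m

  baseModel : (es : List (Fin (n H) × Fin (n H))) →
    (∀ {i j} → adj H i j ≡ true → EdgeIn es i j) → (∀ {i j} → EdgeIn es i j → adj H i j ≡ true) →
    (f : Fin (n H) → V) → (∀ {i j} → f i ≡ f j → i ≡ j) →
    Model (tabulate f) (map (λ e → f (proj₁ e) , f (proj₂ e)) es)
  baseModel es h⁺ h⁻ f inj = record
    { S = H ; isSubdiv = base ; place = f ; place-inj = inj ; place∈ = ∈-tabulate⁺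
    ; covers = λ x∈ → let (i , e) = ∈-tabulate⁻ x∈ in i , sym e
    ; edge⁺ = λ e → Sum.map (∈-map⁺ _) (∈-map⁺ _) (h⁺ e)
    ; edge⁻ = λ e → h⁻ (Sum.map back back e)
    ; within = λ e → let (p , _ , eq) = ∈-map⁻ _ e in
        subst (_∈ tabulate f) (sym (cong proj₁ eq)) (∈-tabulate⁺ _) , subst (_∈ tabulate f) (sym (cong proj₂ eq)) (∈-tabulate⁺ _) }
    where
    back : ∀ {i j} → (f i , f j) ∈ map (λ e → f (proj₁ e) , f (proj₂ e)) es → (i , j) ∈ es
    back {i} {j} e with ∈-map⁻ _ e
    ... | (i′ , j′) , m , eq rewrite inj {i} {i′} (cong proj₁ eq) | inj {j} {j′} (cong proj₂ eq) = m

-- Objects of a graph and the search for them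

module Objects (H G : Graph) where

  image : InducedSubdiv H G → List (Fin (n G))
  image c = tabulate (φ (emb c))

  image-unique : ∀ c → Unique (image c)
  image-unique c = tabulate⁺ (inj (emb c))

  open Models H {Fin (n G)}

  modelObject : ∀ {vs es} → Model vs es →
    (∀ {x y} → x ∈ vs → y ∈ vs → adj G x y ≡ true → EdgeIn es x y) →
    (∀ {x y} → EdgeIn es x y → adj G x y ≡ true) →
    Σ (InducedSubdiv H G) λ c → image c ⊆ vs
  modelObject {vs} m h⁺ h⁻ = c , λ m → let (i , e) = ∈-tabulate⁻ m in subst (_∈ vs) (sym e) (place∈ i)
    where
    open Model m
    bool-eq : ∀ {a b : Bool} → (a ≡ true → b ≡ true) → (b ≡ true → a ≡ true) → a ≡ b
    bool-eq {true} {b} f g = sym (f refl)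
    bool-eq {false} {false} f g = refl
    bool-eq {false} {true} f g = g refl
    c : InducedSubdiv H G
    c = record { sub = S ; isSub = isSubdiv ; emb = record { φ = place ; inj = place-inj
               ; pres = λ i j → bool-eq (λ e → edge⁻ (h⁺ (place∈ i) (place∈ j) e)) (λ e → h⁻ (edge⁺ e)) } }

module Search (H G : Graph) where

  open Objects H G

  private
    V = Fin (n G)

  anyVec? : ∀ k {P : Vec V k → Set} → Decidable P → Dec (∃ P)
  anyVec? zero P? = map′ ([] ,_) (λ { ([] , p) → p }) (P? [])
  anyVec? (suc k) P? = map′ (λ { (x , v , p) → x ∷ v , p }) (λ { (x ∷ v , p) → x , v , p })
                            (Fin.any? (λ x → anyVec? k (λ v → P? (x ∷ v))))

  module _ {Q : List V → Set} (Q? : Decidable Q) where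

    Embeds : Graph → Set
    Embeds S = Σ (InducedEmb S G) λ e → Q (tabulate (φ e))

    embeds? : ∀ S → Dec (Embeds S)
    embeds? S = map′ to from (anyVec? (n S) {P} P?)
      where
      P : Vec V (n S) → Set
      P f = (∀ i j → Vec.lookup f i ≡ Vec.lookup f j → i ≡ j) × (∀ i j → adj G (Vec.lookup f i) (Vec.lookup f j) ≡ adj S i j) × Q (tabulate (Vec.lookup f))
      P? : Decidable P
      P? f = Fin.all? (λ i → Fin.all? (λ j → (Vec.lookup f i ≟ Vec.lookup f j) →-dec (i ≟ j)))
             ×-dec Fin.all? (λ i → Fin.all? (λ j → adj G (Vec.lookup f i) (Vec.lookup f j) Bool.≟ adj S i j))
             ×-dec Q? (tabulate (Vec.lookup f))
      to : ∃ P → Embeds S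
      to (f , i , p , q) = record { φ = Vec.lookup f ; inj = λ {x} {y} → i x y ; pres = p } , q
      from : Embeds S → ∃ P
      from (e , q) = f , (λ i j eq → inj e (trans (sym (lk i)) (trans eq (lk j)))) ,
          (λ i j → trans (cong₂ (adj G) (lk i) (lk j)) (pres e i j)) , subst Q (tabulate-cong (λ i → sym (lk i))) q
        where
        f = Vec.tabulate (φ e)
        lk = lookup∘tabulate (φ e)

    Extends : ℕ → Graph → Set
    Extends zero S = Embeds S
    Extends (suc f) S = Embeds S ⊎ ∃ λ u → ∃ λ v → adj S u v ≡ true × Extends f (subdivide S u v)

    extends? : ∀ f S → Dec (Extends f S)
    extends? zero S = embeds? S
    extends? (suc f) S = embeds? S ⊎-dec Fin.any? (λ u → Fin.any? (λ v → (adj S u v Bool.≟ true) ×-dec extends? f (subdivide S u v)))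

    sound : ∀ f {S} → Subdiv H S → Extends f S → Σ (InducedSubdiv H G) (Q ∘ image)
    sound zero d (e , q) = record { sub = _ ; isSub = d ; emb = e } , q
    sound (suc f) d (inj₁ (e , q)) = record { sub = _ ; isSub = d ; emb = e } , q
    sound (suc f) d (inj₂ (u , v , a , x)) = sound f (step d u v a) x

    steps : ∀ {S} → Subdiv H S → ℕ
    steps base = 0
    steps (step d _ _ _) = suc (steps d)

    steps-size : ∀ {S} (d : Subdiv H S) → steps d + n H ≡ n S
    steps-size base = refl
    steps-size (step d _ _ _) = cong suc (steps-size d)

    extends-start : ∀ {S} (d : Subdiv H S) f → Extends f S → Extends (steps d + f) H
    extends-start base f e = e
    extends-start (step d u v a) f e = subst (λ m → Extends m H) (+-suc (steps d) f) (extends-start d (suc f) (inj₂ (u , v , a , e)))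

    embeds⇒extends : ∀ f {S} → Embeds S → Extends f S
    embeds⇒extends zero e = e
    embeds⇒extends (suc f) e = inj₁ e

    -- Each subdivision adds a vertex and embeddings are injective, so `n G` subdivisions are enough
    -- to try. This takes the place of excluded middle wherever the proof asks whether an object
    -- exists.
    searchObject : Dec (Σ (InducedSubdiv H G) (Q ∘ image))
    searchObject = map′ (sound (n G) base) complete (extends? (n G) H)
      where
      complete : Σ (InducedSubdiv H G) (Q ∘ image) → Extends (n G) H
      complete (c , q) = subst (λ m → Extends m H) (m+[n∸m]≡n le) (extends-start d (n G ℕ.∸ steps d) (embeds⇒extends (n G ℕ.∸ steps d) (emb c , q)))
        where
        d = isSub c
        le : steps d ≤ n G
        le = ≤-trans (m≤m+n (steps d) (n H)) (≤-trans (≤-reflexive (steps-size d)) (Fin.injective⇒≤ (inj (emb c))))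

-- Spines of subdivisions

module _ {A : Set} where

  data Consec (i j : A) : List A → Set where
    here : ∀ {l} → Consec i j (i ∷ j ∷ l)
    there : ∀ {x l} → Consec i j l → Consec i j (x ∷ l)

  consec∈ˡ : ∀ {i j l} → Consec i j l → i ∈ l
  consec∈ˡ here = here refl
  consec∈ˡ (there c) = there (consec∈ˡ c)

  consec∈ʳ : ∀ {i j l} → Consec i j l → j ∈ l
  consec∈ʳ here = there (here refl)
  consec∈ʳ (there c) = there (consec∈ʳ c)

  consec? : DecidableEquality A → ∀ i j l → Dec (Consec i j l)
  consec? _≟_ i j [] = no λ ()
  consec? _≟_ i j (x ∷ []) = no λ { (there ()) }
  consec? _≟_ i j (x ∷ y ∷ l) with i ≟ x | j ≟ y | consec? _≟_ i j (y ∷ l)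
  ... | _ | _ | yes c = yes (there c)
  ... | yes refl | yes refl | _ = yes here
  ... | no p | _ | no q = no λ { here → p refl ; (there c) → q c }
  ... | yes _ | no p | no q = no λ { here → p refl ; (there c) → q c }

  SamePair : A → A → A → A → Set
  SamePair i j x a = (i ≡ x × j ≡ a) ⊎ (i ≡ a × j ≡ x)

-- A Hamiltonian path from x to y such that every edge outside the path is x a or y b.
record Spine (S : Graph) : Set where
  constructor mkSpine
  field
    {x y a b} : Fin (n S)
    {l}       : List (Fin (n S))
    path      : Path (λ i j → adj S i j ≡ true) x l y
    uniq      : Unique l
    cover     : ∀ i → i ∈ l
    edges     : ∀ i j → adj S i j ≡ true → (Consec i j l ⊎ Consec j i l) ⊎ (SamePair i j x a ⊎ SamePair i j y b)

module SubdivideSpine {S : Graph} {u v : Fin (n S)} where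

  S′ : Graph
  S′ = subdivide S u v

  Adj′ : Fin (suc (n S)) → Fin (suc (n S)) → Set
  Adj′ i j = adj S′ i j ≡ true

  Adj : Fin (n S) → Fin (n S) → Set
  Adj i j = adj S i j ≡ true

  IsUV′ = IsUV {S} {u} {v}

  map-path : ∀ {x l y} → Path Adj x l y → (∀ {i j} → Consec i j l → ¬ IsUV′ i j) → Path Adj′ (suc x) (map suc l) (suc y)
  map-path [ x ] _ = [ _ ]
  map-path (r ∷ p) f = subdivide-old⁺ {S} {u} {v} r (f (c p)) ∷ map-path p (λ c → f (there c))
    where
    c : ∀ {x z l y} → Path Adj z l y → Consec x z (x ∷ l)
    c [ _ ] = here
    c (_ ∷ _) = here

  map-unique : ∀ {l : List (Fin (n S))} → Unique l → Unique (map suc l)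
  map-unique = map⁺ Fin.suc-injective

  consec-map : ∀ {i j : Fin (n S)} {l} → Consec i j l → Consec (Fin.suc i) (suc j) (map suc l)
  consec-map here = here
  consec-map (there c) = there (consec-map c)

  consec-snoc : ∀ {A : Set} {i j y : A} {l} → Consec i j l → Consec i j (l ++ y ∷ [])
  consec-snoc here = here
  consec-snoc (there c) = there (consec-snoc c)

  zero∉ : ∀ {l : List (Fin (n S))} → All (λ w → Fin.zero ≢ w) (map suc l)
  zero∉ = All.tabulate λ m e → case (∈-map⁻ suc m) e
    where
    case : ∀ {w} {l : List (Fin (n S))} → (∃ λ i → i ∈ l × w ≡ suc i) → zero ≢ w
    case (_ , _ , refl) ()

  record Inserted (x : Fin (n S)) (l : List (Fin (n S))) (y p q : Fin (n S)) : Set where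
    field
      {l′} : List (Fin (suc (n S)))
      path′ : Path Adj′ (suc x) l′ (suc y)
      uniq′ : Unique l′
      zero∈ : zero ∈ l′
      old∈ : ∀ {i} → i ∈ l → suc i ∈ l′
      from : ∀ {w} → w ∈ l′ → w ≡ zero ⊎ ∃ λ i → i ∈ l × w ≡ suc i
      keep : ∀ {i j} → Consec i j l → ¬ (i ≡ p × j ≡ q) → Consec (suc i) (suc j) l′
      new₁ : Consec (suc p) zero l′
      new₂ : Consec zero (suc q) l′

  -- As l has no repetitions, the step from p to q occurs once, and all other steps of the path
  -- survive the subdivision.
  insert : ∀ {x l y p q} → (∀ {i j} → IsUV′ i j → SamePair i j p q) → Adj′ (suc p) zero → Adj′ zero (suc q) →
           Path Adj x l y → Unique l → Consec p q l → Inserted x l y p q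
  insert {p = p} {q} h e₁ e₂ (r ∷ pt) ((p≢q ∷ p∉) ∷ un) (here {l}) = record
    { path′ = hd pt e₁ e₂ (map-path pt nolink)
    ; uniq′ = ((λ ()) ∷ AllProps.map⁺ (All.map (λ ne e → ne (Fin.suc-injective e)) (p≢q ∷ p∉))) ∷ zero∉ {q ∷ l} ∷ map-unique un
    ; zero∈ = there (here refl)
    ; old∈ = λ { (here refl) → here refl ; (there m) → there (there (∈-map⁺ suc m)) }
    ; from = λ { (here refl) → inj₂ (p , here refl , refl) ; (there (here refl)) → inj₁ refl
               ; (there (there m)) → let (i , i∈ , e) = ∈-map⁻ suc m in inj₂ (i , there i∈ , e) }
    ; keep = λ { here ne → ⊥-elim (ne (refl , refl)) ; (there c) _ → there (there (consec-map c)) }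
    ; new₁ = here ; new₂ = there here }
    where
    nolink : ∀ {i j} → Consec i j (q ∷ l) → ¬ IsUV′ i j
    nolink c e with h e
    ... | inj₁ (refl , _) = All.lookup (p≢q ∷ p∉) (consec∈ˡ c) refl
    ... | inj₂ (_ , refl) = All.lookup (p≢q ∷ p∉) (consec∈ʳ c) refl
    hd : ∀ {z y} → Path Adj z (q ∷ l) y → Adj′ (suc p) zero → Adj′ zero (suc q) → Path Adj′ (suc z) (map suc (q ∷ l)) (suc y) →
         Path Adj′ (suc p) (suc p ∷ zero ∷ map suc (q ∷ l)) (suc y)
    hd [ _ ] a b p = a ∷ b ∷ p
    hd (_ ∷ _) a b p = a ∷ b ∷ p
  insert {x = x} {p = p} {q} h e₁ e₂ (_∷_ {y = z} r pt) (x∉ ∷ un) (there c) = record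
    { path′ = subdivide-old⁺ {S} {u} {v} r ¬uv ∷ path′
    ; uniq′ = All.tabulate x∉′ ∷ uniq′
    ; zero∈ = there zero∈
    ; old∈ = λ { (here refl) → here refl ; (there m) → there (old∈ m) }
    ; from = λ { (here refl) → inj₂ (x , here refl , refl) ; (there m) → Sum.map₂ (λ { (i , i∈ , e) → i , there i∈ , e }) (from m) }
    ; keep = keep′ pt path′ keep
    ; new₁ = there new₁ ; new₂ = there new₂ }
    where
    rec = insert h e₁ e₂ pt un c
    open Inserted rec
    ¬uv : ¬ IsUV′ x z
    ¬uv e with h e
    ... | inj₁ (refl , _) = All.lookup x∉ (consec∈ˡ c) refl
    ... | inj₂ (refl , _) = All.lookup x∉ (consec∈ʳ c) refl
    x∉′ : ∀ {w} → w ∈ l′ → suc x ≢ w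
    x∉′ m refl with from m
    ... | inj₂ (i , i∈ , e) = All.lookup x∉ i∈ (Fin.suc-injective e)
    keep′ : ∀ {z l l′ y} → Path Adj z l y → Path Adj′ (suc z) l′ (suc y) →
      (∀ {i j} → Consec i j l → ¬ (i ≡ p × j ≡ q) → Consec (suc i) (suc j) l′) →
      ∀ {i j} → Consec i j (x ∷ l) → ¬ (i ≡ p × j ≡ q) → Consec (suc i) (suc j) (suc x ∷ l′)
    keep′ _ pt′ k (there c) ne = there (k c ne)
    keep′ [ _ ] [ _ ] k here ne = here
    keep′ [ _ ] (_ ∷ _) k here ne = here
    keep′ (_ ∷ _) [ _ ] k here ne = here
    keep′ (_ ∷ _) (_ ∷ _) k here ne = here

  -- The pair (p , q) is (u , v) or (v , u), according to the direction in which the path runs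
  -- through the edge.
  inserted : (sp : Spine S) → ∀ {p q} → (∀ {i j} → IsUV′ i j → SamePair i j p q) → IsUV′ p q → p ≡ u ⊎ p ≡ v → q ≡ u ⊎ q ≡ v →
             (∀ {j} → j ≡ u ⊎ j ≡ v → j ≡ p ⊎ j ≡ q) → Consec p q (Spine.l sp) → Spine S′
  inserted sp {p} {q} h pq pu qu uvpq c = mkSpine {x = suc x} {suc y} {suc a} {suc b} path′ uniq′ (λ { zero → zero∈ ; (suc i) → old∈ (cover i) }) edges′
    where
    open Spine sp
    rec = insert h (subdivide-new⁺ {S} {u} {v} pu) (subdivide-new⁺ {S} {u} {v} qu) path uniq c
    open Inserted rec
    edges₀ : ∀ {j} → j ≡ p ⊎ j ≡ q → Consec zero (suc j) l′ ⊎ Consec (suc j) zero l′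
    edges₀ (inj₁ refl) = inj₂ new₁
    edges₀ (inj₂ refl) = inj₁ new₂
    sc : ∀ {i j x a} → SamePair {Fin (n S)} i j x a → SamePair (Fin.suc i) (suc j) (suc x) (suc a)
    sc = Sum.map (λ (e , e′) → cong suc e , cong suc e′) (λ (e , e′) → cong suc e , cong suc e′)
    edges′ : ∀ i j → Adj′ i j → (Consec i j l′ ⊎ Consec j i l′) ⊎ (SamePair i j (suc x) (suc a) ⊎ SamePair i j (suc y) (suc b))
    edges′ zero (suc j) e = inj₁ (edges₀ (uvpq (subdivide-new⁻ {S} {u} {v} e)))
    edges′ (suc i) zero e = inj₁ (Sum.swap (edges₀ (uvpq (subdivide-new⁻ {S} {u} {v} e))))
    edges′ (suc i) (suc j) e with subdivide-old⁻ {S} {u} {v} e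
    ... | e′ , ¬uv with edges i j e′
    ...   | inj₁ (inj₁ c′) = inj₁ (inj₁ (keep c′ λ { (refl , refl) → ¬uv pq }))
    ...   | inj₁ (inj₂ c′) = inj₁ (inj₂ (keep c′ λ { (refl , refl) → ¬uv (Sum.swap (Sum.map (λ (a , b) → b , a) (λ (a , b) → b , a) pq)) }))
    ...   | inj₂ (inj₁ s) = inj₂ (inj₁ (sc s))
    ...   | inj₂ (inj₂ s) = inj₂ (inj₂ (sc s))

  snoc-path : ∀ {A : Set} {R : A → A → Set} {x l y z} → Path R x l y → R y z → Path R x (l ++ z ∷ []) z
  snoc-path p r = ++-path p r [ _ ]

  -- Subdividing an edge of the path keeps the chords. Subdividing the chord x a turns it into a
  -- path edge from x to the new vertex and a chord from there to a, so that there is again at most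
  -- one chord at either end.
  subdivideSpine : Adj u v → Spine S → Spine S′
  subdivideSpine uv sp with consec? _≟_ u v (Spine.l sp) | consec? _≟_ v u (Spine.l sp)
  ... | yes c | _ = inserted sp id (inj₁ (refl , refl)) (inj₁ refl) (inj₂ refl) id c
  ... | no _ | yes c = inserted sp Sum.swap (inj₂ (refl , refl)) (inj₂ refl) (inj₁ refl) Sum.swap c
  ... | no ¬c | no ¬c′ = case (edges u v uv)
    where
    open Spine sp
    nolink : ∀ {i j} → Consec i j l → ¬ IsUV′ i j
    nolink c (inj₁ (refl , refl)) = ¬c c
    nolink c (inj₂ (refl , refl)) = ¬c′ c
    l₁ = map suc l
    mp = map-path path nolink
    sc : ∀ {i j x a} → SamePair {Fin (n S)} i j x a → SamePair (Fin.suc i) (suc j) (suc x) (suc a)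
    sc = Sum.map (λ (e , e′) → cong suc e , cong suc e′) (λ (e , e′) → cong suc e , cong suc e′)
    swap-pair : ∀ {x a i j : Fin (n S)} → SamePair u v x a → SamePair i j x a → IsUV′ i j
    swap-pair (inj₁ (refl , refl)) t = t
    swap-pair (inj₂ (refl , refl)) t = Sum.swap t
    -- the new vertex becomes the new end of the path
    module Front (s : SamePair u v x a) where
      cs : Consec zero (suc x) (zero ∷ l₁)
      cs = hd mp
        where
        hd : ∀ {z l y} → Path Adj′ z l y → Consec zero z (zero ∷ l)
        hd [ _ ] = here
        hd (_ ∷ _) = here
      E : ∀ {j} → j ≡ u ⊎ j ≡ v → j ≡ x ⊎ j ≡ a
      E = λ { (inj₁ refl) → Sum.map proj₁ proj₁ s ; (inj₂ refl) → Sum.swap (Sum.map proj₂ proj₂ s) }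
      edges₀ : ∀ {j} → j ≡ x ⊎ j ≡ a → Consec zero (suc j) (zero ∷ l₁) ⊎ (j ≡ a)
      edges₀ (inj₁ refl) = inj₁ cs
      edges₀ (inj₂ e) = inj₂ e
      xa : Adj′ zero (suc x)
      xa = subdivide-new⁺ {S} {u} {v} (Sum.map (λ p → sym (proj₁ p)) (λ p → sym (proj₂ p)) s)
      is-uv : ∀ {i j} → SamePair i j x a → IsUV′ i j
      is-uv = swap-pair s
      edges′ : ∀ i j → Adj′ i j → (Consec i j (zero ∷ l₁) ⊎ Consec j i (zero ∷ l₁)) ⊎ (SamePair i j zero (suc a) ⊎ SamePair i j (suc y) (suc b))
      edges′ zero (suc j) e with edges₀ (E (subdivide-new⁻ {S} {u} {v} e))
      ... | inj₁ c = inj₁ (inj₁ c)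
      ... | inj₂ refl = inj₂ (inj₁ (inj₁ (refl , refl)))
      edges′ (suc i) zero e with edges₀ (E (subdivide-new⁻ {S} {u} {v} e))
      ... | inj₁ c = inj₁ (inj₂ c)
      ... | inj₂ refl = inj₂ (inj₁ (inj₂ (refl , refl)))
      edges′ (suc i) (suc j) e with subdivide-old⁻ {S} {u} {v} e
      ... | e′ , ¬uv with edges i j e′
      ...   | inj₁ c = inj₁ (Sum.map (there ∘ consec-map) (there ∘ consec-map) c)
      ...   | inj₂ (inj₁ t) = ⊥-elim (¬uv (is-uv t))
      ...   | inj₂ (inj₂ t) = inj₂ (inj₂ (sc t))
      spine : Spine S′
      spine = mkSpine {x = zero} {suc y} {suc a} {suc b} (xa ∷ mp) (zero∉ {l} ∷ map-unique uniq)
                (λ { zero → here refl ; (suc i) → there (∈-map⁺ suc (cover i)) }) edges′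
    module Back (s : SamePair u v y b) where
      l₂ = l₁ ++ zero ∷ []
      cs : Consec (suc y) zero l₂
      cs = lst mp
        where
        lst : ∀ {z l y} → Path Adj′ z l y → Consec y zero (l ++ zero ∷ [])
        lst [ _ ] = here
        lst (_ ∷ p) = there (lst p)
      E : ∀ {j} → j ≡ u ⊎ j ≡ v → j ≡ y ⊎ j ≡ b
      E = λ { (inj₁ refl) → Sum.map proj₁ proj₁ s ; (inj₂ refl) → Sum.swap (Sum.map proj₂ proj₂ s) }
      edges₀ : ∀ {j} → j ≡ y ⊎ j ≡ b → Consec (suc j) zero l₂ ⊎ (j ≡ b)
      edges₀ (inj₁ refl) = inj₁ cs
      edges₀ (inj₂ e) = inj₂ e
      ya : Adj′ (suc y) zero
      ya = subdivide-new⁺ {S} {u} {v} (Sum.map (λ p → sym (proj₁ p)) (λ p → sym (proj₂ p)) s)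
      is-uv : ∀ {i j} → SamePair i j y b → IsUV′ i j
      is-uv = swap-pair s
      edges′ : ∀ i j → Adj′ i j → (Consec i j l₂ ⊎ Consec j i l₂) ⊎ (SamePair i j (suc x) (suc a) ⊎ SamePair i j zero (suc b))
      edges′ zero (suc j) e with edges₀ (E (subdivide-new⁻ {S} {u} {v} e))
      ... | inj₁ c = inj₁ (inj₂ c)
      ... | inj₂ refl = inj₂ (inj₂ (inj₁ (refl , refl)))
      edges′ (suc i) zero e with edges₀ (E (subdivide-new⁻ {S} {u} {v} e))
      ... | inj₁ c = inj₁ (inj₁ c)
      ... | inj₂ refl = inj₂ (inj₂ (inj₂ (refl , refl)))
      edges′ (suc i) (suc j) e with subdivide-old⁻ {S} {u} {v} e
      ... | e′ , ¬uv with edges i j e′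
      ...   | inj₁ c = inj₁ (Sum.map (consec-snoc ∘ consec-map) (consec-snoc ∘ consec-map) c)
      ...   | inj₂ (inj₁ t) = inj₂ (inj₁ (sc t))
      ...   | inj₂ (inj₂ t) = ⊥-elim (¬uv (is-uv t))
      spine : Spine S′
      spine = mkSpine {x = suc x} {zero} {suc a} {suc b} (snoc-path mp ya)
                (AP.++⁺ (map-unique uniq) ([] ∷ []) (All.map (λ ne → (λ e → ne (sym e)) ∷ []) (zero∉ {l})))
                (λ { zero → ∈-++⁺ʳ l₁ (here refl) ; (suc i) → ∈-++⁺ˡ (∈-map⁺ suc (cover i)) }) edges′
    case : (Consec u v l ⊎ Consec v u l) ⊎ (SamePair u v x a ⊎ SamePair u v y b) → Spine S′
    case (inj₁ (inj₁ c)) = ⊥-elim (¬c c)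
    case (inj₁ (inj₂ c)) = ⊥-elim (¬c′ c)
    case (inj₂ (inj₁ s)) = Front.spine s
    case (inj₂ (inj₂ s)) = Back.spine s

subdivSpine : ∀ {H S} → Spine H → Subdiv H S → Spine S
subdivSpine s base = s
subdivSpine s (step d u v e) = SubdivideSpine.subdivideSpine e (subdivSpine s d)

spineEdges? : (H : Graph) (l : List (Fin (n H))) (x y a b : Fin (n H)) →
  Dec (∀ i j → adj H i j ≡ true → (Consec i j l ⊎ Consec j i l) ⊎ (SamePair i j x a ⊎ SamePair i j y b))
spineEdges? H l x y a b = Fin.all? λ i → Fin.all? λ j → (adj H i j Bool.≟ true) →-dec
  ((consec? _≟_ i j l ⊎-dec consec? _≟_ j i l) ⊎-dec (same? i j x a ⊎-dec same? i j y b))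
  where
  same? : ∀ i j x a → Dec (SamePair i j x a)
  same? i j x a = ((i ≟ x) ×-dec (j ≟ a)) ⊎-dec ((i ≟ a) ×-dec (j ≟ x))

spine? : (H : Graph) (l : List (Fin (n H))) (x y a b : Fin (n H)) → Dec (Unique l × (∀ i → i ∈ l) ×
  (∀ i j → adj H i j ≡ true → (Consec i j l ⊎ Consec j i l) ⊎ (SamePair i j x a ⊎ SamePair i j y b)))
spine? H l x y a b = unique? l ×-dec Fin.all? (_∈? l) ×-dec spineEdges? H l x y a b
  where
  open import Data.List.Relation.Unary.Unique.DecPropositional (_≟_ {n H}) using (unique?)
  open import Data.List.Membership.DecPropositional (_≟_ {n H}) using (_∈?_)

toSpine : ∀ {H l x y a b} → Path (λ i j → adj H i j ≡ true) x l y → Unique l × (∀ i → i ∈ l) ×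
  (∀ i j → adj H i j ≡ true → (Consec i j l ⊎ Consec j i l) ⊎ (SamePair i j x a ⊎ SamePair i j y b)) → Spine H
toSpine p (u , c , e) = mkSpine p u c e

-- Abstract, since the decided side conditions normalise to large terms.
abstract
  graphSpine : (w : WhichH) → Spine (graphOf w)
  graphSpine isDiamond = toSpine {diamond} (refl ∷ refl ∷ refl ∷ [ _ ])
    (from-yes (spine? diamond (# 2 ∷ # 1 ∷ # 0 ∷ # 3 ∷ []) (# 2) (# 3) (# 0) (# 1)))
  -- The end of the tail has no chord; its neighbour on the path is taken for a, which allows no
  -- further edge.
  graphSpine isPan1 = toSpine {pan1} (refl ∷ refl ∷ refl ∷ [ _ ])
    (from-yes (spine? pan1 (# 3 ∷ # 0 ∷ # 1 ∷ # 2 ∷ []) (# 3) (# 2) (# 0) (# 0)))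
  graphSpine isPan2 = toSpine {pan2} (refl ∷ refl ∷ refl ∷ refl ∷ [ _ ])
    (from-yes (spine? pan2 (# 4 ∷ # 3 ∷ # 0 ∷ # 1 ∷ # 2 ∷ []) (# 4) (# 2) (# 3) (# 0)))

-- Indices, counting and chains

module Nth {A : Set} (d : A) where

  nth : List A → ℕ → A
  nth [] _ = d
  nth (x ∷ l) zero = x
  nth (x ∷ l) (suc i) = nth l i

  nth∈ : ∀ l {i} → i < length l → nth l i ∈ l
  nth∈ (x ∷ l) {zero} _ = here refl
  nth∈ (x ∷ l) {suc i} (s≤s lt) = there (nth∈ l lt)

  index : ∀ {v l} → v ∈ l → ∃ λ i → i < length l × v ≡ nth l i
  index (here refl) = 0 , s≤s z≤n , refl
  index (there m) = let (i , lt , e) = index m in suc i , s≤s lt , e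

  nth-inj : ∀ {l i j} → Unique l → i < length l → j < length l → nth l i ≡ nth l j → i ≡ j
  nth-inj {x ∷ l} {zero} {zero} _ _ _ _ = refl
  nth-inj {x ∷ l} {zero} {suc j} (ne ∷ _) _ (s≤s lt) e = ⊥-elim (All.lookup ne (nth∈ l lt) e)
  nth-inj {x ∷ l} {suc i} {zero} (ne ∷ _) (s≤s lt) _ e = ⊥-elim (All.lookup ne (nth∈ l lt) (sym e))
  nth-inj {x ∷ l} {suc i} {suc j} (_ ∷ u) (s≤s lt) (s≤s lt′) e = cong suc (nth-inj u lt lt′ e)

  nth-path : ∀ {R : A → A → Set} {x l y i} → Path R x l y → suc i < length l → R (nth l i) (nth l (suc i))
  nth-path [ _ ] (s≤s ())
  nth-path {i = zero} (r ∷ [ _ ]) _ = r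
  nth-path {i = zero} (r ∷ (_ ∷ _)) _ = r
  nth-path {i = suc i} (_ ∷ p) (s≤s lt) = nth-path p lt

  nth-consec : ∀ {u v l} → Consec u v l → ∃ λ i → suc i < length l × u ≡ nth l i × v ≡ nth l (suc i)
  nth-consec here = 0 , s≤s (s≤s z≤n) , refl , refl
  nth-consec (there c) = let (i , lt , e) = nth-consec c in suc i , s≤s lt , e

  nth-head : ∀ {R : A → A → Set} {x l y} → Path R x l y → nth l 0 ≡ x
  nth-head [ _ ] = refl
  nth-head (_ ∷ _) = refl

  nth-last : ∀ {R : A → A → Set} {x l y} → Path R x l y → ∀ {k} → length l ≡ suc k → nth l k ≡ y
  nth-last [ _ ] refl = refl
  nth-last (_ ∷ p) {zero} e with p | suc-injective e
  ... | [ _ ] | ()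
  ... | _ ∷ _ | ()
  nth-last (_ ∷ p) {suc k} e = nth-last p (suc-injective e)

-- The K pairs of lo + 2i and lo + 2i + 1 are disjoint, so fewer than K numbers cannot meet all of
-- them. The pairs are tried from the top; a pair that is hit takes at least one number out of J.
avoidPair : ∀ lo K (J : List ℕ) → length J < K → ∃ λ t → lo ≤ t × suc t < lo + (K + K) × t ∉ J × suc t ∉ J
avoidPair lo (suc K) J lt = go (top ∈ℕ? J) (suc top ∈ℕ? J)
  where
  top = lo + (K + K)
  eq : suc (suc top) ≡ lo + (suc K + suc K)
  eq = trans (sym (trans (+-suc lo _) (cong suc (+-suc lo _)))) (cong (λ m → lo + suc m) (sym (+-suc K K)))
  small? = λ j → j <? top
  shrink : ∀ {v} → v ∈ J → top ≤ v → ∃ λ t → lo ≤ t × suc t < lo + (suc K + suc K) × t ∉ J × suc t ∉ J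
  shrink v∈ le with avoidPair lo K (filter small? J) (<-≤-trans (filter-notAll small? J (lose v∈ (λ l → <-irrefl refl (<-≤-trans l le)))) (≤-pred lt))
  ... | t , a , b , c , d = t , a , <-≤-trans b (≤-trans (n≤1+n _) (≤-trans (n≤1+n _) (≤-reflexive eq))) ,
      (λ m → c (∈-filter⁺ small? m (<-trans (n<1+n t) b))) , λ m → d (∈-filter⁺ small? m b)
  go : Dec (top ∈ J) → Dec (suc top ∈ J) → ∃ λ t → lo ≤ t × suc t < lo + (suc K + suc K) × t ∉ J × suc t ∉ J
  go (no p) (no q) = top , m≤m+n lo _ , ≤-reflexive eq , p , q
  go (yes p) _ = shrink p ≤-refl
  go (no _) (yes q) = shrink q (n≤1+n _)

allPairs-index : ∀ {A : Set} {R : A → A → Set} → (∀ {a b} → R a b → R b a) → ∀ {xs} → AllPairs R xs →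
                 ∀ i j → i ≢ j → R (lookup xs i) (lookup xs j)
allPairs-index sy (r ∷ _) zero zero ne = ⊥-elim (ne refl)
allPairs-index sy (r ∷ _) zero (suc j) ne = All.lookup r (∈-lookup j)
allPairs-index sy (r ∷ _) (suc i) zero ne = sy (All.lookup r (∈-lookup i))
allPairs-index sy (_ ∷ ap) (suc i) (suc j) ne = allPairs-index sy ap i j (λ e → ne (cong suc e))

-- Boxes come in powers of two; the factor two lost by rounding up enters the coefficient of the
-- bound.
powerAbove : ∀ k → 1 ≤ k → ∃ λ J → k ≤ 2 ^ J × 2 ^ J ≤ 2 * k
powerAbove (suc zero) _ = 0 , s≤s z≤n , s≤s z≤n
powerAbove (suc (suc k)) _ with powerAbove (suc k) (s≤s z≤n)
... | J , a , b with suc (suc k) ≤? 2 ^ J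
... | yes p = J , p , ≤-trans b (*-monoʳ-≤ 2 {suc k} (n≤1+n (suc k)))
... | no q = suc J , ≤-trans (≤-trans (s≤s a) (≤-reflexive (+-comm 1 (2 ^ J)))) (+-monoʳ-≤ (2 ^ J) (≤-trans (m^n>0 2 J) (m≤m+n _ 0))) ,
             *-monoʳ-≤ 2 (≤-pred (≤-trans (≰⇒> q) (n≤1+n _)))

chain∈ : ∀ {A : Set} {u v x y : A} l → (x , y) ∈ chain u l v → x ∈ u ∷ l × y ∈ v ∷ l
chain∈ [] (here refl) = here refl , here refl
chain∈ (z ∷ l) (here refl) = here refl , there (here refl)
chain∈ (z ∷ l) (there m) with chain∈ l m
... | a , here e = there a , here e
... | a , there b = there a , there (there b)

chain-++ : ∀ {A : Set} {u v b : A} pre {post} → chain u (pre ++ b ∷ post) v ≡ chain u pre b ++ chain b post v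
chain-++ [] = refl
chain-++ (z ∷ pre) = cong (_ ∷_) (chain-++ pre)

lookup-inj : ∀ {A : Set} {l : List A} → Unique l → ∀ {i j} → lookup l i ≡ lookup l j → i ≡ j
lookup-inj (_ ∷ _) {zero} {zero} _ = refl
lookup-inj (ne ∷ _) {zero} {suc j} e = ⊥-elim (All.lookup ne (∈-lookup j) e)
lookup-inj (ne ∷ _) {suc i} {zero} e = ⊥-elim (All.lookup ne (∈-lookup i) (sym e))
lookup-inj (_ ∷ u) {suc i} {suc j} e = cong suc (lookup-inj u e)

edgeIn? : ∀ {m} (es : List (Fin m × Fin m)) i j → Dec (EdgeIn es i j)
edgeIn? es i j = ((i , j) ∈? es) ⊎-dec ((j , i) ∈? es)
  where open import Data.List.Membership.DecPropositional (≡-dec (_≟_ {_}) (_≟_ {_})) using (_∈?_)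

EdgeList : (H : Graph) → List (Fin (n H) × Fin (n H)) → Set
EdgeList H es = ∀ i j → (adj H i j ≡ true → EdgeIn es i j) × (EdgeIn es i j → adj H i j ≡ true)

edgeList? : ∀ H es → Dec (EdgeList H es)
edgeList? H es = Fin.all? λ i → Fin.all? λ j → ((adj H i j Bool.≟ true) →-dec edgeIn? es i j) ×-dec (edgeIn? es i j →-dec (adj H i j Bool.≟ true))

-- Models of thetas and pans

module ThetaModel {V : Set} where

  open Models diamond {V}

  -- The vertices 0 and 1 have degree three. Order and directions follow `thetaModel`, which
  -- subdivides the first three edges, one after the other.
  es₀ : List (Fin 4 × Fin 4)
  es₀ = (# 0 , # 1) ∷ (# 2 , # 0) ∷ (# 3 , # 1) ∷ (# 1 , # 2) ∷ (# 0 , # 3) ∷ []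

  es₀-ok : EdgeList diamond es₀
  es₀-ok = from-yes (edgeList? diamond es₀)

  thetaEdges : V → V → List V → List V → List V → List (V × V)
  thetaEdges a b L₁ L₂ L₃ = chain a L₁ b ++ chain b L₂ a ++ chain a L₃ b

  -- In a simple graph at least two of the three paths between a and b have inner vertices. Let c,
  -- next to b, and d, next to a, be such vertices on different paths; they serve as the vertices of
  -- degree two of the diamond, and only three of its edges need to be subdivided.
  thetaModel : ∀ {a b c d} L₁ L₂ L₃ → a ≢ b → Unique (c ∷ d ∷ []) → (∀ {v} → v ∈ c ∷ d ∷ [] → v ≢ a × v ≢ b) →
    Unique L₁ → Unique L₂ → Unique L₃ →
    (∀ {v} → v ∈ L₁ → v ∉ a ∷ b ∷ c ∷ d ∷ []) → (∀ {v} → v ∈ L₂ → v ∉ L₁ ++ a ∷ b ∷ c ∷ d ∷ []) →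
    (∀ {v} → v ∈ L₃ → v ∉ L₂ ++ L₁ ++ a ∷ b ∷ c ∷ d ∷ []) →
    Model (L₃ ++ L₂ ++ L₁ ++ a ∷ b ∷ c ∷ d ∷ []) (thetaEdges a b L₁ (c ∷ L₂) (d ∷ L₃))
  thetaModel {a} {b} {c} {d} L₁ L₂ L₃ a≢b ((c≢d ∷ []) ∷ _) cd u₁ u₂ u₃ f₁ f₂ f₃ = reorder {es = chain d L₃ b ++ E₃} to from m₃
    where
    vs = a ∷ b ∷ c ∷ d ∷ []
    c≢a = proj₁ (cd (here refl))
    c≢b = proj₂ (cd (here refl))
    d≢a = proj₁ (cd (there (here refl)))
    d≢b = proj₂ (cd (there (here refl)))
    vs! : Unique vs
    vs! = (a≢b ∷ (λ e → c≢a (sym e)) ∷ (λ e → d≢a (sym e)) ∷ []) ∷ ((λ e → c≢b (sym e)) ∷ (λ e → d≢b (sym e)) ∷ []) ∷ (c≢d ∷ []) ∷ [] ∷ []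
    E₁ = (c , a) ∷ (d , b) ∷ (b , c) ∷ (a , d) ∷ []
    m₀ : Model vs ((a , b) ∷ E₁)
    m₀ = baseModel es₀ (λ {i} {j} → proj₁ (es₀-ok i j)) (λ {i} {j} → proj₂ (es₀-ok i j)) (lookup vs) (lookup-inj vs!)
    n₁ : ¬ EdgeIn E₁ a b
    n₁ (inj₁ (here e)) = c≢a (sym (cong proj₁ e))
    n₁ (inj₁ (there (here e))) = d≢a (sym (cong proj₁ e))
    n₁ (inj₁ (there (there (here e)))) = a≢b (cong proj₁ e)
    n₁ (inj₁ (there (there (there (here e))))) = d≢b (sym (cong proj₂ e))
    n₁ (inj₂ (here e)) = c≢b (sym (cong proj₁ e))
    n₁ (inj₂ (there (here e))) = d≢b (sym (cong proj₁ e))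
    n₁ (inj₂ (there (there (here e)))) = c≢a (sym (cong proj₂ e))
    n₁ (inj₂ (there (there (there (here e))))) = a≢b (sym (cong proj₁ e))
    E₂ = chain a L₁ b ++ (d , b) ∷ (b , c) ∷ (a , d) ∷ []
    m₁ : Model (L₁ ++ vs) ((c , a) ∷ E₂)
    m₁ = reorder {es = chain a L₁ b ++ E₁} (pull (chain a L₁ b)) (push (chain a L₁ b)) (subdividePath L₁ u₁ f₁ a≢b n₁ m₀)
      where
      pull : ∀ {A : Set} {y : A} xs {ys} → (xs ++ y ∷ ys) ⊆ (y ∷ xs ++ ys)
      pull xs m with ∈-++⁻ xs m
      ... | inj₁ p = there (∈-++⁺ˡ p)
      ... | inj₂ (here p) = here p
      ... | inj₂ (there p) = there (∈-++⁺ʳ xs p)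
      push : ∀ {A : Set} {y : A} xs {ys} → (y ∷ xs ++ ys) ⊆ (xs ++ y ∷ ys)
      push xs (here p) = ∈-++⁺ʳ xs (here p)
      push xs (there m) with ∈-++⁻ xs m
      ... | inj₁ p = ∈-++⁺ˡ p
      ... | inj₂ p = ∈-++⁺ʳ xs (there p)
    v∉L₁ : ∀ {v} → v ∈ vs → v ∉ L₁
    v∉L₁ m m′ = f₁ m′ m
    c∈ : c ∈ vs
    c∈ = there (there (here refl))
    d∈ : d ∈ vs
    d∈ = there (there (there (here refl)))
    not-chain : ∀ {u w} → u ≢ a → u ≢ b → u ∈ vs → ¬ EdgeIn (chain a L₁ b) u w
    not-chain na nb m (inj₁ e) with proj₁ (chain∈ L₁ e)
    ... | here e′ = na e′
    ... | there m′ = v∉L₁ m m′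
    not-chain na nb m (inj₂ e) with proj₂ (chain∈ L₁ e)
    ... | here e′ = nb e′
    ... | there m′ = v∉L₁ m m′
    edge-++ : ∀ {A : Set} (xs : List (A × A)) {ys u w} → EdgeIn (xs ++ ys) u w → EdgeIn xs u w ⊎ EdgeIn ys u w
    edge-++ xs (inj₁ m) = Sum.map inj₁ inj₁ (∈-++⁻ xs m)
    edge-++ xs (inj₂ m) = Sum.map inj₂ inj₂ (∈-++⁻ xs m)
    n₂ : ¬ EdgeIn E₂ c a
    n₂ e with edge-++ (chain a L₁ b) e
    ... | inj₁ e′ = not-chain c≢a c≢b c∈ e′
    ... | inj₂ (inj₁ (here e′)) = c≢d (cong proj₁ e′)
    ... | inj₂ (inj₁ (there (here e′))) = c≢b (cong proj₁ e′)
    ... | inj₂ (inj₁ (there (there (here e′)))) = c≢a (cong proj₁ e′)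
    ... | inj₂ (inj₂ (here e′)) = d≢a (sym (cong proj₁ e′))
    ... | inj₂ (inj₂ (there (here e′))) = a≢b (cong proj₁ e′)
    ... | inj₂ (inj₂ (there (there (here e′)))) = c≢d (cong proj₂ e′)
    E₃ = chain c L₂ a ++ chain a L₁ b ++ (b , c) ∷ (a , d) ∷ []
    m₂ : Model (L₂ ++ L₁ ++ vs) ((d , b) ∷ E₃)
    m₂ = reorder {es = chain c L₂ a ++ E₂} to′ from′ (subdividePath L₂ u₂ f₂ c≢a n₂ m₁)
      where
      to′ : (chain c L₂ a ++ E₂) ⊆ ((d , b) ∷ E₃)
      to′ m with ∈-++⁻ (chain c L₂ a) m
      ... | inj₁ p = there (∈-++⁺ˡ p)
      ... | inj₂ p with ∈-++⁻ (chain a L₁ b) p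
      ...   | inj₁ q = there (∈-++⁺ʳ (chain c L₂ a) (∈-++⁺ˡ q))
      ...   | inj₂ (here q) = here q
      ...   | inj₂ (there q) = there (∈-++⁺ʳ (chain c L₂ a) (∈-++⁺ʳ (chain a L₁ b) q))
      from′ : ((d , b) ∷ E₃) ⊆ (chain c L₂ a ++ E₂)
      from′ (here e) = ∈-++⁺ʳ (chain c L₂ a) (∈-++⁺ʳ (chain a L₁ b) (here e))
      from′ (there m) with ∈-++⁻ (chain c L₂ a) m
      ... | inj₁ p = ∈-++⁺ˡ p
      ... | inj₂ p with ∈-++⁻ (chain a L₁ b) p
      ...   | inj₁ q = ∈-++⁺ʳ (chain c L₂ a) (∈-++⁺ˡ q)
      ...   | inj₂ q = ∈-++⁺ʳ (chain c L₂ a) (∈-++⁺ʳ (chain a L₁ b) (there q))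
    n₃ : ¬ EdgeIn E₃ d b
    n₃ e with edge-++ (chain c L₂ a) e
    ... | inj₁ (inj₁ m) with proj₁ (chain∈ L₂ m)
    ...   | here e′ = c≢d (sym e′)
    ...   | there m′ = f₂ m′ (∈-++⁺ʳ L₁ d∈)
    n₃ e | inj₁ (inj₂ m) with proj₂ (chain∈ L₂ m)
    ...   | here e′ = d≢a e′
    ...   | there m′ = f₂ m′ (∈-++⁺ʳ L₁ d∈)
    n₃ e | inj₂ e₂ with edge-++ (chain a L₁ b) e₂
    ... | inj₁ e′ = not-chain d≢a d≢b d∈ e′
    ... | inj₂ (inj₁ (here e′)) = d≢b (cong proj₁ e′)
    ... | inj₂ (inj₁ (there (here e′))) = d≢a (cong proj₁ e′)
    ... | inj₂ (inj₂ (here e′)) = c≢d (sym (cong proj₂ e′))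
    ... | inj₂ (inj₂ (there (here e′))) = a≢b (sym (cong proj₁ e′))
    m₃ : Model (L₃ ++ L₂ ++ L₁ ++ vs) (chain d L₃ b ++ E₃)
    m₃ = subdividePath L₃ u₃ f₃ d≢b n₃ m₂
    T = thetaEdges a b L₁ (c ∷ L₂) (d ∷ L₃)
    in₁ : chain a L₁ b ⊆ T
    in₁ = ∈-++⁺ˡ
    in₂ : chain b (c ∷ L₂) a ⊆ T
    in₂ m = ∈-++⁺ʳ (chain a L₁ b) (∈-++⁺ˡ m)
    in₃ : chain a (d ∷ L₃) b ⊆ T
    in₃ m = ∈-++⁺ʳ (chain a L₁ b) (∈-++⁺ʳ (chain b (c ∷ L₂) a) m)
    to : (chain d L₃ b ++ E₃) ⊆ T
    to m with ∈-++⁻ (chain d L₃ b) m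
    ... | inj₁ p = in₃ (there p)
    ... | inj₂ p with ∈-++⁻ (chain c L₂ a) p
    ...   | inj₁ q = in₂ (there q)
    ...   | inj₂ q with ∈-++⁻ (chain a L₁ b) q
    ...     | inj₁ k = in₁ k
    ...     | inj₂ (here k) = in₂ (here k)
    ...     | inj₂ (there (here k)) = in₃ (here k)
    from : T ⊆ (chain d L₃ b ++ E₃)
    from m with ∈-++⁻ (chain a L₁ b) m
    ... | inj₁ p = ∈-++⁺ʳ (chain d L₃ b) (∈-++⁺ʳ (chain c L₂ a) (∈-++⁺ˡ p))
    ... | inj₂ (here p) = ∈-++⁺ʳ (chain d L₃ b) (∈-++⁺ʳ (chain c L₂ a) (∈-++⁺ʳ (chain a L₁ b) (here p)))
    ... | inj₂ (there p) with ∈-++⁻ (chain c L₂ a) p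
    ...   | inj₁ q = ∈-++⁺ʳ (chain d L₃ b) (∈-++⁺ˡ q)
    ...   | inj₂ (here q) = ∈-++⁺ʳ (chain d L₃ b) (∈-++⁺ʳ (chain c L₂ a) (∈-++⁺ʳ (chain a L₁ b) (there (here q))))
    ...   | inj₂ (there q) = ∈-++⁺ˡ q

unique-++ : ∀ {A : Set} (xs : List A) {ys} → Unique (xs ++ ys) → Unique xs × Unique ys × (∀ {v} → v ∈ xs → v ∉ ys)
unique-++ [] u = [] , u , λ ()
unique-++ (x ∷ xs) (x∉ ∷ u) with unique-++ xs u
... | u₁ , u₂ , d = All.tabulate (λ m → All.lookup x∉ (∈-++⁺ˡ m)) ∷ u₁ , u₂ ,
      λ { (here refl) m → All.lookup x∉ (∈-++⁺ʳ xs m) refl ; (there m) → d m }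

module _ {P : ℕ → Set} (P? : Decidable P) where

  first : ∀ a k → (∃ λ m → a ≤ m × m < a + k × P m × (∀ {j} → a ≤ j → j < m → ¬ P j)) ⊎ (∀ {j} → a ≤ j → j < a + k → ¬ P j)
  first a zero = inj₂ λ le lt → ⊥-elim (<-irrefl refl (≤-<-trans le (<-≤-trans lt (≤-reflexive (+-identityʳ a)))))
  first a (suc k) with P? a | first (suc a) k
  ... | yes p | _ = inj₁ (a , ≤-refl , ≤-trans (s≤s (m≤m+n a k)) (≤-reflexive (sym (+-suc a k))) , p , λ le lt → ⊥-elim (<-irrefl refl (≤-<-trans le lt)))
  ... | no np | inj₁ (m , le , lt , p , f) = inj₁ (m , <⇒≤ le , ≤-trans lt (≤-reflexive (sym (+-suc a k))) , p , g)
    where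
    g : ∀ {j} → a ≤ j → j < m → ¬ P j
    g {j} le′ lt′ pj with a ℕ.≟ j
    ... | yes refl = np pj
    ... | no ne = f (≤∧≢⇒< le′ ne) lt′ pj
  ... | no np | inj₂ f = inj₂ g
    where
    g : ∀ {j} → a ≤ j → j < a + suc k → ¬ P j
    g {j} le′ lt′ pj with a ℕ.≟ j
    ... | yes refl = np pj
    ... | no ne = f (≤∧≢⇒< le′ ne) (≤-trans lt′ (≤-reflexive (+-suc a k))) pj

  last : ∀ {i j} → i < j → P i → ∃ λ m → i ≤ m × m < j × P m × (∀ {k} → m < k → k < j → ¬ P k)
  last {i} {suc j} lt pi with P? j
  ... | yes p = j , ≤-pred lt , n<1+n j , p , λ a b → ⊥-elim (<-irrefl refl (<-≤-trans a (≤-pred b)))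
  ... | no np with i ℕ.≟ j
  ...   | yes refl = ⊥-elim (np pi)
  ...   | no ne with last (≤∧≢⇒< (≤-pred lt) ne) pi
  ...     | m , a , b , pm , f = m , a , m≤n⇒m≤1+n b , pm , g
    where
    g : ∀ {k} → m < k → k < suc j → ¬ P k
    g {k} x y pk with k ℕ.≟ j
    ... | yes refl = np pk
    ... | no ne = f x (≤∧≢⇒< (≤-pred y) ne) pk

module PanModel {V : Set} where

  esPan1 : List (Fin 4 × Fin 4)
  esPan1 = (# 1 , # 2) ∷ (# 0 , # 1) ∷ (# 2 , # 0) ∷ (# 0 , # 3) ∷ []

  esPan2 : List (Fin 5 × Fin 5)
  esPan2 = (# 1 , # 2) ∷ (# 0 , # 1) ∷ (# 2 , # 0) ∷ (# 0 , # 3) ∷ (# 3 , # 4) ∷ []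

  pan1-ok : EdgeList pan1 esPan1
  pan1-ok = from-yes (edgeList? pan1 esPan1)

  pan2-ok : EdgeList pan2 esPan2
  pan2-ok = from-yes (edgeList? pan2 esPan2)

  -- Subdividing only the edge opposite to a already yields cycles of every length with a pendant
  -- edge at a, and longer tails are never built.
  pan1Model : ∀ {a x y v} mid → Unique (a ∷ x ∷ y ∷ v ∷ []) → Unique mid → (∀ {u} → u ∈ mid → u ∉ a ∷ x ∷ y ∷ v ∷ []) →
    Models.Model pan1 (mid ++ a ∷ x ∷ y ∷ v ∷ []) (chain x mid y ++ (a , x) ∷ (y , a) ∷ (a , v) ∷ [])
  pan1Model {a} {x} {y} {v} mid u@((a≢x ∷ a≢y ∷ _) ∷ (x≢y ∷ _) ∷ _) u′ f =
    subdividePath mid u′ f x≢y nodup (baseModel esPan1 (λ {i} {j} → proj₁ (pan1-ok i j)) (λ {i} {j} → proj₂ (pan1-ok i j)) (lookup (a ∷ x ∷ y ∷ v ∷ [])) (lookup-inj u))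
    where
    open Models pan1 {V}
    nodup : ¬ EdgeIn ((a , x) ∷ (y , a) ∷ (a , v) ∷ []) x y
    nodup (inj₁ (here e)) = a≢x (sym (cong proj₁ e))
    nodup (inj₁ (there (here e))) = x≢y (cong proj₁ e)
    nodup (inj₁ (there (there (here e)))) = a≢x (sym (cong proj₁ e))
    nodup (inj₂ (here e)) = a≢y (sym (cong proj₁ e))
    nodup (inj₂ (there (here e))) = a≢x (sym (cong proj₂ e))
    nodup (inj₂ (there (there (here e)))) = a≢y (sym (cong proj₁ e))

  pan2Model : ∀ {a x y v w} mid → Unique (a ∷ x ∷ y ∷ v ∷ w ∷ []) → Unique mid → (∀ {u} → u ∈ mid → u ∉ a ∷ x ∷ y ∷ v ∷ w ∷ []) →
    Models.Model pan2 (mid ++ a ∷ x ∷ y ∷ v ∷ w ∷ []) (chain x mid y ++ (a , x) ∷ (y , a) ∷ (a , v) ∷ (v , w) ∷ [])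
  pan2Model {a} {x} {y} {v} {w} mid u@((a≢x ∷ a≢y ∷ _) ∷ (x≢y ∷ x≢v ∷ _) ∷ (y≢v ∷ _) ∷ _) u′ f =
    subdividePath mid u′ f x≢y nodup (baseModel esPan2 (λ {i} {j} → proj₁ (pan2-ok i j)) (λ {i} {j} → proj₂ (pan2-ok i j)) (lookup (a ∷ x ∷ y ∷ v ∷ w ∷ [])) (lookup-inj u))
    where
    open Models pan2 {V}
    nodup : ¬ EdgeIn ((a , x) ∷ (y , a) ∷ (a , v) ∷ (v , w) ∷ []) x y
    nodup (inj₁ (here e)) = a≢x (sym (cong proj₁ e))
    nodup (inj₁ (there (here e))) = x≢y (cong proj₁ e)
    nodup (inj₁ (there (there (here e)))) = a≢x (sym (cong proj₁ e))
    nodup (inj₁ (there (there (there (here e))))) = x≢v (cong proj₁ e)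
    nodup (inj₂ (here e)) = a≢y (sym (cong proj₁ e))
    nodup (inj₂ (there (here e))) = a≢x (sym (cong proj₂ e))
    nodup (inj₂ (there (there (here e)))) = a≢y (sym (cong proj₁ e))
    nodup (inj₂ (there (there (there (here e))))) = y≢v (cong proj₁ e)

-- Induced paths and induced cycles

module _ (G : Graph) (simple : IsSimple G) where

  V : Set
  V = Fin (n G)

  open import Data.List.Membership.DecPropositional (_≟_ {n G}) public using (_∈?_)

  infix 4 _~_ _~?_

  _~_ : V → V → Set
  x ~ y = adj G x y ≡ true

  _~?_ : ∀ x y → Dec (x ~ y)
  x ~? y = adj G x y Bool.≟ true

  ~-sym : ∀ {x y} → x ~ y → y ~ x
  ~-sym {x} {y} e = trans (sym (IsSimple.symm simple x y)) e

  ~-irrefl : ∀ {x} → ¬ x ~ x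
  ~-irrefl {x} e with trans (sym (IsSimple.irref simple x)) e
  ... | ()

  ~⇒≢ : ∀ {x y} → x ~ y → x ≢ y
  ~⇒≢ e refl = ~-irrefl e

  GPath : V → List V → V → Set
  GPath = Path _~_

  data IPath : V → List V → V → Set where
    [_] : ∀ x → IPath x (x ∷ []) x
    cons : ∀ {x y z l} → x ~ y → IPath y (y ∷ l) z → (∀ {w} → w ∈ l → ¬ x ~ w × x ≢ w) → IPath x (x ∷ y ∷ l) z

  ihead : ∀ {x l y} → IPath x l y → Σ (List V) λ t → l ≡ x ∷ t
  ihead [ x ] = _ , refl
  ihead (cons _ _ _) = _ , refl

  ipath⇒path : ∀ {x l y} → IPath x l y → GPath x l y
  ipath⇒path [ x ] = [ x ]
  ipath⇒path (cons r p _) = r ∷ ipath⇒path p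

  ipath-unique : ∀ {x l y} → IPath x l y → Unique l
  ipath-unique [ x ] = [] ∷ []
  ipath-unique (cons r p h) = (~⇒≢ r ∷ All.tabulate (λ w∈ → proj₂ (h w∈))) ∷ ipath-unique p

  Touch : V → V → Set
  Touch x w = x ≡ w ⊎ x ~ w

  touch? : ∀ x w → Dec (Touch x w)
  touch? x w = (x ≟ w) ⊎-dec (x ~? w)

  -- The last vertex of l that equals x or is adjacent to it takes over, so that x gets no chord.
  prepend : ∀ {x y l z} → IPath y l z → Any (Touch x) l →
            Σ (List V) λ l′ → IPath x l′ z × l′ ⊆ x ∷ l × length l′ ≤ suc (length l)
  prepend [ y ] (here (inj₁ refl)) = _ , [ y ] , (λ { (here refl) → here refl }) , s≤s z≤n
  prepend [ y ] (here (inj₂ r)) = _ , cons r [ y ] (λ ()) , (λ v → v) , ≤-refl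
  prepend {x} p@(cons {x = q} {l = l} r p′ h) any with any? (touch? x) (_ ∷ l)
  ... | yes a with prepend p′ a
  ...   | l′ , q′ , sub , le = l′ , q′ , (λ v → f (sub v)) , m≤n⇒m≤1+n le
    where
    f : ∀ {v} → v ∈ x ∷ _ ∷ l → v ∈ x ∷ q ∷ _ ∷ l
    f (here e) = here e
    f (there m) = there (there m)
  prepend p (there a) | no ¬a = ⊥-elim (¬a a)
  prepend p (here (inj₁ refl)) | no ¬a = _ , p , there , n≤1+n _
  prepend p@(cons r p′ h) (here (inj₂ r′)) | no ¬a =
    _ , cons r′ p (λ m → (λ e → ¬a (lose m (inj₂ e))) , (λ e → ¬a (lose m (inj₁ e)))) , (λ v → v) , ≤-refl

  induce : ∀ {x l y} → GPath x l y → Σ (List V) λ l′ → IPath x l′ y × l′ ⊆ l × length l′ ≤ length l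
  induce [ x ] = _ , [ x ] , (λ v → v) , ≤-refl
  induce (r ∷ p) with induce p
  ... | l′ , q , sub , le with prepend q (subst (Any (Touch _)) (sym (proj₂ (ihead q))) (here (inj₂ r)))
  ...   | l″ , q′ , sub′ , le′ = l″ , q′ , (λ v → f (sub′ v)) , ≤-trans le′ (s≤s le)
    where
    f : ∀ {v} → v ∈ _ ∷ l′ → v ∈ _ ∷ _
    f (here e) = here e
    f (there m) = there (sub m)

  isnoc : ∀ {x l y a} → IPath x l y → y ~ a → a ∉ l → (∀ {w} → w ∈ l → a ~ w → w ≡ y) → IPath x (l ++ a ∷ []) a
  isnoc [ x ] r _ _ = cons r [ _ ] (λ ())
  isnoc {y = y} {a} (cons {x = x} {z} {l = l} r p h) r′ a∉ f =
    cons r (isnoc p r′ (λ m → a∉ (there m)) (λ m → f (there m))) g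
    where
    x≢y : ∀ {z l} → IPath z (z ∷ l) y → x ~ z → (∀ {w} → w ∈ l → ¬ x ~ w × x ≢ w) → x ≢ y
    x≢y [ _ ] r h = ~⇒≢ r
    x≢y (cons _ q _) r h = proj₂ (h (last∈ (ipath⇒path q)))
    g : ∀ {w} → w ∈ l ++ a ∷ [] → ¬ x ~ w × x ≢ w
    g m with ∈-++⁻ l m
    ... | inj₁ m′ = h m′
    ... | inj₂ (here refl) = (λ e → x≢y p r h (f (here refl) (~-sym e))) , λ e → a∉ (here (sym e))

  -- Cutting at the first neighbour of z after x leaves z without neighbours strictly between the
  -- ends. In this way z closes an induced path to an induced cycle.
  firstNbr : ∀ {x l y} z → IPath x l y → x ≢ y → z ~ y →
    Σ (List V) λ l′ → Σ V λ y′ → IPath x (x ∷ l′) y′ × z ~ y′ × x ≢ y′ × (x ∷ l′) ⊆ l × length (x ∷ l′) ≤ length l ×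
      (∀ {w} → w ∈ l′ → z ~ w → w ≡ y′)
  firstNbr z [ _ ] ne _ = ⊥-elim (ne refl)
  firstNbr z (cons {x} {h} {l = l} r p f) ne zy with z ~? h
  ... | yes zh = h ∷ [] , h , cons r [ h ] (λ ()) , zh , ~⇒≢ r , (λ { (here e) → here e ; (there (here e)) → there (here e) }) ,
                 s≤s (s≤s z≤n) , λ { (here refl) _ → refl }
  firstNbr {y = y} z (cons {x} {h} {l = l} r p f) ne zy | no z≁h with firstNbr z p (λ { refl → z≁h zy }) zy
  ... | l′ , y′ , q , zy′ , ne′ , sub , le , g =
    h ∷ l′ , y′ , cons r q (λ m → f (tl m)) , zy′ , x≢ , (λ { (here e) → here e ; (there m) → there (sub m) }) , s≤s le ,
    λ { (here refl) e → ⊥-elim (z≁h e) ; (there m) → g m }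
    where
    h∉ : ∀ {w} → w ∈ l′ → w ≢ h
    h∉ m refl with ipath-unique q
    ... | ne ∷ _ = All.lookup ne m refl
    tl : ∀ {w} → w ∈ l′ → w ∈ l
    tl m with sub (there m)
    ... | here e = ⊥-elim (h∉ m e)
    ... | there m′ = m′
    x≢ : x ≢ y′
    x≢ with last∈ (ipath⇒path q)
    ... | here e = λ { refl → ne′ (sym e) }
    ... | there m = proj₂ (f (tl m))

  -- The list P is the induced path that remains after deleting a. Triangles are included, and x ≢ y
  -- gives P at least two vertices.
  record ICycle (a : V) (P : List V) : Set where
    field
      {x y} : V
      ip : IPath x P y
      a~x : a ~ x
      a~y : a ~ y
      x≢y : x ≢ y
      a∉ : a ∉ P
      inner : ∀ {w} → w ∈ P → a ~ w → w ≡ x ⊎ w ≡ y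

  closeCycle : ∀ {x Q y} z → GPath x Q y → z ∉ Q → z ~ x → z ~ y → x ≢ y →
    Σ (List V) λ P → ICycle z P × P ⊆ Q × length P ≤ length Q
  closeCycle z p z∉ zx zy ne with induce p
  ... | Q′ , ip , sub , le with firstNbr z ip ne zy
  ...   | l′ , y′ , ip′ , zy′ , ne′ , sub′ , le′ , f = _ , record
    { ip = ip′ ; a~x = zx ; a~y = zy′ ; x≢y = ne′ ; a∉ = λ m → z∉ (sub (sub′ m))
    ; inner = λ { (here e) _ → inj₁ e ; (there m) e → inj₂ (f m e) } } , (λ m → sub (sub′ m)) , ≤-trans le′ le

  rotate₁ : ∀ {a P} (c : ICycle a P) → Σ (List V) λ t → P ≡ ICycle.x c ∷ t × ICycle (ICycle.x c) (t ++ a ∷ [])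
  rotate₁ {a} record { ip = [ x ] ; x≢y = x≢y } = ⊥-elim (x≢y refl)
  rotate₁ {a} record { y = y ; ip = cons {x} {x₁} {l = l} r p h ; a~x = a~x ; a~y = a~y ; x≢y = x≢y ; a∉ = a∉ ; inner = inner } =
    x₁ ∷ l , refl , record
      { ip = isnoc p (~-sym a~y) (λ m → a∉ (there m)) g
      ; a~x = r ; a~y = ~-sym a~x ; x≢y = λ { refl → a∉ (there (here refl)) }
      ; a∉ = x∉ ; inner = inn }
    where
    x∉t : x ∉ x₁ ∷ l
    x∉t m with ipath-unique (cons r p h)
    ... | ne ∷ _ = All.lookup ne m refl
    g : ∀ {w} → w ∈ x₁ ∷ l → a ~ w → w ≡ y
    g m e with inner (there m) e
    ... | inj₁ refl = ⊥-elim (x∉t m)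
    ... | inj₂ e′ = e′
    x∉ : x ∉ (x₁ ∷ l) ++ a ∷ []
    x∉ m with ∈-++⁻ (x₁ ∷ l) m
    ... | inj₁ m′ = x∉t m′
    ... | inj₂ (here refl) = a∉ (here refl)
    inn : ∀ {w} → w ∈ (x₁ ∷ l) ++ a ∷ [] → x ~ w → w ≡ x₁ ⊎ w ≡ a
    inn m e with ∈-++⁻ (x₁ ∷ l) m
    ... | inj₁ (here refl) = inj₁ refl
    ... | inj₁ (there m′) = ⊥-elim (proj₁ (h m′) e)
    ... | inj₂ (here refl) = inj₂ refl

  Rotated : V → List V → V → Set
  Rotated a P b = Σ (List V) λ P′ → ICycle b P′ × (b ∷ P′) ⊆ (a ∷ P) × (a ∷ P) ⊆ (b ∷ P′) × length P′ ≡ length P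

  -- Turning the cycle by one vertex is repeated until b is its base, so an argument about a vertex
  -- of a cycle may assume it to be the base.
  rotate : ∀ {a P b} → ICycle a P → b ∈ a ∷ P → Rotated a P b
  rotate c (here refl) = _ , c , (λ v → v) , (λ v → v) , refl
  rotate {a} {P} {b} c (there m) with ∈-∃++ m
  ... | pre , post , refl = go pre c
    where
    go : ∀ {a post} pre → ICycle a (pre ++ b ∷ post) → Rotated a (pre ++ b ∷ post) b
    go {a} {post} [] c with rotate₁ c
    ... | t , refl , c′ = t ++ a ∷ [] , c′ ,
      (λ { (here e) → there (here e) ; (there m) → swap m }) ,
      (λ { (here refl) → there (∈-++⁺ʳ t (here refl)) ; (there (here e)) → here e ; (there (there m)) → there (∈-++⁺ˡ m) }) ,
      trans (length-++ t) (+-comm (length t) 1)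
      where
      swap : ∀ {v} → v ∈ t ++ a ∷ [] → v ∈ a ∷ b ∷ t
      swap m with ∈-++⁻ t m
      ... | inj₁ m′ = there (there m′)
      ... | inj₂ (here e) = here e
    go {a} {post} (h ∷ pre) c with rotate₁ c
    ... | .(pre ++ b ∷ post) , refl , c′ with go {post = post ++ a ∷ []} pre (subst (ICycle h) (++-assoc pre (b ∷ post) (a ∷ [])) c′)
    ...   | P′ , c″ , s₁ , s₂ , e = P′ , c″ , (λ m → f (s₁ m)) , (λ m → s₂ (g m)) ,
          trans e (trans (cong length (sym (++-assoc pre (b ∷ post) (a ∷ [])))) (trans (length-++ (pre ++ b ∷ post)) (+-comm _ 1)))
      where
      f : ∀ {v} → v ∈ h ∷ pre ++ b ∷ post ++ a ∷ [] → v ∈ a ∷ h ∷ pre ++ b ∷ post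
      f (here e) = there (here e)
      f {v} (there m) with ∈-++⁻ (pre ++ b ∷ post) (subst (v ∈_) (sym (++-assoc pre (b ∷ post) (a ∷ []))) m)
      ... | inj₁ m′ = there (there m′)
      ... | inj₂ (here e) = here e
      g : ∀ {v} → v ∈ a ∷ h ∷ pre ++ b ∷ post → v ∈ h ∷ pre ++ b ∷ post ++ a ∷ []
      g (here refl) = there (subst (a ∈_) (++-assoc pre (b ∷ post) (a ∷ [])) (∈-++⁺ʳ (pre ++ b ∷ post) (here refl)))
      g (there (here e)) = here e
      g {v} (there (there m)) = there (subst (v ∈_) (++-assoc pre (b ∷ post) (a ∷ [])) (∈-++⁺ˡ m))

  path-split : ∀ {x y b} pre {post} → GPath x (pre ++ b ∷ post) y → GPath x (pre ++ b ∷ []) b × GPath b (b ∷ post) y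
  path-split [] [ _ ] = [ _ ] , [ _ ]
  path-split [] (r ∷ p) = [ _ ] , r ∷ p
  path-split (h ∷ []) (r ∷ p) with path-split [] p
  ... | q , s = r ∷ q , s
  path-split (h ∷ h′ ∷ pre) (r ∷ p) with path-split (h′ ∷ pre) p
  ... | q , s = r ∷ q , s

  arc₁ : ∀ {a b} pre {post} → ICycle a (pre ++ b ∷ post) → GPath a (a ∷ pre ++ b ∷ []) b
  arc₁ pre c = ICycle.a~x c ∷ proj₁ (path-split pre (ipath⇒path (ICycle.ip c)))

  arc₂ : ∀ {a b} pre {post} → ICycle a (pre ++ b ∷ post) → GPath b (b ∷ post ++ a ∷ []) a
  arc₂ pre c = ++-path (proj₂ (path-split pre (ipath⇒path (ICycle.ip c)))) (~-sym (ICycle.a~y c)) [ _ ]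

  -- Induced paths by index, and the path of an object

  record IndPath : Set where
    field
      p : ℕ → V
      N : ℕ
      next : ∀ {i} → suc i < N → p i ~ p (suc i)
      far : ∀ {i j} → suc i < j → j < N → ¬ p i ~ p j
      p-inj : ∀ {i j} → i < N → j < N → p i ≡ p j → i ≡ j

    verts : List V
    verts = applyUpTo p N

    Off : V → Set
    Off v = ∀ j → j < N → v ≢ p j

    on? : ∀ v → (∃ λ j → j < N × v ≡ p j) ⊎ Off v
    on? v with anyUpTo? (λ j → v ≟ p j) N
    ... | yes e = inj₁ e
    ... | no ne = inj₂ λ j lt e → ne (j , lt , e)

    Near : V → ℕ → Set
    Near u t = u ≡ p t ⊎ u ~ p t

    -- A vertex of the path itself needs three indices, its own and those of its two neighbours.
    Few : ℕ → ℕ → V → Set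
    Few lo hi u = Σ (List ℕ) λ J → length J ≤ 3 × (∀ {t} → lo ≤ t → t < hi → Near u t → t ∈ J)

    few-on : ∀ {s lo hi} → hi ≤ N → s < N → Few lo hi (p s)
    few-on {s} hiN s< = (s ∸ 1) ∷ s ∷ suc s ∷ [] , ≤-refl , f
      where
      f : ∀ {t} → _ ≤ t → t < _ → Near (p s) t → t ∈ (s ∸ 1) ∷ s ∷ suc s ∷ []
      f _ lt (inj₁ e) = there (here (sym (p-inj s< (<-≤-trans lt hiN) e)))
      f {t} _ lt (inj₂ e) with <-cmp s t
      ... | tri≈ _ refl _ = there (here refl)
      ... | tri< s<t _ _ with suc s ℕ.≟ t
      ...   | yes refl = there (there (here refl))
      ...   | no ne = ⊥-elim (far (≤∧≢⇒< s<t ne) (<-≤-trans lt hiN) e)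
      f {t} _ lt (inj₂ e) | tri> _ _ t<s with suc t ℕ.≟ s
      ...   | yes refl = here refl
      ...   | no ne = ⊥-elim (far (≤∧≢⇒< t<s ne) s< (~-sym e))

    awayPair : ∀ {lo hi} K us → All (Few lo hi) us → length us * 3 < K → lo + (K + K) ≤ hi →
      ∃ λ t → lo ≤ t × suc t < hi × (∀ {u} → u ∈ us → ¬ Near u t × ¬ Near u (suc t))
    awayPair {lo} {hi} K us fews lt hi≤ = t , a , <-≤-trans b hi≤ , λ u∈ →
        (λ nr → c (proj₂ J∪ u∈ a (<-trans (n<1+n t) (<-≤-trans b hi≤)) nr)) , λ nr → d (proj₂ J∪ u∈ (≤-trans a (n≤1+n t)) (<-≤-trans b hi≤) nr)
      where
      collect : ∀ us → All (Few lo hi) us → Σ (List ℕ) λ J → length J ≤ length us * 3 ×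
        (∀ {u t} → u ∈ us → lo ≤ t → t < hi → Near u t → t ∈ J)
      collect [] _ = [] , z≤n , λ ()
      collect (u ∷ us) ((J , le , f) ∷ fs) with collect us fs
      ... | J′ , le′ , g = J ++ J′ , ≤-trans (≤-reflexive (length-++ J)) (+-mono-≤ le le′) ,
            λ { (here refl) a b nr → ∈-++⁺ˡ (f a b nr) ; (there m) a b nr → ∈-++⁺ʳ J (g m a b nr) }
      J∪ : Σ (List ℕ) λ J → ∀ {u t} → u ∈ us → lo ≤ t → t < hi → Near u t → t ∈ J
      J∪ = let (J , _ , g) = collect us fews in J , g
      r = avoidPair lo K (proj₁ J∪) (≤-<-trans (proj₁ (proj₂ (collect us fews))) lt)
      t = proj₁ r
      a = proj₁ (proj₂ r)
      b = proj₁ (proj₂ (proj₂ r))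
      c = proj₁ (proj₂ (proj₂ (proj₂ r)))
      d = proj₂ (proj₂ (proj₂ (proj₂ r)))

    -- This carries results about the right end of a path over to its left end.
    reversed : IndPath
    reversed = record
      { p = λ i → p (N ∸ suc i) ; N = N
      ; next = λ {i} lt → ~-sym (subst (λ m → p (N ∸ suc (suc i)) ~ p m) (pos lt) (next (subst (_< N) (sym (pos lt)) (bound (<-trans (n<1+n i) lt)))))
      ; far = λ {i} {j} lt jN e → far (ord lt jN) (bound (<-trans (<-trans (n<1+n i) lt) jN)) (~-sym e)
      ; p-inj = λ {i} {j} iN jN e → back iN jN (p-inj (bound iN) (bound jN) e) }
      where
      bound : ∀ {i} → i < N → N ∸ suc i < N
      bound {i} lt = ≤-trans (≤-reflexive (sym (+-∸-assoc 1 lt))) (m∸n≤m N i)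
      pos : ∀ {i} → suc i < N → suc (N ∸ suc (suc i)) ≡ N ∸ suc i
      pos lt = sym (+-∸-assoc 1 lt)
      ord : ∀ {i j} → suc i < j → j < N → suc (N ∸ suc j) < N ∸ suc i
      ord {i} {j} lt jN = subst (_< N ∸ suc i) (+-∸-assoc 1 jN) (∸-monoʳ-< lt (<⇒≤ jN))
      back : ∀ {i j} → i < N → j < N → N ∸ suc i ≡ N ∸ suc j → i ≡ j
      back iN jN e = suc-injective (trans (sym (m∸[m∸n]≡n iN)) (trans (cong (N ∸_) e) (m∸[m∸n]≡n jN)))

  -- The interior of the spine of an object, as an induced path of G.
  record ObjectPath {H : Graph} (c : InducedSubdiv H G) : Set where
    field
      path : IndPath
    open IndPath path public
    open Objects H G
    field
      {x y a b} : V
      {l} : List V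
      hamilton : GPath x l y
      image⊆ : image c ⊆ l
      ⊆image : l ⊆ image c
      split : l ⊆ x ∷ y ∷ verts
      size : n (InducedSubdiv.sub c) ≡ suc (suc N)
      near-x : ∀ {i} → i < N → x ~ p i → i ≡ 0 ⊎ p i ≡ a
      near-y : ∀ {i} → i < N → y ~ p i → suc i ≡ N ⊎ p i ≡ b
      p∈ : ∀ {i} → i < N → p i ∈ image c
      off-x : Off x
      off-y : Off y

  objectPath′ : ∀ {H} → 2 ≤ n H → Spine H → (c : InducedSubdiv H G) → ObjectPath c
  objectPath′ {H} 2≤ spH c = record
    { path = record { p = p ; N = N ; next = st ; far = fa ; p-inj = λ a b e → suc-injective (q-inj (s<L a) (s<L b) e) }
    ; x = φ c.emb x ; y = φ c.emb y ; a = φ c.emb a ; b = φ c.emb b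
    ; hamilton = mapPath path
    ; image⊆ = λ m → let (i , e) = ∈-tabulate⁻ m in subst (_∈ map (φ c.emb) l) (sym e) (∈-map⁺ (φ c.emb) (cover i))
    ; ⊆image = λ m → let (i , _ , e) = ∈-map⁻ (φ c.emb) m in subst (_∈ image c) (sym e) (∈-tabulate⁺ i)
    ; split = λ m → let (i , i∈ , e) = ∈-map⁻ (φ c.emb) m ; (k , k< , e′) = index i∈ in
        subst (_∈ _) (sym (trans e (cong (φ c.emb) e′))) (spl k k<)
    ; size = trans (sym Leq) L≡
    ; near-x = nx ; near-y = ny
    ; p∈ = λ _ → ∈-tabulate⁺ _
    ; off-x = λ j lt e → 0≢ (q-inj (≤-trans (s≤s z≤n) (s<L lt)) (s<L lt) (trans (cong (φ c.emb) (nth-head path)) e))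
    ; off-y = λ j lt e → <-irrefl (q-inj (s<L lt) N<L (trans (sym e) (cong (φ c.emb) (sym y-eq)))) (s≤s lt) }
    where
    module c = InducedSubdiv c
    open Objects H G
    S = c.sub
    sp = subdivSpine spH c.isSub
    open Spine sp
    open Nth x
    L = length l
    Leq : L ≡ n S
    Leq = ≤-antisym (subst (L ≤_) (length-tabulate {n = n S} (λ i → i)) (card uniq (λ {i} _ → ∈-allFin i)))
                    (subst (_≤ L) (length-tabulate {n = n S} (λ i → i)) (card (allFin⁺ (n S)) (λ {i} _ → cover i)))
    steps≤ : ∀ {S} → Subdiv H S → n H ≤ n S
    steps≤ base = ≤-refl
    steps≤ (step d _ _ _) = ≤-trans (steps≤ d) (n≤1+n _)
    -- The two ends of the spine are left out, since every chord is incident with one of them.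
    N = L ∸ 2
    L≡ : L ≡ suc (suc N)
    L≡ = sym (m+[n∸m]≡n (≤-trans 2≤ (≤-trans (steps≤ c.isSub) (≤-reflexive (sym Leq)))))
    q : ℕ → V
    q i = φ c.emb (nth l i)
    p : ℕ → V
    p i = q (suc i)
    s<L : ∀ {i} → i < N → suc i < L
    s<L lt = subst (_ <_) (sym L≡) (s≤s (m<n⇒m<1+n lt))
    N<L : suc N < L
    N<L = subst (suc N <_) (sym L≡) ≤-refl
    0≢ : ∀ {i} → 0 ≢ suc i
    0≢ ()
    y-eq : nth l (suc N) ≡ y
    y-eq = nth-last path L≡
    q-inj : ∀ {i j} → i < L → j < L → q i ≡ q j → i ≡ j
    q-inj a b e = nth-inj uniq a b (inj c.emb e)
    st : ∀ {i} → suc i < N → p i ~ p (suc i)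
    st lt = trans (pres c.emb _ _) (nth-path path (s<L lt))
    adjacent : ∀ {i j} → i < L → j < L → q i ~ q j →
      (suc i ≡ j ⊎ suc j ≡ i) ⊎ (SamePair (nth l i) (nth l j) x a ⊎ SamePair (nth l i) (nth l j) y b)
    adjacent {i} {j} i< j< e with edges (nth l i) (nth l j) (trans (sym (pres c.emb _ _)) e)
    ... | inj₂ s = inj₂ s
    ... | inj₁ (inj₁ cs) = inj₁ (inj₁ (con i< j< cs))
      where
      con : ∀ {i j} → i < L → j < L → Consec (nth l i) (nth l j) l → suc i ≡ j
      con i< j< cs with nth-consec cs
      ... | k , k< , e , e′ with nth-inj uniq i< (<-trans (n<1+n k) k<) e | nth-inj uniq j< k< e′
      ... | refl | refl = refl
    ... | inj₁ (inj₂ cs) = inj₁ (inj₂ (con j< i< cs))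
      where
      con : ∀ {i j} → i < L → j < L → Consec (nth l i) (nth l j) l → suc i ≡ j
      con i< j< cs with nth-consec cs
      ... | k , k< , e , e′ with nth-inj uniq i< (<-trans (n<1+n k) k<) e | nth-inj uniq j< k< e′
      ... | refl | refl = refl
    notx : ∀ {i} → i < N → nth l (suc i) ≢ x
    notx lt e = 0≢ (nth-inj uniq (≤-trans (s≤s z≤n) (s<L lt)) (s<L lt) (trans (nth-head path) (sym e)))
    noty : ∀ {i} → i < N → nth l (suc i) ≢ y
    noty lt e = <-irrefl (nth-inj uniq (s<L lt) N<L (trans e (sym y-eq))) (s≤s lt)
    fa : ∀ {i j} → suc i < j → j < N → ¬ p i ~ p j
    fa {i} {j} lt jN e with adjacent (s<L iN) (s<L jN) e
      where iN = <-trans (<-trans (n<1+n i) lt) jN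
    ... | inj₁ (inj₁ refl) = <-irrefl refl lt
    ... | inj₁ (inj₂ refl) = <-irrefl refl (<-trans (n<1+n j) (<-trans (n<1+n (suc j)) lt))
    ... | inj₂ (inj₁ (inj₁ (h , _))) = notx (<-trans (<-trans (n<1+n i) lt) jN) h
    ... | inj₂ (inj₁ (inj₂ (_ , h))) = notx jN h
    ... | inj₂ (inj₂ (inj₁ (h , _))) = noty (<-trans (<-trans (n<1+n i) lt) jN) h
    ... | inj₂ (inj₂ (inj₂ (_ , h))) = noty jN h
    x≢y : x ≢ y
    x≢y e = 0≢ (nth-inj uniq (≤-trans (s≤s z≤n) N<L) N<L (trans (nth-head path) (trans e (sym y-eq))))
    nx : ∀ {i} → i < N → φ c.emb x ~ p i → i ≡ 0 ⊎ p i ≡ φ c.emb a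
    nx {i} iN e with adjacent (≤-trans (s≤s z≤n) N<L) (s<L iN) (subst (λ v → φ c.emb v ~ p i) (sym (nth-head path)) e)
    ... | inj₁ (inj₁ refl) = inj₁ refl
    ... | inj₂ (inj₁ (inj₁ (_ , h))) = inj₂ (cong (φ c.emb) h)
    ... | inj₂ (inj₁ (inj₂ (_ , h))) = ⊥-elim (notx iN h)
    ... | inj₂ (inj₂ (inj₁ (h , _))) = ⊥-elim (x≢y (trans (sym (nth-head path)) h))
    ... | inj₂ (inj₂ (inj₂ (_ , h))) = ⊥-elim (noty iN h)
    ny : ∀ {i} → i < N → φ c.emb y ~ p i → suc i ≡ N ⊎ p i ≡ φ c.emb b
    ny {i} iN e with adjacent N<L (s<L iN) (subst (λ v → φ c.emb v ~ p i) (sym y-eq) e)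
    ... | inj₁ (inj₁ refl) = ⊥-elim (<-irrefl refl (<-trans iN (n<1+n _)))
    ... | inj₁ (inj₂ e′) = inj₁ (suc-injective e′)
    ... | inj₂ (inj₁ (inj₁ (h , _))) = ⊥-elim (x≢y (sym (trans (sym y-eq) h)))
    ... | inj₂ (inj₁ (inj₂ (_ , h))) = ⊥-elim (notx iN h)
    ... | inj₂ (inj₂ (inj₁ (_ , h))) = inj₂ (cong (φ c.emb) h)
    ... | inj₂ (inj₂ (inj₂ (_ , h))) = ⊥-elim (noty iN h)
    mapPath : ∀ {x l y} → Path (λ i j → adj S i j ≡ true) x l y → GPath (φ c.emb x) (map (φ c.emb) l) (φ c.emb y)
    mapPath [ _ ] = [ _ ]
    mapPath (r ∷ p) = trans (pres c.emb _ _) r ∷ mapPath p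
    spl : ∀ k → k < L → q k ∈ φ c.emb x ∷ φ c.emb y ∷ applyUpTo p N
    spl zero lt = here (cong (φ c.emb) (nth-head path))
    spl (suc k) lt with k <? N
    ... | yes kN = there (there (∈-applyUpTo⁺ p kN))
    ... | no k≮ = there (here (cong (φ c.emb) (trans (cong (λ m → nth l (suc m)) k≡) y-eq)))
      where
      k≡ : k ≡ N
      k≡ = ≤-antisym (≤-pred (≤-pred (subst (suc k <_) L≡ lt))) (≮⇒≥ k≮)

  abstract
    objectPath : ∀ {H} → 2 ≤ n H → Spine H → (c : InducedSubdiv H G) → ObjectPath c
    objectPath = objectPath′

  -- Rungs, ladders and two-connectedness

  GReach : (V → Set) → V → V → Set
  GReach = Reach _~_

  Minus : (V → Set) → V → V → Set
  Minus S c v = S v × v ≢ c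

  TwoConnected : (V → Set) → Set
  TwoConnected S = ∀ {c x y} → S x → S y → x ≢ c → y ≢ c → GReach (Minus S c) x y

  -- All that is remembered of a ladder. The vertex d and its three neighbours exclude that S is
  -- just an induced cycle.
  record Good (P : IndPath) (r : ℕ) (S : List V) : Set where
    open IndPath P
    field
      two-connected : TwoConnected (_∈ S)
      {d e₁ e₂ e₃} : V
      d∈ : d ∈ S
      e₁∈ : e₁ ∈ S
      e₂∈ : e₂ ∈ S
      e₃∈ : e₃ ∈ S
      d~e₁ : d ~ e₁
      d~e₂ : d ~ e₂
      d~e₃ : d ~ e₃
      e₁≢e₂ : e₁ ≢ e₂
      e₁≢e₃ : e₁ ≢ e₃
      e₂≢e₃ : e₂ ≢ e₃
      start : ℕ
      run< : start + r ≤ N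
      run∈ : ∀ {t} → start ≤ t → t < start + r → p t ∈ S

  split-path : ∀ {x l y z} → GPath x l y → Unique l → z ∈ l → Σ (List V) λ pre → Σ (List V) λ suf →
    GPath x pre z × GPath z suf y × pre ⊆ l × suf ⊆ l × (∀ {c} → c ∈ pre → c ∈ suf → c ≡ z)
  split-path p@([ _ ]) _ (here refl) = _ , _ , [ _ ] , p , (λ m → m) , (λ m → m) , λ { (here e) _ → e }
  split-path p@(_ ∷ _) _ (here refl) = _ , _ , [ _ ] , p , (λ { (here e) → here e }) , (λ m → m) , λ { (here e) _ → e }
  split-path (r ∷ p) (x∉ ∷ u) (there m) with split-path p u m
  ... | pre , suf , q , q′ , s , s′ , f = _ , suf , r ∷ q , q′ , (λ { (here e) → here e ; (there m) → there (s m) }) , (λ m → there (s′ m)) ,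
        λ { (here refl) m′ → ⊥-elim (All.lookup x∉ (s′ m′) refl) ; (there m) m′ → f m m′ }

  module _ (P : IndPath) where

    open IndPath P

    segReach : ∀ {W : V → Set} i k → i + k < N → (∀ {j} → i ≤ j → j ≤ i + k → W (p j)) → GReach W (p i) (p (i + k))
    segReach i zero lt f rewrite +-identityʳ i = stop (f ≤-refl ≤-refl)
    segReach {W} i (suc k) lt f = step (f ≤-refl (m≤m+n i _)) (next (≤-trans (s≤s (≤-trans (s≤s (m≤m+n i k)) (≤-reflexive (sym (+-suc i k))))) lt))
      (subst (λ m → GReach W (p (suc i)) (p m)) (sym (+-suc i k))
        (segReach (suc i) k (subst (_< N) (+-suc i k) lt) (λ a b → f (<⇒≤ a) (≤-trans b (≤-reflexive (sym (+-suc i k)))))))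

    segReach′ : ∀ {W : V → Set} {i j} → i ≤ j → j < N → (∀ {k} → i ≤ k → k ≤ j → W (p k)) → GReach W (p i) (p j)
    segReach′ {W} {i} {j} le lt f = subst (λ m → GReach W (p i) (p m)) e (segReach i (j ∸ i) (subst (_< N) (sym e) lt) (λ a b → f a (≤-trans b (≤-reflexive e))))
      where e = m+[n∸m]≡n le

    -- A vertex set with its connectivity is recorded instead of a path, so that `flip` exchanges
    -- the feet without reversing anything.
    record Rung : Set where
      field
        s t : ℕ
        s< : s < N
        t< : t < N
        w : List V
        s∈ : p s ∈ w
        t∈ : p t ∈ w
        split : ∀ {c z} → z ∈ w → z ≢ c → GReach (Minus (_∈ w) c) z (p s) ⊎ GReach (Minus (_∈ w) c) z (p t)
        full : ∀ {c} → c ∉ w → GReach (Minus (_∈ w) c) (p s) (p t)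
        off : ∀ {v} → v ∈ w → (v ≡ p s ⊎ v ≡ p t) ⊎ Off v

    flip : Rung → Rung
    flip R = record { s = t ; t = s ; s< = t< ; t< = s< ; w = w ; s∈ = t∈ ; t∈ = s∈ ; split = λ m ne → Sum.swap (split m ne)
                    ; full = λ c∉ → reach-sym ~-sym (full c∉) ; off = λ m → Sum.map₁ Sum.swap (off m) }
      where open Rung R

    -- Two disjoint segments [a₀ , a₁] and [b₀ , b₁] of P joined by rungs, two of which start at a₀ and a₁.
    record Ladder : Set₁ where
      field
        S : V → Set
        R : Rung → Set
        a₀ a₁ b₀ b₁ : ℕ
        a₁< : a₁ < N
        b₁< : b₁ < N
        s≥ : ∀ {u} → R u → a₀ ≤ Rung.s u
        s≤ : ∀ {u} → R u → Rung.s u ≤ a₁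
        t≥ : ∀ {u} → R u → b₀ ≤ Rung.t u
        t≤ : ∀ {u} → R u → Rung.t u ≤ b₁
        lo hi : Rung
        lo∈ : R lo
        hi∈ : R hi
        lo≡ : Rung.s lo ≡ a₀
        hi≡ : Rung.s hi ≡ a₁
        apart : Disjoint (Rung.w lo) (Rung.w hi)
        A⊆ : ∀ {j} → a₀ ≤ j → j ≤ a₁ → S (p j)
        B⊆ : ∀ {j} → b₀ ≤ j → j ≤ b₁ → S (p j)
        w⊆ : ∀ {u v} → R u → v ∈ Rung.w u → S v
        parts : ∀ {v} → S v → (∃ λ j → a₀ ≤ j × j ≤ a₁ × v ≡ p j) ⊎ (∃ λ j → b₀ ≤ j × j ≤ b₁ × v ≡ p j) ⊎ (∃ λ u → R u × v ∈ Rung.w u)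

    -- If the deleted vertex c is not on the second segment, every other vertex of the ladder still
    -- reaches that segment. If it is, the segments exchange their roles: compare `ladderA` and
    -- `ladderB`.
    module Hub (ladder : Ladder) where

      open Ladder ladder

      module _ {c : V} (c∉B : ∀ {j} → b₀ ≤ j → j ≤ b₁ → p j ≢ c) where

        inB : ∀ {j} → b₀ ≤ j → j ≤ b₁ → GReach (Minus S c) (p j) (p b₀)
        inB j≥ j≤ = reach-sym ~-sym (segReach′ j≥ (≤-<-trans j≤ b₁<) (λ a b → B⊆ a (≤-trans b j≤) , c∉B a (≤-trans b j≤)))

        across : ∀ {u} → R u → c ∉ Rung.w u → GReach (Minus S c) (p (Rung.s u)) (p b₀)
        across {u} r c∉ = reach-trans (reach-mono (λ (m , ne) → w⊆ r m , ne) (Rung.full u c∉)) (inB (t≥ r) (t≤ r))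

        c∉rung : ∀ {u j} → R u → a₀ ≤ j → j ≤ a₁ → c ≡ p j → j ≢ Rung.s u → c ∉ Rung.w u
        c∉rung {u} {j} r j≥ j≤ refl ne m with Rung.off u m
        ... | inj₁ (inj₁ e) = ne (p-inj (≤-<-trans j≤ a₁<) (Rung.s< u) e)
        ... | inj₁ (inj₂ e) = c∉B (t≥ r) (t≤ r) (sym e)
        ... | inj₂ o = o j (≤-<-trans j≤ a₁<) refl

        up : ∀ {j} → a₀ ≤ j → j ≤ a₁ → (∀ {k} → j ≤ k → k ≤ a₁ → p k ≢ c) → c ∉ Rung.w hi → GReach (Minus S c) (p j) (p b₀)
        up j≥ j≤ f c∉ = reach-trans (segReach′ j≤ a₁< (λ a b → A⊆ (≤-trans j≥ a) b , f a b))
                          (subst (λ m → GReach (Minus S c) (p m) (p b₀)) hi≡ (across hi∈ c∉))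

        down : ∀ {j} → a₀ ≤ j → j ≤ a₁ → (∀ {k} → a₀ ≤ k → k ≤ j → p k ≢ c) → c ∉ Rung.w lo → GReach (Minus S c) (p j) (p b₀)
        down j≥ j≤ f c∉ = reach-trans (reach-sym ~-sym (segReach′ j≥ (≤-<-trans j≤ a₁<) (λ a b → A⊆ a (≤-trans b j≤) , f a b)))
                          (subst (λ m → GReach (Minus S c) (p m) (p b₀)) lo≡ (across lo∈ c∉))

        -- Walk along the segment to one of its ends and cross by the rung there. If c is not on the
        -- segment, it lies on at most one of the two disjoint end rungs. If it is, walk away from
        -- it; the rung at that end avoids c because rungs meet P only in their feet.
        inA : ∀ {j} → a₀ ≤ j → j ≤ a₁ → p j ≢ c → GReach (Minus S c) (p j) (p b₀)
        inA {j} j≥ j≤ ne with anyUpTo? (λ i → c ≟ p i) (suc a₁)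
        ... | no c∉ with c ∈? Rung.w lo
        ...   | no c∉lo = down j≥ j≤ (λ {k} a b e → c∉ (k , s≤s (≤-trans b j≤) , sym e)) c∉lo
        ...   | yes c∈lo = up j≥ j≤ (λ {k} a b e → c∉ (k , s≤s b , sym e)) (apart c∈lo)
        inA {j} j≥ j≤ ne | yes (i , s≤s i≤ , c≡) with <-cmp i j
        ... | tri≈ _ refl _ = ⊥-elim (ne (sym c≡))
        ... | tri> _ _ j<i = down j≥ j≤ (λ {k} a b e → <-irrefl (p-inj (≤-<-trans (≤-trans b j≤) a₁<) (≤-<-trans i≤ a₁<) (trans e c≡)) (≤-<-trans b j<i))
              (c∉rung lo∈ (≤-trans j≥ (<⇒≤ j<i)) i≤ c≡ (λ e → <-irrefl (sym (trans e lo≡)) (≤-<-trans j≥ j<i)))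
        ... | tri< i<j _ _ = up j≥ j≤ (λ {k} a b e → <-irrefl (sym (p-inj (≤-<-trans b a₁<) (≤-<-trans i≤ a₁<) (trans e c≡))) (<-≤-trans i<j a)) avoid
          where
          avoid : c ∉ Rung.w hi
          avoid m with Rung.off hi m
          ... | inj₁ (inj₁ e) = <-irrefl (p-inj (≤-<-trans i≤ a₁<) (Rung.s< hi) (trans (sym c≡) e)) (<-≤-trans i<j (≤-trans j≤ (≤-reflexive (sym hi≡))))
          ... | inj₁ (inj₂ e) = c∉B (t≥ hi∈) (t≤ hi∈) (sym e)
          ... | inj₂ o = o i (≤-<-trans i≤ a₁<) c≡

        toHub : ∀ {z} → S z → z ≢ c → GReach (Minus S c) z (p b₀)
        toHub sz ne with parts sz
        ... | inj₁ (j , a , b , refl) = inA a b ne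
        ... | inj₂ (inj₁ (j , a , b , refl)) = inB a b
        ... | inj₂ (inj₂ (u , r , m)) with Rung.split u m ne
        ...   | inj₁ q = reach-trans (reach-mono (λ (m , ne) → w⊆ r m , ne) q) (inA (s≥ r) (s≤ r) (proj₂ (reach-end q)))
        ...   | inj₂ q = reach-trans (reach-mono (λ (m , ne) → w⊆ r m , ne) q) (inB (t≥ r) (t≤ r))

    -- The vertex `exit` follows the left foot on the rung. It is not on the left part of P, so it
    -- is a third neighbour of a foot inside the left segment.
    record CutRung (cut : ℕ) : Set where
      field
        rung : Rung
      open Rung rung public
      field
        s<cut : s < cut
        cut≤t : cut ≤ t
        {exit} : V
        exit∈ : exit ∈ w
        s~exit : p s ~ exit
        exit-off : exit ≡ p t ⊎ Off exit

    module Box {cut : ℕ} (L : List (CutRung cut)) where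

      open CutRung

      module Build (r : ℕ) (3≤r : 3 ≤ r) (r≤ : r ≤ length L)
        (ds : AllPairs (λ u v → s u ≢ s v) L) (dt : AllPairs (λ u v → t u ≢ t v) L)
        (dw : ∀ {u v} → u ∈ L → v ∈ L → s u ≢ s v → Disjoint (w u) (w v)) (u₀ : CutRung cut) (u₀∈ : u₀ ∈ L) where

        ext : (f : CutRung cut → ℕ) → ∃ λ lo → ∃ λ hi → lo ∈ L × hi ∈ L × (∀ {u} → u ∈ L → f lo ≤ f u) × (∀ {u} → u ∈ L → f u ≤ f hi)
        ext f = go L u₀∈
          where
          go : ∀ L → u₀ ∈ L → ∃ λ lo → ∃ λ hi → lo ∈ L × hi ∈ L × (∀ {u} → u ∈ L → f lo ≤ f u) × (∀ {u} → u ∈ L → f u ≤ f hi)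
          go (a ∷ l) _ = let (m , m∈ , h) = argmin f a l ; (m′ , m′∈ , h′) = argmax f a l in m , m′ , m∈ , m′∈ , h , h′

        alo = proj₁ (ext s)
        ahi = proj₁ (proj₂ (ext s))
        alo∈ = proj₁ (proj₂ (proj₂ (ext s)))
        ahi∈ = proj₁ (proj₂ (proj₂ (proj₂ (ext s))))
        alo≤ : ∀ {u} → u ∈ L → s alo ≤ s u
        alo≤ = proj₁ (proj₂ (proj₂ (proj₂ (proj₂ (ext s)))))
        ahi≥ : ∀ {u} → u ∈ L → s u ≤ s ahi
        ahi≥ = proj₂ (proj₂ (proj₂ (proj₂ (proj₂ (ext s)))))
        blo = proj₁ (ext t)
        bhi = proj₁ (proj₂ (ext t))
        blo∈ = proj₁ (proj₂ (proj₂ (ext t)))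
        bhi∈ = proj₁ (proj₂ (proj₂ (proj₂ (ext t))))
        blo≤ : ∀ {u} → u ∈ L → t blo ≤ t u
        blo≤ = proj₁ (proj₂ (proj₂ (proj₂ (proj₂ (ext t)))))
        bhi≥ : ∀ {u} → u ∈ L → t u ≤ t bhi
        bhi≥ = proj₂ (proj₂ (proj₂ (proj₂ (proj₂ (ext t)))))

        seg : ℕ → ℕ → List V
        seg i j = applyUpTo (λ k → p (i + k)) (suc (j ∸ i))

        seg⁺ : ∀ {i j k} → i ≤ k → k ≤ j → p k ∈ seg i j
        seg⁺ {i} {j} {k} a b = subst (λ m → p m ∈ seg i j) (m+[n∸m]≡n a) (∈-applyUpTo⁺ (λ k → p (i + k)) (s≤s (∸-monoˡ-≤ i b)))

        seg⁻ : ∀ {i j v} → i ≤ j → v ∈ seg i j → ∃ λ k → i ≤ k × k ≤ j × v ≡ p k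
        seg⁻ {i} {j} le m with ∈-applyUpTo⁻ (λ k → p (i + k)) m
        ... | k , s≤s k≤ , e = i + k , m≤m+n i k , ≤-trans (+-monoʳ-≤ i k≤) (≤-reflexive (m+[n∸m]≡n le)) , e

        rungVerts : List (CutRung cut) → List V
        rungVerts [] = []
        rungVerts (u ∷ us) = w u ++ rungVerts us

        rungVerts⁺ : ∀ {u v us} → u ∈ us → v ∈ w u → v ∈ rungVerts us
        rungVerts⁺ (here refl) m = ∈-++⁺ˡ m
        rungVerts⁺ {us = u ∷ _} (there u∈) m = ∈-++⁺ʳ (w u) (rungVerts⁺ u∈ m)

        rungVerts⁻ : ∀ {v} us → v ∈ rungVerts us → ∃ λ u → u ∈ us × v ∈ w u
        rungVerts⁻ (u ∷ us) m with ∈-++⁻ (w u) m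
        ... | inj₁ m′ = u , here refl , m′
        ... | inj₂ m′ = let (u′ , a , b) = rungVerts⁻ us m′ in u′ , there a , b

        S : List V
        S = seg (s alo) (s ahi) ++ seg (t blo) (t bhi) ++ rungVerts L

        inA : ∀ {j} → s alo ≤ j → j ≤ s ahi → p j ∈ S
        inA a b = ∈-++⁺ˡ (seg⁺ a b)

        inB : ∀ {j} → t blo ≤ j → j ≤ t bhi → p j ∈ S
        inB a b = ∈-++⁺ʳ (seg (s alo) (s ahi)) (∈-++⁺ˡ (seg⁺ a b))

        inW : ∀ {u v} → u ∈ L → v ∈ w u → v ∈ S
        inW u∈ m = ∈-++⁺ʳ (seg (s alo) (s ahi)) (∈-++⁺ʳ (seg (t blo) (t bhi)) (rungVerts⁺ u∈ m))

        S⁻ : ∀ {v} → v ∈ S → (∃ λ j → s alo ≤ j × j ≤ s ahi × v ≡ p j) ⊎ (∃ λ j → t blo ≤ j × j ≤ t bhi × v ≡ p j) ⊎ (∃ λ u → u ∈ L × v ∈ w u)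
        S⁻ m with ∈-++⁻ (seg (s alo) (s ahi)) m
        ... | inj₁ m′ = inj₁ (seg⁻ (alo≤ ahi∈) m′)
        ... | inj₂ m′ with ∈-++⁻ (seg (t blo) (t bhi)) m′
        ...   | inj₁ m″ = inj₂ (inj₁ (seg⁻ (blo≤ bhi∈) m″))
        ...   | inj₂ m″ = inj₂ (inj₂ (rungVerts⁻ L m″))

        R : Rung → Set
        R u = ∃ λ v → v ∈ L × u ≡ rung v

        -- At least r distinct positions lie between the extreme ones, so the segment contains r
        -- consecutive vertices; for s they become the run of `Good`.
        spread : ∀ (f : CutRung cut → ℕ) → AllPairs (λ u v → f u ≢ f v) L → ∀ {lo hi} → lo ∈ L → (∀ {u} → u ∈ L → f lo ≤ f u) → (∀ {u} → u ∈ L → f u ≤ f hi) →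
                 f lo + r ≤ suc (f hi)
        spread f d {lo} {hi} lo∈ h h′ = ≤-trans (+-monoʳ-≤ (f lo) (≤-trans r≤ (≤-trans (≤-reflexive (sym (length-map f L)))
            (≤-trans (card (AP.map⁺ d) inc) (≤-reflexive (length-applyUpTo (f lo +_) (suc (f hi ∸ f lo)))))))) 
            (≤-reflexive (trans (+-suc (f lo) _) (cong suc (m+[n∸m]≡n (h′ lo∈)))))
          where
          inc : map f L ⊆ applyUpTo (f lo +_) (suc (f hi ∸ f lo))
          inc m with ∈-map⁻ f m
          ... | u , u∈ , refl = subst (_∈ applyUpTo (f lo +_) (suc (f hi ∸ f lo))) (m+[n∸m]≡n (h u∈)) (∈-applyUpTo⁺ (f lo +_) (s≤s (∸-monoˡ-≤ (f lo) (h′ u∈))))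

        s-spread : s alo + r ≤ suc (s ahi)
        s-spread = spread s ds {alo} {ahi} alo∈ alo≤ ahi≥

        s-far : suc (s alo) < s ahi
        s-far = ≤-pred (≤-trans (≤-trans (≤-reflexive (trans (cong suc (cong suc (+-comm 1 _))) (cong suc (sym (+-suc (s alo) 1))))) (≤-reflexive (sym (+-suc (s alo) 2)))) (≤-trans (+-monoʳ-≤ (s alo) 3≤r) s-spread))

        t-lt : t blo < t bhi
        t-lt = ≤-pred (≤-trans (≤-trans (s≤s (≤-trans (s≤s (m≤m+n (t blo) 1)) (≤-reflexive (sym (+-suc (t blo) 1))))) (≤-reflexive (sym (+-suc (t blo) 2))))
                  (≤-trans (+-monoʳ-≤ (t blo) 3≤r) (spread t dt {blo} {bhi} blo∈ blo≤ bhi≥)))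

        dw′ : ∀ {u v} → u ∈ L → v ∈ L → t u ≢ t v → Disjoint (w u) (w v)
        dw′ {u} {v} u∈ v∈ ne with s u ℕ.≟ s v
        ... | no ne′ = dw u∈ v∈ ne′
        ... | yes e with allPairs-lookup (λ h e → h (sym e)) ds u∈ v∈
        ...   | inj₁ refl = ⊥-elim (ne refl)
        ...   | inj₂ ne′ = ⊥-elim (ne′ e)

        segs : ∀ {i j} → i ≤ s ahi → t blo ≤ j → i ≢ j
        segs i≤ ≤j refl = <-irrefl refl (<-≤-trans (s<cut ahi) (≤-trans (cut≤t blo) (≤-trans ≤j i≤)))

        ladderA : Ladder
        ladderA = record
          { S = _∈ S ; R = R ; a₀ = s alo ; a₁ = s ahi ; b₀ = t blo ; b₁ = t bhi ; a₁< = s< ahi ; b₁< = t< bhi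
          ; s≥ = λ { (v , v∈ , refl) → alo≤ v∈ } ; s≤ = λ { (v , v∈ , refl) → ahi≥ v∈ } ; t≥ = λ { (v , v∈ , refl) → blo≤ v∈ } ; t≤ = λ { (v , v∈ , refl) → bhi≥ v∈ }
          ; lo = rung alo ; hi = rung ahi ; lo∈ = alo , alo∈ , refl ; hi∈ = ahi , ahi∈ , refl ; lo≡ = refl ; hi≡ = refl
          ; apart = dw alo∈ ahi∈ (λ e → <-irrefl e (<-trans (n<1+n _) s-far))
          ; A⊆ = inA ; B⊆ = inB ; w⊆ = λ { (v , v∈ , refl) m → inW v∈ m }
          ; parts = λ m → Sum.map₂ (Sum.map₂ (λ (u , u∈ , m) → rung u , (u , u∈ , refl) , m)) (S⁻ m) }

        swap₃ : ∀ {A B C : Set} → A ⊎ B ⊎ C → B ⊎ A ⊎ C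
        swap₃ (inj₁ a) = inj₂ (inj₁ a)
        swap₃ (inj₂ (inj₁ b)) = inj₁ b
        swap₃ (inj₂ (inj₂ c)) = inj₂ (inj₂ c)

        ladderB : Ladder
        ladderB = record
          { S = _∈ S ; R = λ u → ∃ λ v → v ∈ L × u ≡ flip (rung v) ; a₀ = t blo ; a₁ = t bhi ; b₀ = s alo ; b₁ = s ahi ; a₁< = t< bhi ; b₁< = s< ahi
          ; s≥ = λ { (v , v∈ , refl) → blo≤ v∈ } ; s≤ = λ { (v , v∈ , refl) → bhi≥ v∈ } ; t≥ = λ { (v , v∈ , refl) → alo≤ v∈ } ; t≤ = λ { (v , v∈ , refl) → ahi≥ v∈ }
          ; lo = flip (rung blo) ; hi = flip (rung bhi) ; lo∈ = blo , blo∈ , refl ; hi∈ = bhi , bhi∈ , refl ; lo≡ = refl ; hi≡ = refl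
          ; apart = dw′ blo∈ bhi∈ (λ e → <-irrefl e t-lt)
          ; A⊆ = inB ; B⊆ = inA ; w⊆ = λ { (v , v∈ , refl) m → inW v∈ m }
          ; parts = λ m → swap₃ (Sum.map₂ (Sum.map₂ (λ (u , u∈ , m) → flip (rung u) , (u , u∈ , refl) , m)) (S⁻ m)) }

        toHubA : ∀ {c} → (∀ {j} → t blo ≤ j → j ≤ t bhi → p j ≢ c) → ∀ {z} → z ∈ S → z ≢ c → GReach (Minus (_∈ S) c) z (p (t blo))
        toHubA = Hub.toHub ladderA

        toHubB : ∀ {c} → (∀ {j} → s alo ≤ j → j ≤ s ahi → p j ≢ c) → ∀ {z} → z ∈ S → z ≢ c → GReach (Minus (_∈ S) c) z (p (s alo))
        toHubB = Hub.toHub ladderB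

        two : TwoConnected (_∈ S)
        two {c} sx sy x≢ y≢ with anyUpTo? (λ j → (t blo ≤? j) ×-dec (p j ≟ c)) (suc (t bhi))
          where open import Relation.Nullary.Decidable using (_×-dec_)
        ... | no ne = reach-trans (toHubA f sx x≢) (reach-sym ~-sym (toHubA f sy y≢))
          where
          f : ∀ {j} → t blo ≤ j → j ≤ t bhi → p j ≢ c
          f {j} a b e = ne (j , s≤s b , a , e)
        ... | yes (j , s≤s j≤ , ≤j , refl) = reach-trans (toHubB f sx x≢) (reach-sym ~-sym (toHubB f sy y≢))
          where
          f : ∀ {i} → s alo ≤ i → i ≤ s ahi → p i ≢ p j
          f a b e = segs b ≤j (p-inj (≤-<-trans b (s< ahi)) (≤-<-trans j≤ (t< bhi)) e)

        -- Among three distinct feet at most two are extreme. The third has both neighbours on the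
        -- segment and becomes the vertex of degree three in `good`.
        middle : ∃ λ u → u ∈ L × s alo < s u × s u < s ahi
        middle = go L (λ m → m) ds (≤-trans 3≤r r≤)
          where
          inside : ∀ {u} → u ∈ L → s u ≢ s alo → s u ≢ s ahi → ∃ λ u → u ∈ L × s alo < s u × s u < s ahi
          inside u∈ a b = _ , u∈ , ≤∧≢⇒< (alo≤ u∈) (λ e → a (sym e)) , ≤∧≢⇒< (ahi≥ u∈) b
          go : ∀ M → M ⊆ L → AllPairs (λ u v → s u ≢ s v) M → 3 ≤ length M → ∃ λ u → u ∈ L × s alo < s u × s u < s ahi
          go (_ ∷ []) _ _ (s≤s ())
          go (_ ∷ _ ∷ []) _ _ (s≤s (s≤s ()))
          go (a ∷ b ∷ c ∷ _) i ((a≢b ∷ a≢c ∷ _) ∷ (b≢c ∷ _) ∷ _) _ with s a ℕ.≟ s alo | s a ℕ.≟ s ahi | s b ℕ.≟ s alo | s b ℕ.≟ s ahi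
          ... | no p | no q | _ | _ = inside (i (here refl)) p q
          ... | _ | _ | no p | no q = inside (i (there (here refl))) p q
          ... | yes p | _ | yes q | _ = ⊥-elim (a≢b (trans p (sym q)))
          ... | _ | yes p | _ | yes q = ⊥-elim (a≢b (trans p (sym q)))
          ... | yes p | _ | _ | yes q = inside (i (there (there (here refl)))) (λ e → a≢c (trans p (sym e))) (λ e → b≢c (trans q (sym e)))
          ... | _ | yes p | yes q | _ = inside (i (there (there (here refl)))) (λ e → b≢c (trans q (sym e))) (λ e → a≢c (trans p (sym e)))

        good : Good P r S
        good with middle
        ... | u , u∈ , lt , lt′ = build (s u) refl lt
          where
          build : ∀ k → k ≡ s u → s alo < k → Good P r S
          build (suc k) e lo< = record
            { two-connected = two
            ; d∈ = inA (<⇒≤ lt) (<⇒≤ lt′)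
            ; e₁∈ = inA {k} (≤-pred lo<) (≤-trans (≤-trans (n≤1+n k) (≤-reflexive e)) (<⇒≤ lt′))
            ; e₂∈ = inA {suc (s u)} (m≤n⇒m≤1+n (<⇒≤ lt)) lt′
            ; e₃∈ = inW u∈ (exit∈ u)
            ; d~e₁ = ~-sym (subst (λ m → p k ~ p m) e (next (subst (_< N) (sym e) (s< u))))
            ; d~e₂ = next (≤-<-trans lt′ (s< ahi))
            ; d~e₃ = s~exit u
            ; e₁≢e₂ = λ e′ → <-irrefl (p-inj k< (≤-<-trans lt′ (s< ahi)) e′) (≤-trans (s≤s (n≤1+n k)) (s≤s (≤-reflexive e)))
            ; e₁≢e₃ = λ e′ → out k< (≤-trans (≤-trans (n≤1+n k) (≤-reflexive e)) (<⇒≤ lt′)) (sym e′)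
            ; e₂≢e₃ = λ e′ → out (≤-<-trans lt′ (s< ahi)) lt′ (sym e′)
            ; start = s alo
            ; run< = ≤-trans s-spread (s< ahi)
            ; run∈ = λ a b → inA a (≤-pred (≤-trans b s-spread)) }
            where
            k< : k < N
            k< = <-trans (≤-reflexive e) (s< u)
            out : ∀ {j} → j < N → j ≤ s ahi → exit u ≢ p j
            out {j} j< j≤ e with exit-off u
            ... | inj₁ e′ = segs j≤ (blo≤ u∈) (p-inj j< (t< u) (trans (sym e) e′))
            ... | inj₂ o = o j j< e

  -- Cuts of the path, peeling and the induction on k

  module Packing (H : Graph) (spine : Spine H) (2≤ : 2 ≤ n H) where

    open Objects H G public
    open Search H G public
    open Menger (_≟_ {n G}) using (Edges; EPath; Link; mkLink; src; tgt; verts; path; src∈; tgt∈; menger; Separates; Linkage)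

    Object : Set
    Object = InducedSubdiv H G

    Avoids : List V → Object → Set
    Avoids X c = ∀ {v} → v ∈ image c → v ∉ X

    Meets : List V → Object → Set
    Meets Z c = ∃ λ v → v ∈ image c × v ∈ Z

    Apart : Object → Object → Set
    Apart c c′ = Disjoint (image c) (image c′)

    apart-sym : ∀ {c c′} → Apart c c′ → Apart c′ c
    apart-sym {c} {c′} d a b = d b a

    avoids-++ : ∀ {X Y c} → Avoids X c → Avoids Y c → Avoids (X ++ Y) c
    avoids-++ {X} a b m m′ with ∈-++⁻ X m′
    ... | inj₁ x = a m x
    ... | inj₂ y = b m y

    avoids-++ˡ : ∀ {X Y c} → Avoids (X ++ Y) c → Avoids X c
    avoids-++ˡ a m m′ = a m (∈-++⁺ˡ m′)

    avoids-++ʳ : ∀ X {Y c} → Avoids (X ++ Y) c → Avoids Y c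
    avoids-++ʳ X a m m′ = a m (∈-++⁺ʳ X m′)

    meets? : ∀ Z c → Meets Z c ⊎ Avoids Z c
    meets? Z c with any? (_∈? Z) (image c)
    ... | yes a = inj₁ (find a)
    ... | no na = inj₂ λ m m′ → na (lose m m′)

    connected : ∀ (c : Object) {u v} → u ∈ image c → v ∈ image c → GReach (_∈ image c) u v
    connected c u∈ v∈ = reach-trans (reach-sym ~-sym (from (image⊆ u∈))) (from (image⊆ v∈))
      where
      open ObjectPath (objectPath 2≤ spine c)
      prefix : ∀ {x l y v} → GPath x l y → v ∈ l → (∀ {w} → w ∈ l → w ∈ image c) → GReach (_∈ image c) x v
      prefix [ _ ] (here refl) f = stop (f (here refl))
      prefix (_ ∷ _) (here refl) f = stop (f (here refl))
      prefix (r ∷ p) (there m) f = step (f (here refl)) r (prefix p m (λ w → f (there w)))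
      from : ∀ {v} → v ∈ l → GReach (_∈ image c) x v
      from m = prefix hamilton m ⊆image

    module Trim (P : IndPath) (cut : ℕ) where

      open IndPath P

      OnL : V → Set
      OnL v = ∃ λ i → i < cut × i < N × v ≡ p i

      OnR : V → Set
      OnR v = ∃ λ j → cut ≤ j × j < N × v ≡ p j

      locate : ∀ v → OnL v ⊎ OnR v ⊎ Off v
      locate v with on? v
      ... | inj₂ o = inj₂ (inj₂ o)
      ... | inj₁ (j , lt , e) with j <? cut
      ...   | yes a = inj₁ (j , a , lt , e)
      ...   | no a = inj₂ (inj₁ (j , ≮⇒≥ a , lt , e))

      record Crossing (l : List V) : Set where
        field
          {u v} : V
          {l′} : List V
          gp : GPath u l′ v
          onL : OnL u
          onR : OnR v
          sub : l′ ⊆ l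
          mid : ∀ {w} → w ∈ l′ → (w ≡ u ⊎ w ≡ v) ⊎ Off w

      record Tail (u : V) (l : List V) : Set where
        field
          {v} : V
          {l′} : List V
          gp : GPath u l′ v
          onR : OnR v
          sub : l′ ⊆ l
          mid : ∀ {w} → w ∈ l′ → w ≡ v ⊎ Off w

      -- The walk is scanned from its end. A vertex on the right restarts the tail, a vertex off P
      -- prolongs it, and a vertex on the left completes it to a crossing, whose inner vertices are
      -- then off P.
      crossing : ∀ {u l v} → GPath u l v → OnR v → Crossing l ⊎ Tail u l
      crossing {u} p r with locate u
      crossing {u} p r | inj₂ (inj₁ r′) = inj₂ (record { gp = [ u ] ; onR = r′ ; sub = λ { (here refl) → head∈ p } ; mid = λ { (here e) → inj₁ e } })
      crossing [ u ] r | inj₁ _ = inj₂ (record { gp = [ u ] ; onR = r ; sub = λ m → m ; mid = λ { (here e) → inj₁ e } })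
      crossing [ u ] r | inj₂ (inj₂ _) = inj₂ (record { gp = [ u ] ; onR = r ; sub = λ m → m ; mid = λ { (here e) → inj₁ e } })
      crossing (e ∷ p) r | inj₁ l with crossing p r
      ... | inj₁ c = inj₁ (record { Crossing c ; sub = λ m → there (Crossing.sub c m) })
      ... | inj₂ t = inj₁ (record { gp = e ∷ Tail.gp t ; onL = l ; onR = Tail.onR t
                                  ; sub = λ { (here e) → here e ; (there m) → there (Tail.sub t m) }
                                  ; mid = λ { (here e) → inj₁ (inj₁ e) ; (there m) → Sum.map₁ inj₂ (Tail.mid t m) } })
      crossing (e ∷ p) r | inj₂ (inj₂ o) with crossing p r
      ... | inj₁ c = inj₁ (record { Crossing c ; sub = λ m → there (Crossing.sub c m) })
      ... | inj₂ t = inj₂ (record { gp = e ∷ Tail.gp t ; onR = Tail.onR t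
                                  ; sub = λ { (here e) → here e ; (there m) → there (Tail.sub t m) }
                                  ; mid = λ { (here refl) → inj₂ o ; (there m) → Tail.mid t m } })

      not-both : ∀ {v} → OnL v → ¬ OnR v
      not-both (i , i< , iN , e) (j , ≤j , jN , e′) = <-irrefl (p-inj iN jN (trans (sym e) e′)) (<-≤-trans i< ≤j)

      crossing′ : ∀ {u l v} → GPath u l v → OnL u → OnR v → Crossing l
      crossing′ p l r with crossing p r
      ... | inj₁ c = c
      crossing′ [ u ] l r | inj₂ _ = ⊥-elim (not-both l r)
      crossing′ (e ∷ p) l r | inj₂ _ with crossing p r
      ... | inj₁ c = record { Crossing c ; sub = λ m → there (Crossing.sub c m) }
      ... | inj₂ t = record { gp = e ∷ Tail.gp t ; onL = l ; onR = Tail.onR t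
                            ; sub = λ { (here e) → here e ; (there m) → there (Tail.sub t m) }
                            ; mid = λ { (here e) → inj₁ (inj₁ e) ; (there m) → Sum.map₁ inj₂ (Tail.mid t m) } }

      cutRung : ∀ {u l v} → GPath u l v → OnL u → OnR v → Σ (CutRung P cut) λ R → CutRung.w R ⊆ l
      cutRung gp₀ l₀ r₀ with crossing′ gp₀ l₀ r₀
      ... | record { gp = gp ; onL = (i , i< , iN , refl) ; onR = (j , ≤j , jN , refl) ; sub = sub ; mid = mid } with induce gp
      ...   | l″ , ip , sub′ , _ = record
        { rung = record
            { s = i ; t = j ; s< = iN ; t< = jN ; w = l″ ; s∈ = head∈ q ; t∈ = last∈ q ; split = sp
            ; full = λ c∉ → path⇒reach q (λ m → m , λ { refl → c∉ m }) ; off = λ m → mid (sub′ m) }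
        ; s<cut = i< ; cut≤t = ≤j
        ; exit∈ = proj₁ (proj₂ (ex ip refl (λ m → m))) ; s~exit = proj₁ (proj₂ (proj₂ (ex ip refl (λ m → m)))) ; exit-off = proj₂ (proj₂ (proj₂ (ex ip refl (λ m → m)))) } , λ m → sub (sub′ m)
        where
        q = ipath⇒path ip
        sp : ∀ {c z} → z ∈ l″ → z ≢ c → GReach (Minus (_∈ l″) c) z (p i) ⊎ GReach (Minus (_∈ l″) c) z (p j)
        sp {c} z∈ ne with split-path q (ipath-unique ip) z∈
        ... | pre , suf , q₁ , q₂ , s₁ , s₂ , f with c ∈? pre
        ...   | no c∉ = inj₁ (reach-sym ~-sym (path⇒reach q₁ (λ m → s₁ m , λ { refl → c∉ m })))
        ...   | yes c∈ = inj₂ (path⇒reach q₂ (λ m → s₂ m , λ { refl → ne (sym (f c∈ m)) }))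
        ij : p i ≢ p j
        ij e = <-irrefl (p-inj iN jN e) (<-≤-trans i< ≤j)
        ex : ∀ {l u} → IPath (p i) l u → u ≡ p j → l ⊆ l″ → ∃ λ v → v ∈ l × p i ~ v × (v ≡ p j ⊎ Off v)
        ex [ _ ] e _ = ⊥-elim (ij e)
        ex (cons {y = z} r _ _) _ s with mid (sub′ (s (there (here refl))))
        ... | inj₂ o = z , there (here refl) , r , inj₂ o
        ... | inj₁ (inj₂ e) = z , there (here refl) , r , inj₁ e
        ... | inj₁ (inj₁ e) = ⊥-elim (~-irrefl (subst (_ ~_) e r))

    module PathLemma (P : IndPath) (r : ℕ) (3≤r : 3 ≤ r) (J : ℕ) (X₀ : List V)
      (ladder : ∀ {S} → Good P r S → (∀ {v} → v ∈ S → v ∈ IndPath.verts P ⊎ v ∉ X₀) → Σ Object λ c → image c ⊆ S)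
      (meetsP : ∀ {c} → Avoids X₀ c → ∃ λ i → i < IndPath.N P × IndPath.p P i ∈ image c) where

      open IndPath P renaming (verts to vertsP)

      -- Only the rungs avoid everything removed so far; the segments of P in a ladder may pass
      -- through objects peeled off before. So these objects are not combined with the peeled ones
      -- but form an outcome of their own, and they need to avoid X₀ only off P.
      Ladders : Set
      Ladders = Σ (List Object) λ cs → length cs ≡ 2 ^ J × AllPairs Apart cs × (∀ {c} → c ∈ cs → ∀ {v} → v ∈ image c → v ∈ vertsP ⊎ v ∉ X₀)

      -- The value of `need` is the same for all coordinates, so dummy ones fix it before there are
      -- any rungs.
      m : ℕ
      m = Boxes.need {CutRung P 0} (λ _ → 0) (λ _ → 0) r J

      need≡ : ∀ {A B : Set} {x y : A → ℕ} {x′ y′ : B → ℕ} r j → Boxes.need x y r j ≡ Boxes.need x′ y′ r j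
      need≡ {x = x} {y} {x′} {y′} r j = trans (Boxes.need-eq x y r j) (sym (Boxes.need-eq x′ y′ r j))

      module FromRungs {cut : ℕ} (L : List (CutRung P cut)) (len : m ≤ length L)
        (dis : AllPairs (λ u v → Disjoint (CutRung.w u) (CutRung.w v)) L)
        (clean : ∀ {u v} → u ∈ L → v ∈ CutRung.w u → v ∉ X₀) where

        open CutRung
        open Boxes {CutRung P cut} s t hiding (Apart)

        ds : AllPairs (λ u v → s u ≢ s v) L
        ds = AllP.map (λ {u} {v} d e → d (s∈ u) (subst (λ k → p k ∈ w v) (sym e) (s∈ v))) dis

        dt : AllPairs (λ u v → t u ≢ t v) L
        dt = AllP.map (λ {u} {v} d e → d (t∈ u) (subst (λ k → p k ∈ w v) (sym e) (t∈ v))) dis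

        dw : ∀ {u v} → u ∈ L → v ∈ L → s u ≢ s v → Disjoint (w u) (w v)
        dw {u} {v} u∈ v∈ ne with allPairs-lookup (λ {u} {v} → disjoint-sym {l = w u} {w v}) dis u∈ v∈
        ... | inj₁ refl = ⊥-elim (ne refl)
        ... | inj₂ d = d

        -- Feet count as vertices of the spans on P, so the three kinds exclude each other: left of
        -- the cut, right of it, off P. Zones of separated boxes are therefore compared kind by
        -- kind.
        Zone : List (CutRung P cut) → V → Set
        Zone b v = (∃ λ j → ∃ λ u → ∃ λ u′ → u ∈ b × u′ ∈ b × s u ≤ j × j ≤ s u′ × v ≡ p j)
                 ⊎ (∃ λ j → ∃ λ u → ∃ λ u′ → u ∈ b × u′ ∈ b × t u ≤ j × j ≤ t u′ × v ≡ p j)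
                 ⊎ (Off v × ∃ λ u → u ∈ b × v ∈ w u)

        squeeze : ∀ {f : CutRung P cut → ℕ} {b b′ j} → Boxes.Apart s t f b b′ → ∀ {u₁ u₂ v₁ v₂} → u₁ ∈ b → u₂ ∈ b → v₁ ∈ b′ → v₂ ∈ b′ →
                  f u₁ ≤ j → j ≤ f u₂ → f v₁ ≤ j → j ≤ f v₂ → ⊥
        squeeze (inj₁ h) a b c d e g i k = <-irrefl refl (<-≤-trans (h b c) (≤-trans i g))
        squeeze (inj₂ h) a b c d e g i k = <-irrefl refl (<-≤-trans (h a d) (≤-trans e k))

        zones : ∀ {b b′ v} → b ⊆ L → b′ ⊆ L → Sep b b′ → Zone b v → Zone b′ v → ⊥
        zones bl bl′ (sx , sy) (inj₁ (j , u₁ , u₂ , a₁ , a₂ , l₁ , l₂ , e)) (inj₁ (j′ , v₁ , v₂ , b₁ , b₂ , k₁ , k₂ , e′))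
          with p-inj (≤-<-trans l₂ (s< u₂)) (≤-<-trans k₂ (s< v₂)) (trans (sym e) e′)
        ... | refl = squeeze {s} sx a₁ a₂ b₁ b₂ l₁ l₂ k₁ k₂
        zones bl bl′ (sx , sy) (inj₂ (inj₁ (j , u₁ , u₂ , a₁ , a₂ , l₁ , l₂ , e))) (inj₂ (inj₁ (j′ , v₁ , v₂ , b₁ , b₂ , k₁ , k₂ , e′)))
          with p-inj (≤-<-trans l₂ (t< u₂)) (≤-<-trans k₂ (t< v₂)) (trans (sym e) e′)
        ... | refl = squeeze {t} sy a₁ a₂ b₁ b₂ l₁ l₂ k₁ k₂
        zones _ _ _ (inj₁ (j , u₁ , u₂ , a₁ , a₂ , l₁ , l₂ , e)) (inj₂ (inj₁ (j′ , v₁ , v₂ , b₁ , b₂ , k₁ , k₂ , e′)))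
          with p-inj (≤-<-trans l₂ (s< u₂)) (≤-<-trans k₂ (t< v₂)) (trans (sym e) e′)
        ... | refl = <-irrefl refl (<-≤-trans (s<cut u₂) (≤-trans (cut≤t v₁) (≤-trans k₁ l₂)))
        zones _ _ _ (inj₂ (inj₁ (j , u₁ , u₂ , a₁ , a₂ , l₁ , l₂ , e))) (inj₁ (j′ , v₁ , v₂ , b₁ , b₂ , k₁ , k₂ , e′))
          with p-inj (≤-<-trans l₂ (t< u₂)) (≤-<-trans k₂ (s< v₂)) (trans (sym e) e′)
        ... | refl = <-irrefl refl (<-≤-trans (s<cut v₂) (≤-trans (cut≤t u₁) (≤-trans l₁ k₂)))
        zones bl bl′ (sx , _) (inj₂ (inj₂ (_ , u , u∈ , m))) (inj₂ (inj₂ (_ , u′ , u′∈ , m′))) =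
          dw (bl u∈) (bl′ u′∈) (λ e → squeeze {s} sx u∈ u∈ u′∈ u′∈ (≤-reflexive refl) ≤-refl (≤-reflexive (sym e)) (≤-reflexive e)) m m′
        zones _ _ _ (inj₂ (inj₂ (o , _))) (inj₁ (j , _ , u , _ , _ , _ , l , e)) = o j (≤-<-trans l (s< u)) e
        zones _ _ _ (inj₂ (inj₂ (o , _))) (inj₂ (inj₁ (j , _ , u , _ , _ , _ , l , e))) = o j (≤-<-trans l (t< u)) e
        zones _ _ _ (inj₁ (j , _ , u , _ , _ , _ , l , e)) (inj₂ (inj₂ (o , _))) = o j (≤-<-trans l (s< u)) e
        zones _ _ _ (inj₂ (inj₁ (j , _ , u , _ , _ , _ , l , e))) (inj₂ (inj₂ (o , _))) = o j (≤-<-trans l (t< u)) e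

        boxObject : ∀ {b} → Box r L b → Σ Object λ c → (∀ {v} → v ∈ image c → Zone b v × (v ∈ vertsP ⊎ v ∉ X₀))
        boxObject {[]} (r≤ , _) with ≤-trans 3≤r r≤
        ... | ()
        boxObject {u₀ ∷ b} (r≤ , bl , dx , dy) = proj₁ ob , λ m → zone (B.S⁻ (proj₂ ob m)) , side (B.S⁻ (proj₂ ob m))
          where
          module B = Box.Build P {cut} (u₀ ∷ b) r 3≤r r≤ dx dy (λ a b → dw (bl a) (bl b)) u₀ (here refl)
          zone : ∀ {v} → _ → Zone (u₀ ∷ b) v
          zone (inj₁ (j , a , b , e)) = inj₁ (j , _ , _ , B.alo∈ , B.ahi∈ , a , b , e)
          zone (inj₂ (inj₁ (j , a , b , e))) = inj₂ (inj₁ (j , _ , _ , B.blo∈ , B.bhi∈ , a , b , e))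
          zone (inj₂ (inj₂ (u , u∈ , m))) with off u m
          ... | inj₁ (inj₁ e) = inj₁ (s u , u , u , u∈ , u∈ , ≤-refl , ≤-refl , e)
          ... | inj₁ (inj₂ e) = inj₂ (inj₁ (t u , u , u , u∈ , u∈ , ≤-refl , ≤-refl , e))
          ... | inj₂ o = inj₂ (inj₂ (o , u , u∈ , m))
          side : ∀ {v} → _ → v ∈ vertsP ⊎ v ∉ X₀
          side (inj₁ (j , a , b , refl)) = inj₁ (∈-applyUpTo⁺ p (≤-<-trans b (s< B.ahi)))
          side (inj₂ (inj₁ (j , a , b , refl))) = inj₁ (∈-applyUpTo⁺ p (≤-<-trans b (t< B.bhi)))
          side (inj₂ (inj₂ (u , u∈ , m))) = inj₂ (clean (bl u∈) m)
          ob = ladder B.good (λ m → side (B.S⁻ m))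

        objects : ∀ bs → All (Box r L) bs → AllPairs Sep bs → Σ (List Object) λ cs → length cs ≡ length bs × AllPairs Apart cs ×
          (∀ {c} → c ∈ cs → ∃ λ b → b ∈ bs × (∀ {v} → v ∈ image c → Zone b v × (v ∈ vertsP ⊎ v ∉ X₀)))
        objects [] _ _ = [] , refl , [] , λ ()
        objects (b ∷ bs) (bx ∷ bxs) (sp ∷ sps) with objects bs bxs sps | boxObject bx
        ... | cs , e , ap , f | c , g = c ∷ cs , cong suc e , All.tabulate (λ {c′} c′∈ → d {c′} (f c′∈)) ∷ ap ,
              λ { (here refl) → b , here refl , g ; (there m) → let (b′ , b∈ , h) = f m in b′ , there b∈ , h }
          where
          d : ∀ {c′} → (∃ λ b′ → b′ ∈ bs × (∀ {v} → v ∈ image c′ → Zone b′ v × (v ∈ vertsP ⊎ v ∉ X₀))) → Apart c c′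
          d (b′ , b∈ , h) m m′ = zones (proj₁ (proj₂ bx)) (proj₁ (proj₂ (All.lookup bxs b∈))) (All.lookup sp b∈) (proj₁ (g m)) (proj₁ (h m′))

        ladders : Ladders
        ladders with boxes r J L {N} {N} ds dt (λ {u} _ → s< u) (λ {u} _ → t< u) (subst (_≤ length L) (need≡ {x = λ (_ : CutRung P 0) → 0} {λ _ → 0} {λ (u : CutRung P cut) → s u} {t} r J) len)
        ... | bs , e , al , sp with objects bs al sp
        ...   | cs , e′ , ap , f = cs , trans e′ e , ap , λ c∈ m → proj₂ (proj₂ (proj₂ (f c∈)) m)

      module Cut (X : List V) (X₀⊆X : X₀ ⊆ X) (cut : ℕ) where

        open Trim P cut

        -- The edges of G - X in both directions, since `menger` is about directed edges.
        E : List (V × V)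
        E = filter (λ (u , v) → (u ~? v) ×-dec (¬? (u ∈? X) ×-dec ¬? (v ∈? X))) (cartesianProduct (allFin (n G)) (allFin (n G)))

        E⁺ : ∀ {u v} → u ~ v → u ∉ X → v ∉ X → (u , v) ∈ E
        E⁺ {u} {v} a b c = ∈-filter⁺ _ (∈-cartesianProduct⁺ (∈-allFin u) (∈-allFin v)) (a , b , c)

        E⁻ : ∀ {u v} → (u , v) ∈ E → u ~ v × u ∉ X × v ∉ X
        E⁻ m = proj₂ (∈-filter⁻ (λ (u , v) → (u ~? v) ×-dec (¬? (u ∈? X) ×-dec ¬? (v ∈? X))) {xs = cartesianProduct (allFin (n G)) (allFin (n G))} m)

        A B : List V
        A = filter (λ v → ¬? (v ∈? X)) (filter (λ v → isL? v) vertsP)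
          where
          isL? : ∀ v → Dec (OnL v)
          isL? v with locate v
          ... | inj₁ l = yes l
          ... | inj₂ (inj₁ r) = no λ l → not-both l r
          ... | inj₂ (inj₂ o) = no λ (i , _ , iN , e) → o i iN e
        B = filter (λ v → ¬? (v ∈? X)) (filter (λ v → isR? v) vertsP)
          where
          isR? : ∀ v → Dec (OnR v)
          isR? v with locate v
          ... | inj₁ l = no λ r → not-both l r
          ... | inj₂ (inj₁ r) = yes r
          ... | inj₂ (inj₂ o) = no λ (i , _ , iN , e) → o i iN e

        A⁺ : ∀ {i} → i < cut → i < N → p i ∉ X → p i ∈ A
        A⁺ {i} a b c = ∈-filter⁺ _ (∈-filter⁺ _ (∈-applyUpTo⁺ p b) (i , a , b , refl)) c

        B⁺ : ∀ {j} → cut ≤ j → j < N → p j ∉ X → p j ∈ B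
        B⁺ {j} a b c = ∈-filter⁺ _ (∈-filter⁺ _ (∈-applyUpTo⁺ p b) (j , a , b , refl)) c

        A⁻ : ∀ {v} → v ∈ A → OnL v × v ∉ X
        A⁻ m = let (a , b) = ∈-filter⁻ (λ v → ¬? (v ∈? X)) {xs = filter _ vertsP} m in proj₂ (∈-filter⁻ _ {xs = vertsP} a) , b

        B⁻ : ∀ {v} → v ∈ B → OnR v × v ∉ X
        B⁻ m = let (a , b) = ∈-filter⁻ (λ v → ¬? (v ∈? X)) {xs = filter _ vertsP} m in proj₂ (∈-filter⁻ _ {xs = vertsP} a) , b

        toG : ∀ {u l v} → EPath E u l v → GPath u l v
        toG [ u ] = [ u ]
        toG (r ∷ q) = proj₁ (E⁻ r) ∷ toG q

        clean : ∀ {u l v} → EPath E u l v → u ∉ X → ∀ {z} → z ∈ l → z ∉ X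
        clean [ u ] u∉ (here refl) = u∉
        clean (r ∷ q) u∉ (here refl) = u∉
        clean (r ∷ q) u∉ (there m) = clean q (proj₂ (proj₂ (E⁻ r))) m

        fromReach : ∀ {u v} {W : V → Set} → GReach W u v → (∀ {z} → W z → z ∉ X) → Σ (List V) λ l → EPath E u l v × (∀ {z} → z ∈ l → W z)
        fromReach (stop w) f = _ , [ _ ] , λ { (here refl) → w }
        fromReach (step w r q) f with fromReach q f
        ... | l , q′ , g = _ , E⁺ r (f w) (f (reach-start q)) ∷ q′ , λ { (here refl) → w ; (there m) → g m }

        rungs : ∀ (Ls : List (Link E A B)) → AllPairs (λ a b → Disjoint (verts a) (verts b)) Ls →
          Σ (List (CutRung P cut)) λ L → length L ≡ length Ls × AllPairs (λ u v → Disjoint (CutRung.w u) (CutRung.w v)) L ×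
          (∀ {u} → u ∈ L → ∃ λ k → k ∈ Ls × CutRung.w u ⊆ verts k)
        rungs [] _ = [] , refl , [] , λ ()
        rungs (k ∷ Ls) (d ∷ ds) with rungs Ls ds | cutRung (toG (path k)) (proj₁ (A⁻ (src∈ k))) (proj₁ (B⁻ (tgt∈ k)))
        ... | L , e , ap , f | R , s = R ∷ L , cong suc e , All.tabulate (λ {u} u∈ → h {u} (f u∈)) ∷ ap ,
              λ { (here refl) → k , here refl , s ; (there m) → let (k′ , a , b) = f m in k′ , there a , b }
          where
          h : ∀ {u : CutRung P cut} → (∃ λ k′ → k′ ∈ Ls × CutRung.w u ⊆ verts k′) → Disjoint (CutRung.w R) (CutRung.w u)
          h (k′ , k∈ , s′) a b = All.lookup d k∈ (s a) (s′ b)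

        cutResult : Ladders ⊎ Σ (List V) λ Z → length Z < m × Separates E A B Z
        cutResult with menger E A B m
        ... | inj₂ z = inj₂ z
        ... | inj₁ (Ls , e , ap) with rungs Ls ap
        ...   | L , e′ , ap′ , f = inj₁ (FromRungs.ladders L (≤-reflexive (sym (trans e′ e))) ap′ cl)
          where
          cl : ∀ {u v} → u ∈ L → v ∈ CutRung.w u → v ∉ X₀
          cl u∈ m m′ with f u∈
          ... | k , _ , s = clean (path k) (proj₂ (A⁻ (src∈ k))) (s m) (X₀⊆X m′)

      Hitting : List V → List V → Set
      Hitting X Z = ∀ {c} → Avoids X c → Meets Z c

      MeetsBelow : ℕ → Object → Set
      MeetsBelow i c = ∃ λ j → j < i × p j ∈ image c

      findBelow : ∀ X i → (∃ λ c → Avoids X c × MeetsBelow i c) ⊎ (∀ {c} → Avoids X c → ¬ MeetsBelow i c)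
      findBelow X i with searchObject (λ l → all? (λ v → ¬? (v ∈? X)) l ×-dec any? (_∈? applyUpTo p i) l)
      ... | yes (c , a , b) = let (v , v∈ , m) = find b ; (j , lt , e) = ∈-applyUpTo⁻ p m in
                              inj₁ (c , (λ m → All.lookup a m) , j , lt , subst (_∈ image c) e v∈)
      ... | no ne = inj₂ λ {c} a (j , lt , m) → ne (c , All.tabulate a , lose m (∈-applyUpTo⁺ p lt))

      -- The bound counts the separators of two consecutive cuts, with at most m vertices each, and
      -- the vertex of P between these cuts.
      Peel : List V → Set
      Peel X = Σ Object λ c → Avoids X c × Σ (List V) λ Z → length Z ≤ m + suc m × (∀ {c′} → Avoids X c′ → Avoids Z c′ → Apart c c′)

      -- Advance the cut until some object avoiding the separator meets the part of P below the cut;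
      -- every object avoiding this separator and the previous one then lies on the other side.
      scan : ∀ X → X₀ ⊆ X → ∀ k i → i + k ≡ N → ∀ Z → length Z ≤ m → (∀ {c} → Avoids (X ++ Z) c → ¬ MeetsBelow i c) →
             Ladders ⊎ (Σ (List V) λ Z → length Z ≤ m + suc m × Hitting X Z) ⊎ Peel X
      scan X sub zero i e Z le none = inj₂ (inj₁ (Z , ≤-trans le (m≤m+n m _) , λ {c} → hit {c}))
        where
        hit : Hitting X Z
        hit {c} a with meets? Z c
        ... | inj₁ h = h
        ... | inj₂ h with meetsP {c} (λ m m′ → a m (sub m′))
        ...   | j , jN , m = ⊥-elim (none {c} (avoids-++ {X} {Z} {c} a h) (j , subst (j <_) (trans (sym e) (+-identityʳ i)) jN , m))
      scan X sub (suc k) i e Z le none with Cut.cutResult X sub (suc i)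
      ... | inj₁ l = inj₁ l
      ... | inj₂ (Z′ , lt , sep) with findBelow (X ++ Z′) (suc i)
      ...   | inj₂ none′ = scan X sub k (suc i) (trans (sym (+-suc i k)) e) Z′ (<⇒≤ lt) (λ {c} → none′ {c})
      ...   | inj₁ (c , av , (j , j≤ , pj)) = inj₂ (inj₂ (c , avoids-++ˡ {X} {Z′} {c} av , Z ++ p i ∷ Z′ ,
              ≤-trans (≤-reflexive (length-++ Z)) (+-mono-≤ le (s≤s (<⇒≤ lt))) , λ {c′} → far-side {c′}))
        where
        module C = Cut X sub (suc i)
        iN : suc i ≤ N
        iN = ≤-trans (≤-trans (s≤s (m≤m+n i k)) (≤-reflexive (sym (+-suc i k)))) (≤-reflexive e)
        -- By `none` and the removal of p i, the object c′ meets P only to the right of the cut. A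
        -- vertex shared with c would yield a walk from the left part to the right part that misses
        -- Z′.
        far-side : ∀ {c′} → Avoids X c′ → Avoids (Z ++ p i ∷ Z′) c′ → Apart c c′
        far-side {c′} avX avZ v∈ v∈′ with meetsP {c′} (λ m m′ → avX m (sub m′))
        ... | j′ , j′N , pj′ with <-cmp j′ i
        ...   | tri< lt _ _ = none {c′} (avoids-++ {X} {Z} {c′} avX (avoids-++ˡ {Z} {p i ∷ Z′} {c′} avZ)) (j′ , lt , pj′)
        ...   | tri≈ _ refl _ = avZ pj′ (∈-++⁺ʳ Z (here refl))
        ...   | tri> _ _ gt with C.fromReach (reach-trans (reach-mono inj₁ (connected c pj v∈)) (reach-mono {W′ = λ z → z ∈ image c ⊎ z ∈ image c′} inj₂ (connected c′ v∈′ pj′))) noX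
          where
          noX : ∀ {z} → z ∈ image c ⊎ z ∈ image c′ → z ∉ X
          noX (inj₁ m) = avoids-++ˡ {X} {Z′} {c} av m
          noX (inj₂ m) = avX m
        ...     | l , q , f with sep (C.A⁺ j≤ (<-≤-trans j≤ iN) (avoids-++ˡ {X} {Z′} {c} av pj)) (C.B⁺ gt j′N (avX pj′)) q
        ...       | z , z∈ , zZ with f z∈
        ...         | inj₁ m = avoids-++ʳ X {Z′} {c} av m zZ
        ...         | inj₂ m = avZ m (∈-++⁺ʳ Z (there zZ))

      Packed : ℕ → List V → Set
      Packed j X = Σ (List Object) λ cs → length cs ≡ j × AllPairs Apart cs × (∀ {c} → c ∈ cs → Avoids X c)

      -- The peeled object c itself costs nothing: objects avoiding X and Z are disjoint from it, so
      -- the hitting set consists of the sets Z alone.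
      pathLemma : ∀ j X → X₀ ⊆ X → Ladders ⊎ Packed j X ⊎ Σ (List V) λ Z → length Z ≤ j * (m + suc m) × Hitting X Z
      pathLemma zero X sub = inj₂ (inj₁ ([] , refl , [] , λ ()))
      pathLemma (suc j) X sub with scan X sub N 0 refl [] z≤n (λ _ (_ , lt , _) → n≮0 lt)
      ... | inj₁ l = inj₁ l
      ... | inj₂ (inj₁ (Z , le , h)) = inj₂ (inj₂ (Z , ≤-trans le (m≤m+n _ _) , λ {c} → h {c}))
      ... | inj₂ (inj₂ (c , av , Z , le , far)) with pathLemma j (X ++ Z ++ image c) (λ m → ∈-++⁺ˡ (sub m))
      ...   | inj₁ l = inj₁ l
      ...   | inj₂ (inj₁ (cs , e , ap , f)) = inj₂ (inj₁ (c ∷ cs , cong suc e ,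
                All.tabulate (λ {c′} c∈ m m′ → f c∈ m′ (∈-++⁺ʳ X (∈-++⁺ʳ Z m))) ∷ ap ,
                λ { (here refl) → av ; {c′} (there c∈) → avoids-++ˡ {X} {Z ++ image c} {c′} (f c∈) }))
      ...   | inj₂ (inj₂ (Z′ , le′ , h)) = inj₂ (inj₂ (Z ++ Z′ , ≤-trans (≤-reflexive (length-++ Z)) (+-mono-≤ le le′) , λ {c′} → hit {c′}))
        where
        hit : Hitting X (Z ++ Z′)
        hit {c′} a with meets? Z c′
        ... | inj₁ (v , v∈ , m) = v , v∈ , ∈-++⁺ˡ m
        ... | inj₂ b with h {c′} (avoids-++ {X} {Z ++ image c} {c′} a (avoids-++ {Z} {image c} {c′} b (λ m m′ → far {c′} a b m′ m)))
        ...   | v , v∈ , m = v , v∈ , ∈-++⁺ʳ Z m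

    -- How to proceed with the objects avoiding X: either there is none, or there is a small one,
    -- or one that is a path P and few other vertices, such that
    -- the objects meeting P avoid A, and every ladder on P outside A contains an object.
    data Choice (s₀ d₀ r : ℕ) (X : List V) : Set where
      none : (∀ {c} → ¬ Avoids X c) → Choice s₀ d₀ r X
      small : ∀ c → Avoids X c → length (image c) ≤ s₀ → Choice s₀ d₀ r X
      big : ∀ c → Avoids X c → (P : IndPath) (D A : List V) → length D ≤ d₀ →
            image c ⊆ D ++ IndPath.verts P → IndPath.verts P ⊆ image c → Disjoint (IndPath.verts P) A →
            (∀ {c′} → Avoids X c′ → Meets (IndPath.verts P) c′ → Avoids A c′) →
            (∀ {S} → Good P r S → (∀ {v} → v ∈ S → v ∉ X × v ∉ A × (v ∈ image c → v ∈ IndPath.verts P)) → Σ Object λ c → image c ⊆ S) →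
            Choice s₀ d₀ r X

    module Main (s₀ d₀ r : ℕ) (3≤r : 3 ≤ r) (choose : ∀ X → Choice s₀ d₀ r X) (J : ℕ) where

      Packs : ℕ → List V → Set
      Packs j X = Σ (List Object) λ cs → length cs ≡ j × AllPairs Apart cs × (∀ {c} → c ∈ cs → Avoids X c)

      Hits′ : List V → List V → Set
      Hits′ X Z = ∀ {c} → Avoids X c → Meets Z c

      need : ℕ
      need = Boxes.need {V} (λ _ → 0) (λ _ → 0) r J

      -- One round pays for a small object, or for D and at most 2^J peelings; the set Y is paid for
      -- by the remaining rounds.
      cost : ℕ
      cost = s₀ + (d₀ + 2 ^ J * (need + suc need))

      extend : ∀ {j X c} → Avoids X c → Packs j (X ++ image c) → Packs (suc j) X
      extend {X = X} {c} av (cs , e , ap , f) = c ∷ cs , cong suc e , All.tabulate (λ c∈ m m′ → f c∈ m′ (∈-++⁺ʳ X m)) ∷ ap ,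
        λ { (here refl) → av ; {c′} (there c∈) → avoids-++ˡ {X} {image c} {c′} (f c∈) }

      -- With j ≤ 2^J the objects of the 2^J ladders are enough for a packing, and `pathLemma` peels
      -- at most 2^J times.
      solve : ∀ j X → j ≤ 2 ^ J → Packs j X ⊎ Σ (List V) λ Z → length Z ≤ j * cost × Hits′ X Z
      solve zero X _ = inj₁ ([] , refl , [] , λ ())
      solve (suc j) X j≤ with choose X
      ... | none nil = inj₂ ([] , z≤n , λ {c} a → ⊥-elim (nil {c} a))
      ... | small c av le with solve j (X ++ image c) (≤-trans (n≤1+n j) j≤)
      ...   | inj₁ pk = inj₁ (extend {c = c} av pk)
      ...   | inj₂ (Z , le′ , h) = inj₂ (image c ++ Z , ≤-trans (≤-reflexive (length-++ (image c))) (+-mono-≤ (≤-trans le (m≤m+n s₀ _)) le′) , λ {c′} → hit {c′})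
        where
        hit : Hits′ X (image c ++ Z)
        hit {c′} a with meets? (image c) c′
        ... | inj₁ (v , v∈ , m) = v , v∈ , ∈-++⁺ˡ m
        ... | inj₂ b with h {c′} (avoids-++ {X} {image c} {c′} a b)
        ...   | v , v∈ , m = v , v∈ , ∈-++⁺ʳ (image c) m
      solve (suc j) X j≤ | big c av P D A leD cov P⊆ PA meetsA lad with solve j (X ++ image c) (≤-trans (n≤1+n j) j≤)
      ...   | inj₁ pk = inj₁ (extend {c = c} av pk)
      ...   | inj₂ (Y , leY , hY) = finish (pathLemma (suc j) X′ (λ m → m))
        where
        open IndPath P using (p; N) renaming (verts to vertsP)
        X₁ = X ++ D ++ Y
        -- The set A may be large. The objects that meet P avoid it anyway, so it is removed for the
        -- ladders but does not enter the hitting set.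
        X′ = X₁ ++ A
        toP : ∀ {c′} → Avoids X₁ c′ → Meets vertsP c′
        toP {c′} a with meets? (image c) c′
        ... | inj₂ b = let (v , v∈ , m) = hY {c′} (avoids-++ {X} {image c} {c′} (avoids-++ˡ {X} {D ++ Y} {c′} a) b) in
                       ⊥-elim (avoids-++ʳ D {Y} {c′} (avoids-++ʳ X {D ++ Y} {c′} a) v∈ m)
        ... | inj₁ (v , v∈ , m) with ∈-++⁻ D (cov m)
        ...   | inj₁ d = ⊥-elim (a v∈ (∈-++⁺ʳ X (∈-++⁺ˡ d)))
        ...   | inj₂ q = v , v∈ , q
        side : ∀ {S : List V} → (∀ {v} → v ∈ S → v ∈ vertsP ⊎ v ∉ X′) → ∀ {v} → v ∈ S → v ∉ X × v ∉ A × (v ∈ image c → v ∈ vertsP)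
        side f m with f m
        ... | inj₁ q = (λ x → av (P⊆ q) x) , (λ x → PA q x) , λ _ → q
        ... | inj₂ q = (λ x → q (∈-++⁺ˡ (∈-++⁺ˡ x))) , (λ x → q (∈-++⁺ʳ X₁ x)) , λ i → Sum.[ (λ d → ⊥-elim (q (∈-++⁺ˡ (∈-++⁺ʳ X (∈-++⁺ˡ d))))) , (λ y → y) ] (∈-++⁻ D (cov i))
        mp : ∀ {c′} → Avoids X′ c′ → ∃ λ i → i < N × p i ∈ image c′
        mp {c′} a with toP {c′} (avoids-++ˡ {X₁} {A} {c′} a)
        ... | v , v∈ , m = let (i , lt , e) = ∈-applyUpTo⁻ p m in i , lt , subst (_∈ image c′) e v∈
        open PathLemma P r 3≤r J X′ (λ g f → lad g (side f)) (λ {c′} → mp {c′})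
        finish : _ → Packs (suc j) X ⊎ Σ (List V) λ Z → length Z ≤ suc j * cost × Hits′ X Z
        finish (inj₁ (cs , e , ap , f)) = inj₁ (take (suc j) cs , trans (length-take (suc j) cs) (m≤n⇒m⊓n≡m (≤-trans j≤ (≤-reflexive (sym e)))) ,
          AP.take⁺ (suc j) ap , λ {c′} c∈ m x → proj₁ (side {image c′} (f (take⊆ (suc j) c∈)) m) x)
          where
          take⊆ : ∀ n {l : List Object} {v} → v ∈ take n l → v ∈ l
          take⊆ (suc n) {_ ∷ _} (here e) = here e
          take⊆ (suc n) {_ ∷ _} (there m) = there (take⊆ n m)
        finish (inj₂ (inj₁ (cs , e , ap , f))) = inj₁ (cs , e , ap , λ {c′} c∈ → avoids-++ˡ {X} {D ++ Y} {c′} (avoids-++ˡ {X₁} {A} {c′} (f c∈)))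
        finish (inj₂ (inj₂ (Z , le , h))) = inj₂ ((D ++ Y) ++ Z , bound , λ {c′} → hit {c′})
          where
          bound : length ((D ++ Y) ++ Z) ≤ suc j * cost
          bound = ≤-trans (≤-reflexive (trans (length-++ (D ++ Y)) (cong (_+ length Z) (length-++ D))))
            (≤-trans (+-mono-≤ (+-mono-≤ leD leY) (≤-trans le (*-mono-≤ j≤ (≤-reflexive (cong (λ k → k + suc k) (need≡ {x = λ (_ : CutRung P 0) → 0} {λ _ → 0} {λ (_ : V) → 0} {λ _ → 0} r J))))))
              (≤-trans (≤-reflexive (lem d₀ (j * cost) (2 ^ J * (need + suc need)))) (+-monoˡ-≤ (j * cost) (m≤n+m _ s₀))))
            where
            open import Data.Nat.Tactic.RingSolver using (solve-∀)
            lem : ∀ a b c → a + b + c ≡ a + c + b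
            lem = solve-∀
          hit : Hits′ X ((D ++ Y) ++ Z)
          hit {c′} a with meets? (D ++ Y) c′
          ... | inj₁ (v , v∈ , m) = v , v∈ , ∈-++⁺ˡ m
          ... | inj₂ b with h {c′} (avoids-++ {X₁} {A} {c′} a₁ (meetsA {c′} a (toP {c′} a₁)))
            where
            a₁ : Avoids X₁ c′
            a₁ = avoids-++ {X} {D ++ Y} {c′} a b
          ...   | v , v∈ , m = v , v∈ , ∈-++⁺ʳ (D ++ Y) m

  -- Edges and degrees in induced cycles

  rev-ipath : ∀ {x l y} → IPath x l y → Σ (List V) λ l′ → IPath y l′ x × l′ ⊆ l × l ⊆ l′
  rev-ipath [ x ] = _ , [ x ] , (λ m → m) , λ m → m
  rev-ipath (cons {x} {y} {l = l} r p h) with rev-ipath p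
  ... | l′ , q , s , s′ = l′ ++ x ∷ [] , isnoc q (~-sym r) (λ m → out (s m)) only , f , g
    where
    out : x ∉ y ∷ l
    out m with ipath-unique (cons r p h)
    ... | ne ∷ _ = All.lookup ne m refl
    only : ∀ {w} → w ∈ l′ → x ~ w → w ≡ y
    only m e with s m
    ... | here e′ = e′
    ... | there m′ = ⊥-elim (proj₁ (h m′) e)
    f : ∀ {v} → v ∈ l′ ++ x ∷ [] → v ∈ x ∷ y ∷ l
    f m with ∈-++⁻ l′ m
    ... | inj₁ m′ = there (s m′)
    ... | inj₂ (here e) = here e
    g : ∀ {v} → v ∈ x ∷ y ∷ l → v ∈ l′ ++ x ∷ []
    g (here e) = ∈-++⁺ʳ l′ (here e)
    g (there m) = ∈-++⁺ˡ (s′ m)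

  rev-cycle : ∀ {a P} (c : ICycle a P) → Σ (List V) λ P′ → Σ (ICycle a P′) λ c′ → ICycle.x c′ ≡ ICycle.y c × P′ ⊆ P × P ⊆ P′
  rev-cycle c with rev-ipath (ICycle.ip c)
  ... | P′ , q , s , s′ = P′ , record { ip = q ; a~x = a~y ; a~y = a~x ; x≢y = λ e → x≢y (sym e) ; a∉ = λ m → a∉ (s m)
                                      ; inner = λ m e → Sum.swap (inner (s m) e) } , refl , s , s′
    where open ICycle c

  ipath-edges : ∀ {x l y u w} → IPath x l y → u ∈ l → w ∈ l → u ~ w → ∀ a b → EdgeIn (chain a l b) u w
  ipath-edges [ _ ] (here refl) (here refl) e _ _ = ⊥-elim (~-irrefl e)
  ipath-edges (cons r p h) (here refl) (here refl) e _ _ = ⊥-elim (~-irrefl e)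
  ipath-edges (cons r p h) (here refl) (there (here refl)) e _ _ = inj₁ (there (here refl))
  ipath-edges (cons r p h) (here refl) (there (there m)) e _ _ = ⊥-elim (proj₁ (h m) e)
  ipath-edges (cons r p h) (there (here refl)) (here refl) e _ _ = inj₂ (there (here refl))
  ipath-edges (cons r p h) (there (there m)) (here refl) e _ _ = ⊥-elim (proj₁ (h m) (~-sym e))
  ipath-edges (cons r p h) (there m) (there m′) e a b = Sum.map there there (ipath-edges p m m′ e _ b)

  chain-first : ∀ {x l y a b} → IPath x l y → (a , x) ∈ chain a l b
  chain-first [ _ ] = here refl
  chain-first (cons _ _ _) = here refl

  chain-last : ∀ {x l y a b} → IPath x l y → (y , b) ∈ chain a l b
  chain-last [ _ ] = there (here refl)
  chain-last (cons _ p _) = there (chain-last p)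

  chain-adj : ∀ {x l y a b u w} → IPath x l y → a ~ x → y ~ b → (u , w) ∈ chain a l b → u ~ w
  chain-adj [ _ ] r s (here refl) = r
  chain-adj [ _ ] r s (there (here refl)) = s
  chain-adj (cons _ _ _) r s (here refl) = r
  chain-adj (cons r′ p _) r s (there m) = chain-adj p r′ s m

  cycle-edges : ∀ {a P u w} → ICycle a P → u ∈ a ∷ P → w ∈ a ∷ P → u ~ w → EdgeIn (chain a P a) u w
  cycle-edges c (here refl) (here refl) e = ⊥-elim (~-irrefl e)
  cycle-edges c (here refl) (there m) e with ICycle.inner c m e
  ... | inj₁ refl = inj₁ (chain-first (ICycle.ip c))
  ... | inj₂ refl = inj₂ (chain-last (ICycle.ip c))
  cycle-edges {a} {P} c (there m) (here refl) e = edgeIn-sym {es = chain a P a} (cycle-edges c (here refl) (there m) (~-sym e))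
  cycle-edges {a} c (there m) (there m′) e = ipath-edges (ICycle.ip c) m m′ e a a

  cycle-adj : ∀ {a P u w} → ICycle a P → (u , w) ∈ chain a P a → u ~ w
  cycle-adj c = chain-adj (ICycle.ip c) (ICycle.a~x c) (~-sym (ICycle.a~y c))

  -- With d as the base, its only neighbours on the cycle are the two ends of the remaining path.
  cycle-degree : ∀ {a P d e₁ e₂ e₃} → ICycle a P → d ∈ a ∷ P → e₁ ∈ a ∷ P → e₂ ∈ a ∷ P → e₃ ∈ a ∷ P →
    d ~ e₁ → d ~ e₂ → d ~ e₃ → e₁ ≢ e₂ → e₁ ≢ e₃ → e₂ ≢ e₃ → ⊥
  cycle-degree c d∈ m₁ m₂ m₃ r₁ r₂ r₃ n₁₂ n₁₃ n₂₃ with rotate c d∈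
  ... | P′ , c′ , _ , s , _ = go (nb (s m₁) r₁) (nb (s m₂) r₂) (nb (s m₃) r₃)
    where
    open ICycle c′
    nb : ∀ {e} → e ∈ _ ∷ P′ → _ ~ e → e ≡ x ⊎ e ≡ y
    nb (here refl) r = ⊥-elim (~-irrefl r)
    nb (there m) r = inner m r
    go : _ ≡ x ⊎ _ ≡ y → _ ≡ x ⊎ _ ≡ y → _ ≡ x ⊎ _ ≡ y → ⊥
    go (inj₁ a) (inj₁ b) _ = n₁₂ (trans a (sym b))
    go (inj₂ a) (inj₂ b) _ = n₁₂ (trans a (sym b))
    go (inj₁ a) (inj₂ _) (inj₁ b) = n₁₃ (trans a (sym b))
    go (inj₂ a) (inj₁ _) (inj₂ b) = n₁₃ (trans a (sym b))
    go (inj₁ _) (inj₂ a) (inj₂ b) = n₂₃ (trans a (sym b))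
    go (inj₂ _) (inj₁ a) (inj₁ b) = n₂₃ (trans a (sym b))

  -- Induced thetas: the diamond

  module Theta where

    open Objects diamond G
    open ThetaModel {V}

    Object : Set
    Object = InducedSubdiv diamond G

    enter : ∀ {W : V → Set} {L : List V} {u v} → GReach W u v → u ∉ L → v ∈ L → ∃ λ z → ∃ λ w → W z × z ∉ L × z ~ w × w ∈ L × W w
    enter (stop _) u∉ v∈ = ⊥-elim (u∉ v∈)
    enter {L = L} (step {y = w} wu r q) u∉ v∈ with w ∈? L
    ... | yes w∈ = _ , w , wu , u∉ , r , w∈ , reach-start q
    ... | no w∉ = enter q w∉ v∈

    -- The walk has to leave the closed neighbourhood of u, and its step out of it gives a and y.
    -- When it returns to u, the search starts again from there.
    cherry : ∀ {W : V → Set} {u w v} → GReach W w v → u ~ w → v ≢ u → ¬ u ~ v → ∃ λ a → ∃ λ y → W a × W y × u ~ a × a ~ y × u ≢ y × ¬ u ~ y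
    cherry (stop _) uw v≢ uv = ⊥-elim (uv uw)
    cherry {u = u} (step {x = w} {y = w′} ww r q) uw v≢ uv with u ~? w′ | u ≟ w′
    ... | yes e | _ = cherry q e v≢ uv
    ... | no ne | no ne′ = w , w′ , ww , reach-start q , uw , r , ne′ , ne
    ... | no ne | yes refl with q
    ...   | stop _ = ⊥-elim (v≢ refl)
    ...   | step _ r′ q′ = cherry q′ r′ v≢ uv

    ends≢ : ∀ {a P} (c : ICycle a P) → 3 ≤ length P → ¬ ICycle.x c ~ ICycle.y c
    ends≢ record { ip = [ _ ] } (s≤s ())
    ends≢ record { ip = cons r [ _ ] _ } (s≤s (s≤s ()))
    ends≢ record { ip = cons r (cons _ q _) h } _ = proj₁ (h (last∈ (ipath⇒path q)))

    module In (S : List V) where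

      Result : Set
      Result = Σ Object λ c → image c ⊆ S

      -- An induced cycle and a disjoint induced path joined to it by exactly the edges d a and q b
      -- form an induced theta with branch vertices a and b. The vertex e after b ensures that a
      -- second path of the theta has an inner vertex.
      module ClearEar {a b e d q : V} {pre post Q : List V} (c : ICycle a (pre ++ b ∷ e ∷ post)) (ipQ : IPath d (d ∷ Q) q)
        (off : ∀ {v} → v ∈ d ∷ Q → v ∉ a ∷ pre ++ b ∷ e ∷ post) (d~a : d ~ a) (q~b : q ~ b)
        (cross : ∀ {u v} → u ∈ d ∷ Q → v ∈ a ∷ pre ++ b ∷ e ∷ post → u ~ v → (u ≡ d × v ≡ a) ⊎ (u ≡ q × v ≡ b))
        (C⊆ : (a ∷ pre ++ b ∷ e ∷ post) ⊆ S) (Q⊆ : (d ∷ Q) ⊆ S) where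

        P = pre ++ b ∷ e ∷ post
        T = thetaEdges a b pre (e ∷ post) (d ∷ Q)
        vs = Q ++ post ++ pre ++ a ∷ b ∷ e ∷ d ∷ []

        sides : ∀ {v} → v ∈ vs → v ∈ a ∷ P ⊎ v ∈ d ∷ Q
        sides m with ∈-++⁻ Q m
        ... | inj₁ p = inj₂ (there p)
        ... | inj₂ p with ∈-++⁻ post p
        ...   | inj₁ k = inj₁ (there (∈-++⁺ʳ pre (there (there k))))
        ...   | inj₂ k with ∈-++⁻ pre k
        ...     | inj₁ j = inj₁ (there (∈-++⁺ˡ j))
        ...     | inj₂ (here j) = inj₁ (here j)
        ...     | inj₂ (there (here j)) = inj₁ (there (∈-++⁺ʳ pre (here j)))
        ...     | inj₂ (there (there (here j))) = inj₁ (there (∈-++⁺ʳ pre (there (here j))))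
        ...     | inj₂ (there (there (there (here j)))) = inj₂ (here j)

        cyc : ∀ {u w} → EdgeIn (chain a P a) u w → EdgeIn T u w
        cyc {u} {w} m = Sum.map f f m
          where
          f : ∀ {u w} → (u , w) ∈ chain a P a → (u , w) ∈ T
          f {u} {w} m with ∈-++⁻ (chain a pre b) (subst ((u , w) ∈_) (chain-++ pre) m)
          ... | inj₁ k = ∈-++⁺ˡ k
          ... | inj₂ k = ∈-++⁺ʳ (chain a pre b) (∈-++⁺ˡ k)

        ear : ∀ {u w} → EdgeIn (chain a (d ∷ Q) b) u w → EdgeIn T u w
        ear = Sum.map (λ m → ∈-++⁺ʳ (chain a pre b) (∈-++⁺ʳ (chain b (e ∷ post) a) m)) (λ m → ∈-++⁺ʳ (chain a pre b) (∈-++⁺ʳ (chain b (e ∷ post) a) m))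

        crossEdge : ∀ {u w} → (u ≡ d × w ≡ a) ⊎ (u ≡ q × w ≡ b) → EdgeIn T u w
        crossEdge (inj₁ (refl , refl)) = ear (inj₂ (chain-first ipQ))
        crossEdge (inj₂ (refl , refl)) = ear (inj₁ (chain-last ipQ))

        adj⇒T : ∀ {u w} → u ∈ vs → w ∈ vs → u ~ w → EdgeIn T u w
        adj⇒T u∈ w∈ r with sides u∈ | sides w∈
        ... | inj₁ p | inj₁ k = cyc (cycle-edges c p k r)
        ... | inj₂ p | inj₂ k = ear (ipath-edges ipQ p k r a b)
        ... | inj₂ p | inj₁ k = crossEdge (cross p k r)
        ... | inj₁ p | inj₂ k = edgeIn-sym {es = T} (crossEdge (cross k p (~-sym r)))

        T⇒adj₁ : ∀ {u w} → (u , w) ∈ T → u ~ w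
        T⇒adj₁ {u} {w} m with ∈-++⁻ (chain a pre b) m
        ... | inj₁ k = cycle-adj c (subst ((u , w) ∈_) (sym (chain-++ pre)) (∈-++⁺ˡ k))
        ... | inj₂ k with ∈-++⁻ (chain b (e ∷ post) a) k
        ...   | inj₁ j = cycle-adj c (subst ((u , w) ∈_) (sym (chain-++ pre)) (∈-++⁺ʳ (chain a pre b) j))
        ...   | inj₂ j = chain-adj ipQ (~-sym d~a) q~b j

        result : Result
        result = let (o , s) = modelObject model adj⇒T Sum.[ T⇒adj₁ , (λ m → ~-sym (T⇒adj₁ m)) ] in
                 o , λ m → Sum.[ C⊆ , Q⊆ ] (sides (s m))
          where
          uP = unique-++ pre (ipath-unique (ICycle.ip c))
          a∉ = ICycle.a∉ c
          model : _
          model with proj₁ (proj₂ uP) | ipath-unique ipQ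
          ... | (b∉ ∷ e∉ ∷ u₂) | (d∉ ∷ u₃) = thetaModel pre post Q
            (λ { refl → a∉ (∈-++⁺ʳ pre (here refl)) })
            (((λ { refl → off (here refl) (there (∈-++⁺ʳ pre (there (here refl)))) }) ∷ []) ∷ [] ∷ [])
            (λ { (here refl) → (λ { refl → a∉ (∈-++⁺ʳ pre (there (here refl))) }) , (λ { refl → All.lookup b∉ (here refl) refl })
               ; (there (here refl)) → (λ { refl → off (here refl) (here refl) }) , (λ { refl → off (here refl) (there (∈-++⁺ʳ pre (here refl))) }) })
            (proj₁ uP) u₂ u₃ f₁ f₂ f₃
            where
            f₁ : ∀ {v} → v ∈ pre → v ∉ a ∷ b ∷ e ∷ d ∷ []
            f₁ m (here refl) = a∉ (∈-++⁺ˡ m)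
            f₁ m (there (here refl)) = proj₂ (proj₂ uP) m (here refl)
            f₁ m (there (there (here refl))) = proj₂ (proj₂ uP) m (there (here refl))
            f₁ m (there (there (there (here refl)))) = off (here refl) (there (∈-++⁺ˡ m))
            f₂ : ∀ {v} → v ∈ post → v ∉ pre ++ a ∷ b ∷ e ∷ d ∷ []
            f₂ m m′ with ∈-++⁻ pre m′
            ... | inj₁ k = proj₂ (proj₂ uP) k (there (there m))
            ... | inj₂ (here refl) = a∉ (∈-++⁺ʳ pre (there (there m)))
            ... | inj₂ (there (here refl)) = All.lookup b∉ (there m) refl
            ... | inj₂ (there (there (here refl))) = All.lookup e∉ m refl
            ... | inj₂ (there (there (there (here refl)))) = off (here refl) (there (∈-++⁺ʳ pre (there (there m))))
            f₃ : ∀ {v} → v ∈ Q → v ∉ post ++ pre ++ a ∷ b ∷ e ∷ d ∷ []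
            f₃ m m′ with ∈-++⁻ post m′
            ... | inj₁ k = off (there m) (there (∈-++⁺ʳ pre (there (there k))))
            ... | inj₂ k with ∈-++⁻ pre k
            ...   | inj₁ j = off (there m) (there (∈-++⁺ˡ j))
            ...   | inj₂ (here refl) = off (there m) (here refl)
            ...   | inj₂ (there (here refl)) = off (there m) (there (∈-++⁺ʳ pre (here refl)))
            ...   | inj₂ (there (there (here refl))) = off (there m) (there (∈-++⁺ʳ pre (there (here refl))))
            ...   | inj₂ (there (there (there (here refl)))) = All.lookup d∉ m refl

      Ear : V → List V → V → V → List V → V → Set
      Ear a P b d Q q = IPath d Q q × (∀ {v} → v ∈ Q → v ∉ a ∷ P) × d ~ a × q ~ b ×
        (∀ {u v} → u ∈ Q → v ∈ a ∷ P → u ~ v → (u ≡ d × v ≡ a) ⊎ (u ≡ q × v ≡ b))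

      clearEar : ∀ {a P b d Q q} → ICycle a P → b ∈ P → Ear a P b d Q q → (a ∷ P) ⊆ S → Q ⊆ S → Result
      clearEar {a} {P} {b} c b∈ (ipQ , off , r₁ , r₂ , cross) C⊆ Q⊆ with ∈-∃++ b∈ | ihead ipQ
      ... | pre , e ∷ post , refl | Q′ , refl = ClearEar.result c ipQ off r₁ r₂ cross C⊆ Q⊆
      -- Here b is the last vertex of P and the arc behind it is empty; on the reversed cycle b
      -- comes first.
      ... | pre , [] , refl | Q′ , refl with rev-cycle c
      ...   | P′ , c′ , e , s , s′ = go c′ (trans e (last≡ pre (ICycle.ip c))) s s′
        where
        last≡ : ∀ {x y b} pre → IPath x (pre ++ b ∷ []) y → y ≡ b
        last≡ [] [ _ ] = refl
        last≡ (_ ∷ []) (cons _ p _) = last≡ [] p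
        last≡ (_ ∷ h ∷ pre) (cons _ p _) = last≡ (h ∷ pre) p
        go : ∀ {P′} (c′ : ICycle a P′) → ICycle.x c′ ≡ b → P′ ⊆ P → P ⊆ P′ → Result
        go record { ip = [ _ ] ; x≢y = ne } _ _ _ = ⊥-elim (ne refl)
        go c′@(record { ip = cons _ _ _ }) refl s s′ = ClearEar.result {pre = []} c′ ipQ (λ m m′ → off m (tr m′)) r₁ r₂ (λ m m′ → cross m (tr m′)) (λ m → C⊆ (tr m)) Q⊆
          where
          tr : ∀ {v} → v ∈ a ∷ _ → v ∈ a ∷ P
          tr (here e) = here e
          tr (there m) = there (s m)

      -- The triangle z h u has the single vertex v as an ear from z to h.
      diamondAt : ∀ {z h u v} → z ~ h → z ~ u → z ~ v → h ~ u → h ~ v → u ≢ v → ¬ u ~ v → z ∈ S → h ∈ S → u ∈ S → v ∈ S → Result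
      diamondAt {z} {h} {u} {v} zh zu zv hu hv u≢v uv z∈ h∈ u∈ v∈ = clearEar {P = h ∷ u ∷ []}
        record { ip = cons hu [ u ] (λ ()) ; a~x = zh ; a~y = zu ; x≢y = ~⇒≢ hu ; a∉ = λ { (here e) → ~⇒≢ zh e ; (there (here e)) → ~⇒≢ zu e }
               ; inner = λ { (here e) _ → inj₁ e ; (there (here e)) _ → inj₂ e } }
        (here refl)
        ([ v ] , (λ { (here refl) (here e) → ~⇒≢ zv (sym e) ; (here refl) (there (here e)) → ~⇒≢ hv (sym e) ; (here refl) (there (there (here e))) → u≢v (sym e) }) ,
         ~-sym zv , ~-sym hv ,
         λ { (here refl) (here e) _ → inj₁ (refl , e) ; (here refl) (there (here e)) _ → inj₂ (refl , e) ; (here refl) (there (there (here refl))) r → ⊥-elim (uv (~-sym r)) })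
        (λ { (here refl) → z∈ ; (there (here refl)) → h∈ ; (there (there (here refl))) → u∈ })
        (λ { (here refl) → v∈ })

      -- Three vertices besides the base make a cycle of length at least four, so the neighbours of
      -- the base are not adjacent (`ends≢`).
      Hole : V → ℕ → Set
      Hole z m = Σ (List V) λ P → ICycle z P × P ⊆ S × length P ≤ m × 3 ≤ length P

      -- Let h be the vertex after u. If z is adjacent to h, then either so is v, giving a diamond
      -- on z, h, u, v, or the search goes on from h. If not, the first neighbour of z after u
      -- closes a cycle of length at least four.
      holeFrom : ∀ {z u l v} → IPath u l v → z ∈ S → l ⊆ S → z ∉ l → z ~ u → z ~ v → ¬ u ~ v → u ≢ v → Hole z (length l) ⊎ Result
      holeFrom [ _ ] _ _ _ _ _ _ ne = ⊥-elim (ne refl)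
      holeFrom {z} {u} {v = v} (cons {y = h} {l = l} r p f) z∈ s z∉ zu zv uv ne with z ~? h
      ... | yes zh with h ~? v | h ≟ v
      ...   | yes hv | _ = inj₂ (diamondAt zh zu zv (~-sym r) hv ne uv z∈ (s (there (here refl))) (s (here refl)) (s (there (last∈ (ipath⇒path p)))))
      ...   | no _ | yes refl = ⊥-elim (uv r)
      ...   | no hv | no h≢v with holeFrom p z∈ (λ m → s (there m)) (λ m → z∉ (there m)) zh zv hv h≢v
      ...     | inj₁ (P , c , s′ , le , le′) = inj₁ (P , c , s′ , ≤-trans le (n≤1+n _) , le′)
      ...     | inj₂ o = inj₂ o
      holeFrom {z} {u} (cons {y = h} {l = l} r p f) z∈ s z∉ zu zv uv ne | no zh with firstNbr z (cons r p f) ne zv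
      ... | l′ , y′ , q , zy , ne′ , sub , le , g = inj₁ (u ∷ l′ , record
            { ip = q ; a~x = zu ; a~y = zy ; x≢y = ne′ ; a∉ = λ m → z∉ (sub m) ; inner = λ { (here e) _ → inj₁ e ; (there m) e → inj₂ (g m e) } } ,
            (λ m → s (sub m)) , le , long q)
        where
        long : ∀ {l′} → IPath u (u ∷ l′) y′ → 3 ≤ length (u ∷ l′)
        long [ _ ] = ⊥-elim (ne′ refl)
        long (cons r₁ [ _ ] _) with sub (last∈ (ipath⇒path q))
        ... | here e = ⊥-elim (ne′ (sym e))
        ... | there (here refl) = ⊥-elim (zh zy)
        ... | there (there m) = ⊥-elim (proj₁ (f m) r₁)
        long (cons _ (cons _ _ _) _) = s≤s (s≤s (s≤s z≤n))

      closeHole : ∀ {z u Q v} → GPath u Q v → z ∈ S → Q ⊆ S → z ∉ Q → z ~ u → z ~ v → ¬ u ~ v → u ≢ v → Hole z (length Q) ⊎ Result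
      closeHole p z∈ s z∉ zu zv uv ne with induce p
      ... | Q′ , ip , sub , le with holeFrom ip z∈ (λ m → s (sub m)) (λ m → z∉ (sub m)) zu zv uv ne
      ...   | inj₁ (P , c , s′ , le′ , le″) = inj₁ (P , c , s′ , ≤-trans le′ le , le″)
      ...   | inj₂ o = inj₂ o

      -- If q has a neighbour w on P that is not next to a, both arcs between a and w close through
      -- q to a hole or yield a diamond, and one of the holes is shorter unless the given one has
      -- four vertices. Otherwise q sees a and one or both neighbours of a: a clear ear or a
      -- diamond.
      twoNbrs : ∀ {a P q b} → ICycle a P → 3 ≤ length P → (a ∷ P) ⊆ S → q ∈ S → q ∉ a ∷ P → q ~ a → b ∈ P → q ~ b →
        (∃ λ k → suc k ≤ length P × Hole q k) ⊎ Result
      twoNbrs {a} {P} {q} {b} c 3≤ C⊆ q∈ q∉ qa b∈ qb with any? (λ w → (q ~? w) ×-dec (¬? (w ≟ ICycle.x c) ×-dec ¬? (w ≟ ICycle.y c))) P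
      ... | no none = ends (q ~? x) (q ~? y)
        where
        open ICycle c
        x∈ = head∈ (ipath⇒path ip)
        y∈ = last∈ (ipath⇒path ip)
        only : ∀ {w} → w ∈ P → q ~ w → w ≡ x ⊎ w ≡ y
        only {w} m e with w ≟ x | w ≟ y
        ... | yes p | _ = inj₁ p
        ... | no _ | yes p = inj₂ p
        ... | no p | no k = ⊥-elim (none (lose m (e , p , k)))
        single : ∀ {t} → t ∈ P → q ~ t → (∀ {w} → w ∈ P → q ~ w → w ≡ t) → Result
        single {t} t∈ qt uniq = clearEar c t∈ ([ q ] , (λ { (here refl) m → q∉ m }) , qa , qt ,
          λ { (here refl) (here e) _ → inj₁ (refl , e) ; (here refl) (there m) r → inj₂ (refl , uniq m r) }) C⊆ (λ { (here refl) → q∈ })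
        ends : Dec (q ~ x) → Dec (q ~ y) → _
        ends (yes qx) (yes qy) = inj₂ (diamondAt (~-sym qa) a~x a~y qx qy x≢y (ends≢ c 3≤) (C⊆ (here refl)) q∈ (C⊆ (there x∈)) (C⊆ (there y∈)))
        ends (yes qx) (no qy) = inj₂ (single x∈ qx λ m e → Sum.[ (λ k → k) , (λ { refl → ⊥-elim (qy e) }) ] (only m e))
        ends (no qx) (yes qy) = inj₂ (single y∈ qy λ m e → Sum.[ (λ { refl → ⊥-elim (qx e) }) , (λ k → k) ] (only m e))
        ends (no qx) (no qy) = ⊥-elim (Sum.[ (λ { refl → qx qb }) , (λ { refl → qy qb }) ] (only b∈ qb))
      ... | yes an with find an
      ...   | w , w∈ , qw , w≢x , w≢y with ∈-∃++ w∈
      ...     | pre , post , refl = shape pre post c 3≤ C⊆ q∉ w≢x w≢y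
        where
        arcs : ∀ pre post (c : ICycle a (pre ++ w ∷ post)) → (a ∷ pre ++ w ∷ post) ⊆ S → q ∉ a ∷ pre ++ w ∷ post → w ≢ ICycle.x c → w ≢ ICycle.y c →
          (Hole q (length (a ∷ pre ++ w ∷ [])) ⊎ Result) × (Hole q (length (w ∷ post ++ a ∷ [])) ⊎ Result)
        arcs pre post c C⊆ q∉ w≢x w≢y =
          closeHole (arc₁ pre c) q∈ (λ m → C⊆ (s₁ m)) (λ m → q∉ (s₁ m)) qa qw a≁w a≢w ,
          closeHole (arc₂ pre c) q∈ (λ m → C⊆ (s₂ m)) (λ m → q∉ (s₂ m)) qw qa (λ e → a≁w (~-sym e)) (λ e → a≢w (sym e))
          where
          a≁w : ¬ a ~ w
          a≁w e = Sum.[ w≢x , w≢y ] (ICycle.inner c (∈-++⁺ʳ pre (here refl)) e)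
          a≢w : a ≢ w
          a≢w refl = ICycle.a∉ c (∈-++⁺ʳ pre (here refl))
          s₁ : ∀ {v} → v ∈ a ∷ pre ++ w ∷ [] → v ∈ a ∷ pre ++ w ∷ post
          s₁ (here e) = here e
          s₁ (there m) with ∈-++⁻ pre m
          ... | inj₁ k = there (∈-++⁺ˡ k)
          ... | inj₂ (here e) = there (∈-++⁺ʳ pre (here e))
          s₂ : ∀ {v} → v ∈ w ∷ post ++ a ∷ [] → v ∈ a ∷ pre ++ w ∷ post
          s₂ (here e) = there (∈-++⁺ʳ pre (here e))
          s₂ (there m) with ∈-++⁻ post m
          ... | inj₁ k = there (∈-++⁺ʳ pre (there k))
          ... | inj₂ (here e) = here e
        shape : ∀ pre post (c : ICycle a (pre ++ w ∷ post)) → 3 ≤ length (pre ++ w ∷ post) → (a ∷ pre ++ w ∷ post) ⊆ S → q ∉ a ∷ pre ++ w ∷ post →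
          w ≢ ICycle.x c → w ≢ ICycle.y c → (∃ λ k → suc k ≤ length (pre ++ w ∷ post) × Hole q k) ⊎ Result
        shape [] post record { ip = [ _ ] } _ _ _ w≢x _ = ⊥-elim (w≢x refl)
        shape [] post record { ip = cons _ _ _ } _ _ _ w≢x _ = ⊥-elim (w≢x refl)
        shape (h ∷ h′ ∷ pre) post c _ C⊆ q∉ nx ny with proj₂ (arcs (h ∷ h′ ∷ pre) post c C⊆ q∉ nx ny)
        ... | inj₂ o = inj₂ o
        ... | inj₁ H = inj₁ (_ , ≤-reflexive′ , H)
          where
          ≤-reflexive′ : suc (length (w ∷ post ++ a ∷ [])) ≤ length (h ∷ h′ ∷ pre ++ w ∷ post)
          ≤-reflexive′ = s≤s (s≤s (≤-trans (≤-reflexive (trans (length-++ post) (+-comm (length post) 1))) (≤-trans (m≤n+m (suc (length post)) (length pre)) (≤-reflexive (sym (length-++ pre))))))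
        shape (h ∷ []) (e ∷ e′ ∷ post) c _ C⊆ q∉ nx ny with proj₁ (arcs (h ∷ []) (e ∷ e′ ∷ post) c C⊆ q∉ nx ny)
        ... | inj₂ o = inj₂ o
        ... | inj₁ H = inj₁ (_ , s≤s (s≤s (s≤s (s≤s z≤n))) , H)
        shape (h ∷ []) [] c (s≤s (s≤s ())) C⊆ q∉ nx ny
        -- The hole is a 4-cycle and q sees the opposite vertices a and w. A third neighbour of q
        -- gives a diamond; without one, q completes an induced K_{2,3}.
        shape (h ∷ []) (e ∷ []) c@(record { ip = cons r₁ (cons r₂ [ _ ] _) f ; a~x = ah ; a~y = ae ; inner = inn }) 3≤ C⊆ q∉ nx ny with q ~? h | q ~? e
        ... | yes qh | _ = inj₂ (diamondAt qh qa qw (~-sym ah) r₁ (λ { refl → ICycle.a∉ c (there (here refl)) }) (λ r → Sum.[ nx , ny ] (inn (there (here refl)) r))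
                q∈ (C⊆ (there (here refl))) (C⊆ (here refl)) (C⊆ (there (there (here refl)))))
        ... | _ | yes qe = inj₂ (diamondAt qe qa qw (~-sym ae) (~-sym r₂) (λ { refl → ICycle.a∉ c (there (here refl)) }) (λ r → Sum.[ nx , ny ] (inn (there (here refl)) r))
                q∈ (C⊆ (there (there (there (here refl))))) (C⊆ (here refl)) (C⊆ (there (there (here refl)))))
        ... | no qh | no qe = inj₂ (clearEar c (there (here refl)) ([ q ] , (λ { (here refl) m → q∉ m }) , qa , qw ,
                λ { (here refl) (here e) _ → inj₁ (refl , e) ; (here refl) (there (here refl)) r → ⊥-elim (qh r)
                  ; (here refl) (there (there (here e))) _ → inj₂ (refl , e) ; (here refl) (there (there (there (here refl)))) r → ⊥-elim (qe r) }) C⊆ (λ { (here refl) → q∈ }))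

      module _ (two : TwoConnected (_∈ S)) {d e₁ e₂ e₃ : V} (d∈ : d ∈ S) (e₁∈ : e₁ ∈ S) (e₂∈ : e₂ ∈ S) (e₃∈ : e₃ ∈ S)
        (d~e₁ : d ~ e₁) (d~e₂ : d ~ e₂) (d~e₃ : d ~ e₃) (e₁≢e₂ : e₁ ≢ e₂) (e₁≢e₃ : e₁ ≢ e₃) (e₂≢e₃ : e₂ ≢ e₃) where

        -- Stopping at the first vertex q that touches P makes q the only such vertex; `lastAdj`
        -- then starts the walk at its last neighbour of the base. What is left touches the cycle
        -- only as an ear should, except that q may have several neighbours on P.
        walkUntil : ∀ {a P z v} → GReach (Minus (_∈ S) a) z v → z ∉ a ∷ P → v ∈ P → Σ (List V) λ l → ∃ λ q → GPath z l q × l ⊆ S × (∀ {w} → w ∈ l → w ∉ a ∷ P) ×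
          Any (q ~_) P × (∀ {w} → w ∈ l → Any (w ~_) P → w ≡ q)
        walkUntil {a} {P} {z} q z∉ v∈ with any? (z ~?_) P
        walkUntil {z = z} q z∉ v∈ | yes an = z ∷ [] , z , [ z ] , (λ { (here refl) → proj₁ (reach-start q) }) , (λ { (here refl) → z∉ }) , an , λ { (here e) _ → e }
        walkUntil (stop _) z∉ v∈ | no _ = ⊥-elim (z∉ (there v∈))
        walkUntil {a} {P} {z} (step {y = w} wz r q) z∉ v∈ | no nz with walkUntil {a} {P} q w∉ v∈
          where
          w∉ : w ∉ a ∷ P
          w∉ (here e) = proj₂ (reach-start q) e
          w∉ (there m) = nz (lose m r)
        ... | l , t , p , s , o , an , f = z ∷ l , t , r ∷ p , (λ { (here refl) → proj₁ wz ; (there m) → s m }) , (λ { (here refl) → z∉ ; (there m) → o m }) ,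
              an , λ { (here refl) an′ → ⊥-elim (nz an′) ; (there m) → f m }

        lastAdj : ∀ {a z l q} → GPath z l q → Any (_~ a) l → ∃ λ d → Σ (List V) λ l′ → GPath d l′ q × l′ ⊆ l × d ~ a × (∀ {w} → w ∈ l′ → w ~ a → w ≡ d)
        lastAdj [ z ] (here r) = z , _ , [ z ] , (λ m → m) , r , λ { (here e) _ → e }
        lastAdj {a} (_∷_ {l = l} r p) an with any? (_~? a) l
        ... | yes an′ = let (d , l′ , p′ , s , rest) = lastAdj p an′ in d , l′ , p′ , (λ m → there (s m)) , rest
        lastAdj (r ∷ p) (there an) | no nn = ⊥-elim (nn an)
        lastAdj (_∷_ {x = z} r p) (here r′) | no nn = z , _ , r ∷ p , (λ m → m) , r′ , λ { (here e) _ → e ; (there m) e → ⊥-elim (nn (lose m e)) }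

        -- The number `bound` stands in for the choice of a shortest hole. If the last vertex q of
        -- the ear has two neighbours on P, `twoNbrs` gives an object or a shorter hole; otherwise
        -- the ear is clear.
        fromHole : ∀ bound {a P} → ICycle a P → a ∈ S → P ⊆ S → length P ≤ bound → 3 ≤ length P → Result
        fromHole zero c _ _ le 3≤ with ≤-trans 3≤ le
        ... | ()
        fromHole (suc bound) {a} {P} c a∈ P⊆ le 3≤ with any? (λ v → ¬? (v ∈? a ∷ P)) S
        ... | no none = ⊥-elim (cycle-degree c (all d∈) (all e₁∈) (all e₂∈) (all e₃∈) d~e₁ d~e₂ d~e₃ e₁≢e₂ e₁≢e₃ e₂≢e₃)
          where
          all : ∀ {v} → v ∈ S → v ∈ a ∷ P
          all {v} m with v ∈? a ∷ P
          ... | yes k = k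
          ... | no k = ⊥-elim (none (lose m k))
        ... | yes an with find an
        ...   | z₀ , z₀∈ , z₀∉ with enter {L = a ∷ P} (two {ICycle.x c} z₀∈ a∈ (λ { refl → z₀∉ (there (head∈ (ipath⇒path (ICycle.ip c)))) }) (~⇒≢ (ICycle.a~x c))) z₀∉ (here refl)
        ...   | z , w , (z∈ , _) , z∉ , z~w , w∈ , _ with rotate c w∈
        ...   | P′ , c′ , s₁ , s₂ , len = ear c′ (≤-trans (≤-reflexive len) le) (≤-trans 3≤ (≤-reflexive (sym len))) C⊆ (λ m → z∉ (s₁ m)) z~w
          where
          C⊆ : (w ∷ P′) ⊆ S
          C⊆ m with s₁ m
          ... | here refl = a∈
          ... | there m′ = P⊆ m′
          again : ∀ {q} P → (∃ λ k → suc k ≤ length P × Hole q k) ⊎ Result → q ∈ S → length P ≤ suc bound → Result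
          again P (inj₂ o) _ _ = o
          again P (inj₁ (k , lt , _ , c , s , le , 3≤)) q∈ leP = fromHole bound c q∈ s (≤-pred (≤-trans (s≤s le) (≤-trans lt leP))) 3≤
          ear : ∀ {w P} → (c : ICycle w P) → length P ≤ suc bound → 3 ≤ length P → (w ∷ P) ⊆ S → z ∉ w ∷ P → z ~ w → Result
          ear {w} {P} c leP 3≤ C⊆ z∉ z~w with head∈ (ipath⇒path (ICycle.ip c))
          ... | x∈ with walkUntil {w} {P} (two {w} z∈ (C⊆ (there x∈)) (~⇒≢ z~w) (λ e → ~⇒≢ (ICycle.a~x c) (sym e))) z∉ x∈
          ...   | l , q , p , l⊆ , off , an , f with lastAdj p (lose (head∈ p) z~w)
          ...     | d , l′ , p′ , l′⊆ , d~w , g with induce p′ | find an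
          ...       | Q , ip , Q⊆ , _ | b , b∈ , q~b with any? (λ b′ → (q ~? b′) ×-dec ¬? (b′ ≟ b)) P
          ...         | no one = clearEar c b∈ (ip , (λ m → off (l′⊆ (Q⊆ m))) , d~w , q~b , cross) C⊆ (λ m → l⊆ (l′⊆ (Q⊆ m)))
            where
            cross : ∀ {u v} → u ∈ Q → v ∈ w ∷ P → u ~ v → (u ≡ d × v ≡ w) ⊎ (u ≡ q × v ≡ b)
            cross u∈ (here refl) r = inj₁ (g (Q⊆ u∈) r , refl)
            cross {u} {v} u∈ (there v∈) r with f (l′⊆ (Q⊆ u∈)) (lose v∈ r)
            ... | refl with v ≟ b
            ...   | yes e = inj₂ (refl , e)
            ...   | no ne = ⊥-elim (one (lose v∈ (r , ne)))
          ...         | yes an′ with find an′ | rotate c (there b∈)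
          ...           | b′ , b′∈ , q~b′ , b′≢b | P″ , c″ , t₁ , t₂ , len with t₂ (there b′∈)
          ...             | here e = ⊥-elim (b′≢b e)
          ...             | there m = again P″ (twoNbrs c″ (≤-trans 3≤ (≤-reflexive (sym len))) (λ k → C⊆ (t₁ k)) (l⊆ (last∈ p))
                                       (λ k → off (last∈ p) (t₁ k)) q~b m q~b′) (l⊆ (last∈ p)) (≤-trans (≤-reflexive len) leP)

        -- The non-adjacent vertices u and v rule out complete graphs.
        theta : ∀ {u v t} → u ∈ S → v ∈ S → u ≢ v → ¬ u ~ v → u ≢ t → v ≢ t → Result
        theta {u} {v} {t} u∈ v∈ u≢v u≁v u≢t v≢t with start (two {t} u∈ v∈ u≢t v≢t)
          where
          start : ∀ {W : V → Set} → GReach W u v → ∃ λ a → ∃ λ y → W a × W y × u ~ a × a ~ y × u ≢ y × ¬ u ~ y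
          start (stop _) = ⊥-elim (u≢v refl)
          start (step _ r q) = cherry q r (λ e → u≢v (sym e)) u≁v
        ... | a , y , (a∈ , _) , (y∈ , _) , u~a , a~y , u≢y , u≁y with reach⇒path (two {a} u∈ y∈ (~⇒≢ u~a) (λ e → ~⇒≢ a~y (sym e)))
        ...   | l , p , f with closeHole p a∈ (λ m → proj₁ (f m)) (λ m → proj₂ (f m) refl) (~-sym u~a) a~y u≁y u≢y
        ...     | inj₂ o = o
        ...     | inj₁ (P , c , s , le , 3≤) = fromHole (length P) c a∈ s ≤-refl 3≤

    open Packing diamond (graphSpine isDiamond) (s≤s (s≤s z≤n)) using (Avoids; Choice; none; big)
    open Search diamond G
    open import Data.List.Relation.Unary.All using (all?)

    -- D consists of the two ends of the spine, and three consecutive vertices of P contain the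
    -- non-adjacent pair from which `theta` starts.
    choose : ∀ X → Choice 0 2 3 X
    choose X with searchObject (all? (λ v → ¬? (v ∈? X)))
    ... | no ne = none (λ {c} a → ne (c , All.tabulate a))
    ... | yes (c , al) = big c (λ m → All.lookup al m) path (x ∷ y ∷ []) [] (s≤s (s≤s z≤n)) (λ m → split (image⊆ m)) verts⊆ (λ _ ()) (λ _ _ _ ()) ladder
      where
      open ObjectPath (objectPath (s≤s (s≤s z≤n)) (graphSpine isDiamond) c)
      verts⊆ : verts ⊆ image c
      verts⊆ m with ∈-applyUpTo⁻ p m
        where open import Data.List.Membership.Propositional.Properties using (∈-applyUpTo⁻)
      ... | i , lt , refl = p∈ lt
      ladder : ∀ {S} → Good path 3 S → _ → Σ Object λ c → image c ⊆ S
      ladder {S} g _ = In.theta S two-connected d∈ e₁∈ e₂∈ e₃∈ d~e₁ d~e₂ d~e₃ e₁≢e₂ e₁≢e₃ e₂≢e₃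
          (run∈ ≤-refl (≤-trans (s≤s (m≤m+n start 2)) (≤-reflexive (sym (+-suc start 2)))))
          (run∈ (m≤m+n start 2) (≤-reflexive (sym (+-suc start 2))))
          (λ e → <-irrefl (p-inj s< s+2< e) lt₂) (far lt s+2<)
          (λ e → <-irrefl (p-inj s< s+1< e) ≤-refl) (λ e → <-irrefl (sym (p-inj s+2< s+1< e)) lt)
        where
        open Good g
        lt : suc start < start + 2
        lt = ≤-reflexive (trans (cong suc (+-comm 1 start)) (sym (+-suc start 1)))
        s+2< : start + 2 < N
        s+2< = ≤-trans (≤-reflexive (sym (+-suc start 2))) run<
        s+1< : suc start < N
        s+1< = <-trans lt s+2<
        s< : start < N
        s< = <-trans (n<1+n start) s+1<
        lt₂ : start < start + 2
        lt₂ = <-trans (n<1+n start) lt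

  -- Cycles with tails

  -- A cycle with a tail Lt attached at its apex; Et lists the edges of the tail.
  module Tailed {H : Graph} {a : V} {P : List V} (c : ICycle a P) (Lt : List V) (Et : List (V × V))
    (tail-edge : ∀ {u w} → u ∈ Lt → w ∈ Lt → u ~ w → EdgeIn Et u w) (tail-adj : ∀ {u w} → (u , w) ∈ Et → u ~ w)
    (cross : ∀ {u w} → u ∈ Lt → w ∈ a ∷ P → u ~ w → EdgeIn Et u w) where

    open Objects H G

    finish : ∀ {x y} mid → P ≡ x ∷ mid ++ y ∷ [] → Models.Model H (mid ++ a ∷ x ∷ y ∷ Lt) (chain x mid y ++ (a , x) ∷ (y , a) ∷ Et) →
             Σ (InducedSubdiv H G) λ o → image o ⊆ Lt ++ a ∷ P
    finish {x} {y} mid refl m = let (o , s) = modelObject m h⁺ Sum.[ h⁻ , (λ e → ~-sym (h⁻ e)) ] in o , λ v∈ → out (sides (s v∈))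
      where
      T = chain x mid y ++ (a , x) ∷ (y , a) ∷ Et
      sides : ∀ {v} → v ∈ mid ++ a ∷ x ∷ y ∷ Lt → v ∈ Lt ⊎ v ∈ a ∷ P
      sides v∈ with ∈-++⁻ mid v∈
      ... | inj₁ k = inj₂ (there (there (∈-++⁺ˡ k)))
      ... | inj₂ (here e) = inj₂ (here e)
      ... | inj₂ (there (here e)) = inj₂ (there (here e))
      ... | inj₂ (there (there (here e))) = inj₂ (there (there (∈-++⁺ʳ mid (here e))))
      ... | inj₂ (there (there (there k))) = inj₁ k
      out : ∀ {v} → v ∈ Lt ⊎ v ∈ a ∷ P → v ∈ Lt ++ a ∷ P
      out = Sum.[ ∈-++⁺ˡ , ∈-++⁺ʳ Lt ]
      cyc : ∀ {u w} → (u , w) ∈ chain a P a → (u , w) ∈ T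
      cyc (here e) = ∈-++⁺ʳ (chain x mid y) (here e)
      cyc {u} {w} (there k) with ∈-++⁻ (chain x mid y) (subst ((u , w) ∈_) (chain-++ mid) k)
      ... | inj₁ j = ∈-++⁺ˡ j
      ... | inj₂ (here e) = ∈-++⁺ʳ (chain x mid y) (there (here e))
      tl : ∀ {u w} → EdgeIn Et u w → EdgeIn T u w
      tl = Sum.map (λ k → ∈-++⁺ʳ (chain x mid y) (there (there k))) (λ k → ∈-++⁺ʳ (chain x mid y) (there (there k)))
      h⁺ : ∀ {u w} → u ∈ _ → w ∈ _ → u ~ w → EdgeIn T u w
      h⁺ u∈ w∈ r with sides u∈ | sides w∈
      ... | inj₁ p | inj₁ q = tl (tail-edge p q r)
      ... | inj₁ p | inj₂ q = tl (cross p q r)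
      ... | inj₂ p | inj₁ q = edgeIn-sym {es = T} (tl (cross q p (~-sym r)))
      ... | inj₂ p | inj₂ q = Sum.map cyc cyc (cycle-edges c p q r)
      back : ∀ {u w} → (u , w) ∈ chain x mid y ++ (y , a) ∷ [] → u ~ w
      back {u} {w} k = cycle-adj c (there (subst ((u , w) ∈_) (sym (chain-++ mid)) k))
      h⁻ : ∀ {u w} → (u , w) ∈ T → u ~ w
      h⁻ k with ∈-++⁻ (chain x mid y) k
      ... | inj₁ j = back (∈-++⁺ˡ j)
      ... | inj₂ (here refl) = cycle-adj c (here refl)
      ... | inj₂ (there (here refl)) = back (∈-++⁺ʳ (chain x mid y) (here refl))
      ... | inj₂ (there (there j)) = tail-adj j

  unsnoc : ∀ {x l y} → IPath x l y → x ≢ y → Σ (List V) λ mid → l ≡ x ∷ mid ++ y ∷ []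
  unsnoc [ _ ] ne = ⊥-elim (ne refl)
  unsnoc (cons {y = h} {z = z} r p f) ne with h ≟ z
  unsnoc (cons r [ _ ] f) ne | yes _ = [] , refl
  unsnoc (cons r p@(cons _ q _) f) ne | yes refl with ipath-unique p
  ... | h∉ ∷ _ = ⊥-elim (All.lookup h∉ (last∈ (ipath⇒path q)) refl)
  unsnoc (cons {y = h} r p f) ne | no ne′ with unsnoc p ne′
  ... | mid , refl = h ∷ mid , refl

  pan1At : ∀ {a P v} → ICycle a P → v ~ a → v ∉ a ∷ P → (∀ {w} → w ∈ P → ¬ v ~ w) →
    Σ (InducedSubdiv pan1 G) λ o → Objects.image pan1 G o ⊆ v ∷ a ∷ P
  pan1At {a} {P} {v} c va v∉ f with unsnoc (ICycle.ip c) (ICycle.x≢y c)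
  ... | mid , e = Tailed.finish c (v ∷ []) ((a , v) ∷ [])
      (λ { (here refl) (here refl) r → ⊥-elim (~-irrefl r) }) (λ { (here refl) → ~-sym va })
      (λ { (here refl) (here refl) _ → inj₂ (here refl) ; (here refl) (there m) r → ⊥-elim (f m r) }) mid e (go e (ipath-unique (ICycle.ip c)) (ICycle.a∉ c) v∉)
    where
    open PanModel {V}
    go : ∀ {x y P} → P ≡ x ∷ mid ++ y ∷ [] → Unique P → a ∉ P → v ∉ a ∷ P → _
    go {x} {y} refl (x∉ ∷ u) a∉ v∉ with unique-++ mid u
    ... | u₁ , _ , d = pan1Model mid (((λ { refl → a∉ (here refl) }) ∷ (λ { refl → a∉ (there (∈-++⁺ʳ mid (here refl))) }) ∷ (λ { refl → v∉ (here refl) }) ∷ []) ∷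
        (All.lookup x∉ (∈-++⁺ʳ mid (here refl)) ∷ (λ { refl → v∉ (there (here refl)) }) ∷ []) ∷ ((λ { refl → v∉ (there (there (∈-++⁺ʳ mid (here refl)))) }) ∷ []) ∷ [] ∷ [])
        u₁ λ { m (here refl) → a∉ (there (∈-++⁺ˡ m)) ; m (there (here refl)) → All.lookup x∉ (∈-++⁺ˡ m) refl
             ; m (there (there (here refl))) → d m (here refl) ; m (there (there (there (here refl)))) → v∉ (there (there (∈-++⁺ˡ m))) }

  pan2At : ∀ {a P v w} → ICycle a P → v ~ a → v ∉ a ∷ P → (∀ {u} → u ∈ P → ¬ v ~ u) → w ~ v → w ∉ a ∷ P → (∀ {u} → u ∈ a ∷ P → ¬ w ~ u) →
    Σ (InducedSubdiv pan2 G) λ o → Objects.image pan2 G o ⊆ v ∷ w ∷ a ∷ P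
  pan2At {a} {P} {v} {w} c va v∉ f wv w∉ g with unsnoc (ICycle.ip c) (ICycle.x≢y c)
  ... | mid , e = Tailed.finish c (v ∷ w ∷ []) ((a , v) ∷ (v , w) ∷ [])
      (λ { (here refl) (here refl) r → ⊥-elim (~-irrefl r) ; (there (here refl)) (there (here refl)) r → ⊥-elim (~-irrefl r)
         ; (here refl) (there (here refl)) _ → inj₁ (there (here refl)) ; (there (here refl)) (here refl) _ → inj₂ (there (here refl)) })
      (λ { (here refl) → ~-sym va ; (there (here refl)) → ~-sym wv })
      (λ { (here refl) (here refl) _ → inj₂ (here refl) ; (here refl) (there m) r → ⊥-elim (f m r) ; (there (here refl)) m r → ⊥-elim (g m r) })
      mid e (go e (ipath-unique (ICycle.ip c)) (ICycle.a∉ c) v∉ w∉)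
    where
    open PanModel {V}
    go : ∀ {x y P} → P ≡ x ∷ mid ++ y ∷ [] → Unique P → a ∉ P → v ∉ a ∷ P → w ∉ a ∷ P → _
    go {x} {y} refl (x∉ ∷ u) a∉ v∉ w∉ with unique-++ mid u
    ... | u₁ , _ , d = pan2Model mid (((λ { refl → a∉ (here refl) }) ∷ (λ { refl → a∉ (there (∈-++⁺ʳ mid (here refl))) }) ∷ (λ { refl → v∉ (here refl) }) ∷ (λ { refl → w∉ (here refl) }) ∷ []) ∷
        (All.lookup x∉ (∈-++⁺ʳ mid (here refl)) ∷ (λ { refl → v∉ (there (here refl)) }) ∷ (λ { refl → w∉ (there (here refl)) }) ∷ []) ∷
        ((λ { refl → v∉ (there (there (∈-++⁺ʳ mid (here refl)))) }) ∷ (λ { refl → w∉ (there (there (∈-++⁺ʳ mid (here refl)))) }) ∷ []) ∷ ((λ e → ~⇒≢ wv (sym e)) ∷ []) ∷ [] ∷ [])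
        u₁ λ { m (here refl) → a∉ (there (∈-++⁺ˡ m)) ; m (there (here refl)) → All.lookup x∉ (∈-++⁺ˡ m) refl
             ; m (there (there (here refl))) → d m (here refl) ; m (there (there (there (here refl)))) → v∉ (there (there (∈-++⁺ˡ m)))
             ; m (there (there (there (there (here refl))))) → w∉ (there (there (∈-++⁺ˡ m))) }

  Touches : V → List V → Set
  Touches z C = Any (z ~_) C

  -- A single neighbour makes z the beginning of a tail at it; two neighbours give a new cycle
  -- through z.
  data OnCycle (z a : V) (P : List V) : Set where
    one : ∀ {w P′} → ICycle w P′ → (w ∷ P′) ⊆ (a ∷ P) → (a ∷ P) ⊆ (w ∷ P′) → length P′ ≡ length P → z ~ w → (∀ {u} → u ∈ P′ → ¬ z ~ u) → OnCycle z a P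
    two : ∀ {w P′ b} → ICycle w P′ → (w ∷ P′) ⊆ (a ∷ P) → length P′ ≡ length P → z ~ w → b ∈ P′ → z ~ b → OnCycle z a P

  onCycle : ∀ {z a P} → ICycle a P → Touches z (a ∷ P) → OnCycle z a P
  onCycle {z} c t with find t
  ... | w , w∈ , zw with rotate c w∈
  ...   | P′ , c′ , s , s′ , len with any? (z ~?_) P′
  ...     | no none = one c′ s s′ len zw λ m e → none (lose m e)
  ...     | yes an = let (b , b∈ , zb) = find an in two c′ s len zw b∈ zb

  -- If at least two vertices follow b on P, the arc before b is short enough. Otherwise the arc
  -- after b has at most three vertices, fewer than P as soon as P has four.
  through : ∀ {z w P b} → ICycle w P → z ∉ w ∷ P → z ~ w → b ∈ P → z ~ b →
    Σ (List V) λ Q → ICycle z Q × Q ⊆ (w ∷ P) × (4 ≤ length P → suc (length Q) ≤ length P)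
  through {z} {w} {P} {b} c z∉ zw b∈ zb with ∈-∃++ b∈
  ... | pre , post , refl with 2 ≤? length post
  ...   | yes 2≤ = let (Q , c′ , s , le) = closeCycle z (arc₁ pre c) (λ m → z∉ (s₁ m)) zw zb (λ { refl → ICycle.a∉ c b∈ }) in
                   Q , c′ , (λ m → s₁ (s m)) , λ _ → ≤-trans (s≤s le) (≤-trans (≤-reflexive (cong suc (cong suc (length-++ pre)))) (≤-trans (≤-reflexive (sym (trans (+-suc (length pre) 2) (cong suc (+-suc (length pre) 1)))))
                     (≤-trans (+-monoʳ-≤ (length pre) (s≤s 2≤)) (≤-reflexive (sym (length-++ pre))))))
    where
    s₁ : ∀ {v} → v ∈ w ∷ pre ++ b ∷ [] → v ∈ w ∷ pre ++ b ∷ post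
    s₁ (here e) = here e
    s₁ (there m) with ∈-++⁻ pre m
    ... | inj₁ k = there (∈-++⁺ˡ k)
    ... | inj₂ (here e) = there (∈-++⁺ʳ pre (here e))
  ...   | no ≱ = let (Q , c′ , s , le) = closeCycle z (arc₂ pre c) (λ m → z∉ (s₂ m)) zb zw (λ { refl → ICycle.a∉ c b∈ }) in
                 Q , c′ , (λ m → s₂ (s m)) , λ 4≤ → ≤-trans (s≤s le) (≤-trans (s≤s (s≤s (≤-trans (≤-reflexive (trans (length-++ post) (+-comm (length post) 1))) (≰⇒> ≱)))) 4≤)
    where
    s₂ : ∀ {v} → v ∈ b ∷ post ++ w ∷ [] → v ∈ w ∷ pre ++ b ∷ post
    s₂ (here e) = there (∈-++⁺ʳ pre (here e))
    s₂ (there m) with ∈-++⁻ post m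
    ... | inj₁ k = there (∈-++⁺ʳ pre (there k))
    ... | inj₂ (here e) = here e

  module OnPath (Pt : IndPath) where

    open IndPath Pt public

    segL : ℕ → ℕ → List V
    segL i zero = p i ∷ []
    segL i (suc k) = p i ∷ segL (suc i) k

    segL⁻ : ∀ i k {v} → v ∈ segL i k → ∃ λ t → i ≤ t × t ≤ i + k × v ≡ p t
    segL⁻ i zero (here e) = i , ≤-refl , m≤m+n i 0 , e
    segL⁻ i (suc k) (here e) = i , ≤-refl , m≤m+n i _ , e
    segL⁻ i (suc k) (there m) = let (t , a , b , e) = segL⁻ (suc i) k m in t , <⇒≤ a , ≤-trans b (≤-reflexive (sym (+-suc i k))) , e

    segL-length : ∀ i k → length (segL i k) ≡ suc k
    segL-length i zero = refl
    segL-length i (suc k) = cong suc (segL-length (suc i) k)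

    segI : ∀ i k → i + k < N → IPath (p i) (segL i k) (p (i + k))
    segI i zero lt rewrite +-identityʳ i = [ p i ]
    segI i (suc zero) lt rewrite +-suc i 0 | +-identityʳ i = cons (next lt) [ _ ] (λ ())
    segI i (suc (suc k)) lt = cons (next (≤-<-trans (≤-trans (m≤m+n (suc i) (suc k)) (≤-reflexive (sym (+-suc i (suc k))))) lt))
        (subst (λ j → IPath (p (suc i)) (segL (suc i) (suc k)) (p j)) (sym (+-suc i (suc k))) (segI (suc i) (suc k) (subst (_< N) (+-suc i (suc k)) lt))) f
      where
      f : ∀ {w} → w ∈ segL (suc (suc i)) k → ¬ p i ~ w × p i ≢ w
      f m with segL⁻ (suc (suc i)) k m
      ... | t , a , b , refl = far a t< , λ e → <-irrefl (p-inj (<-trans (<-trans (n<1+n i) a) t<) t< e) (<-trans (n<1+n i) a)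
        where t< = ≤-<-trans (≤-trans b (≤-reflexive (sym (trans (+-suc i (suc k)) (cong suc (+-suc i k)))))) lt

    segCycle : ∀ {u i j} → Off u → i < j → j < N → u ~ p i → u ~ p j → (∀ {k} → i < k → k < j → ¬ u ~ p k) →
      Σ (List V) λ P → ICycle u P × (length P ≡ suc (j ∸ i) × p j ∈ P) × (∀ {v} → v ∈ P → ∃ λ t → i ≤ t × t ≤ j × v ≡ p t)
    segCycle {u} {i} {j} off lt jN ui uj none = segL i (j ∸ i) , record
      { ip = subst (λ m → IPath (p i) (segL i (j ∸ i)) (p m)) e (segI i (j ∸ i) (subst (_< N) (sym e) jN))
      ; a~x = ui ; a~y = uj ; x≢y = λ eq → <-irrefl (p-inj (<-trans lt jN) jN eq) lt
      ; a∉ = λ m → let (t , a , b , eq) = mem m in off t (≤-<-trans b jN) eq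
      ; inner = λ m r → inn (mem m) r } , (segL-length i (j ∸ i) , last∈ (ipath⇒path (subst (λ m → IPath (p i) (segL i (j ∸ i)) (p m)) e (segI i (j ∸ i) (subst (_< N) (sym e) jN))))) , mem
      where
      e = m+[n∸m]≡n (<⇒≤ lt)
      mem : ∀ {v} → v ∈ segL i (j ∸ i) → ∃ λ t → i ≤ t × t ≤ j × v ≡ p t
      mem m = let (t , a , b , eq) = segL⁻ i (j ∸ i) m in t , a , ≤-trans b (≤-reflexive e) , eq
      inn : ∀ {w} → (∃ λ t → i ≤ t × t ≤ j × w ≡ p t) → u ~ w → w ≡ p i ⊎ w ≡ p j
      inn (t , a , b , refl) r with i ℕ.≟ t | t ℕ.≟ j
      ... | yes refl | _ = inj₁ refl
      ... | _ | yes refl = inj₂ refl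
      ... | no n₁ | no n₂ = ⊥-elim (none (≤∧≢⇒< a n₁) (≤∧≢⇒< b n₂) r)

    p≢ : ∀ {s t} → s < t → t < N → p t ≢ p s
    p≢ lt tN e = <-irrefl (sym (p-inj tN (<-trans lt tN) e)) lt

  -- The walk before entering Q is kept, because the tail of a 2-pan is taken from it.
  enterNear : ∀ {W Q : V → Set} → Decidable Q → ∀ {u v} → GReach W u v → ¬ Q u → Q v → ∃ λ z → ∃ λ w → GReach (λ t → W t × ¬ Q t) u z × z ~ w × Q w × W w
  enterNear Q? (stop _) nq q = ⊥-elim (nq q)
  enterNear Q? (step {y = w} wu r p) nq q with Q? w
  ... | yes qw = _ , w , stop (wu , nq) , r , qw , reach-start p
  ... | no nw with enterNear Q? p nw q
  ...   | z , w′ , re , zw , qw , ww = z , w′ , step (wu , nq) r re , zw , qw , ww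

  NearC : List V → V → Set
  NearC C v = v ∈ C ⊎ Touches v C

  nearC? : ∀ C v → Dec (NearC C v)
  nearC? C v = (v ∈? C) ⊎-dec any? (v ~?_) C

  outside : ∀ {a P S Pt r} → ICycle a P → (a ∷ P) ⊆ S → Good Pt r S → ∃ λ z → ∃ λ w → z ∈ S × z ∉ a ∷ P × z ~ w × w ∈ a ∷ P
  outside {a} {P} {S} c C⊆ g with any? (λ v → ¬? (v ∈? a ∷ P)) S
  ... | no none = ⊥-elim (cycle-degree c (all d∈) (all e₁∈) (all e₂∈) (all e₃∈) d~e₁ d~e₂ d~e₃ e₁≢e₂ e₁≢e₃ e₂≢e₃)
    where
    open Good g
    all : ∀ {v} → v ∈ S → v ∈ a ∷ P
    all {v} m with v ∈? a ∷ P
    ... | yes k = k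
    ... | no k = ⊥-elim (none (lose m k))
  ... | yes an with find an
  ...   | z₀ , z₀∈ , z₀∉ with enterNear {Q = _∈ a ∷ P} (_∈? (a ∷ P)) (Good.two-connected g {ICycle.x c} z₀∈ (C⊆ (here refl)) (λ { refl → z₀∉ (there (head∈ (ipath⇒path (ICycle.ip c)))) }) (~⇒≢ (ICycle.a~x c))) z₀∉ (here refl)
  ...     | z , w , re , zw , w∈ , _ = z , w , proj₁ (proj₁ (reach-end re)) , proj₂ (reach-end re) , zw , w∈

  someCycle : ∀ {S Pt r} → Good Pt r S → ∃ λ a → Σ (List V) λ P → ICycle a P × (a ∷ P) ⊆ S
  someCycle {S} g with reach⇒path (two-connected {d} e₁∈ e₂∈ (λ e → ~⇒≢ d~e₁ (sym e)) (λ e → ~⇒≢ d~e₂ (sym e)))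
    where open Good g
  ... | l , p , f with closeCycle (Good.d g) p (λ m → proj₂ (f m) refl) (Good.d~e₁ g) (Good.d~e₂ g) (Good.e₁≢e₂ g)
  ...   | P , c , s , _ = Good.d g , P , c , λ { (here refl) → Good.d∈ g ; (there m) → proj₁ (f (s m)) }

  -- The 1-pan

  module Pan1 where

    open Objects pan1 G

    module In {Pt : IndPath} {S : List V} (g : Good Pt 30 S) where

      open OnPath Pt
      open Good g

      Result : Set
      Result = Σ (InducedSubdiv pan1 G) λ o → image o ⊆ S

      at : ∀ {a P v} → ICycle a P → (a ∷ P) ⊆ S → v ∈ S → v ~ a → v ∉ a ∷ P → (∀ {w} → w ∈ P → ¬ v ~ w) → Result
      at c C⊆ v∈ va v∉ f = let (o , s) = pan1At c va v∉ f in o , λ m → inS (s m)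
        where
        inS : ∀ {u} → u ∈ _ ∷ _ ∷ _ → u ∈ S
        inS (here refl) = v∈
        inS (there m) = C⊆ m

      -- A cycle with at most four vertices rules out at most 12 indices, so 13 pairs, that is 26
      -- indices, suffice; the run of 30 also contains the index `hi` itself.
      lo hi : ℕ
      lo = start
      hi = start + 26

      inRun : ∀ {t} → lo ≤ t → t ≤ hi → t < N × p t ∈ S
      inRun a b = <-≤-trans (≤-<-trans b lt) run< , run∈ a (≤-<-trans b lt)
        where
        lt : start + 26 < start + 30
        lt = +-monoʳ-< start (toWitness {a? = 27 ≤? 30} _)

      -- If l is not j + 1, then p l is pendant at u on the cycle through p i and p j. If i + 1 is
      -- not j, then p i is pendant at u on the cycle through p j and p l. If the three are
      -- consecutive, p (l + 1) is pendant at u or at p l on a triangle.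
      panFrom : ∀ {u i j l} → u ∈ S → Off u → lo ≤ i → i < j → j < l → suc l ≤ hi → u ~ p i → u ~ p j → u ~ p l →
        (∀ {k} → i < k → k < j → ¬ u ~ p k) → (∀ {k} → j < k → k < l → ¬ u ~ p k) → Result
      panFrom {u} {i} {j} {l} u∈ off lo≤ ij jl l≤ ui uj ul f g′ with segCycle off ij jN ui uj f | segCycle off jl lN uj ul g′ | suc j ℕ.≟ l
        where
        lN = proj₁ (inRun (≤-trans lo≤ (<⇒≤ (<-trans ij jl))) (<⇒≤ l≤))
        jN = <-trans jl lN
      ... | P , c , _ , mem | _ | no ne = at c (λ { (here refl) → u∈ ; (there m) → let (t , a , b , e) = mem m in subst (_∈ S) (sym e) (proj₂ (inRun (≤-trans lo≤ a) (≤-trans b (<⇒≤ (<-trans jl l≤))))) }) l∈ (~-sym ul)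
          (λ { (here e) → off l lN (sym e) ; (there m) → let (t , a , b , e) = mem m in p≢ (≤-<-trans b jl) lN e })
          (λ m r → let (t , a , b , e) = mem m in far (≤-<-trans (s≤s b) (≤∧≢⇒< jl ne)) lN (~-sym (subst (p l ~_) e r)))
        where
        lN = proj₁ (inRun (≤-trans lo≤ (<⇒≤ (<-trans ij jl))) (<⇒≤ l≤))
        l∈ = proj₂ (inRun (≤-trans lo≤ (<⇒≤ (<-trans ij jl))) (<⇒≤ l≤))
      ... | P , c , _ , mem | P′ , c′ , _ , mem′ | yes refl with suc i ℕ.≟ j | u ~? p (suc l)
      ...   | no ne | _ = at c′ (λ { (here refl) → u∈ ; (there m) → let (t , a , b , e) = mem′ m in subst (_∈ S) (sym e) (proj₂ (inRun (≤-trans lo≤ (≤-trans (<⇒≤ ij) a)) (≤-trans b (<⇒≤ l≤)))) }) (proj₂ (inRun lo≤ (<⇒≤ (<-trans ij (<-trans jl l≤))))) (~-sym ui)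
          (λ { (here e) → off i (<-trans ij (<-trans jl lN)) (sym e) ; (there m) → let (t , a , b , e) = mem′ m in p≢ (<-≤-trans ij a) (≤-<-trans b lN) (sym e) })
          (λ m r → let (t , a , b , e) = mem′ m in far (<-≤-trans (≤∧≢⇒< ij ne) a) (≤-<-trans b lN) (subst (p i ~_) e r))
        where
        lN = proj₁ (inRun (≤-trans lo≤ (<⇒≤ (<-trans ij jl))) (<⇒≤ l≤))
      ...   | yes refl | yes ul+ = at c (λ { (here refl) → u∈ ; (there m) → let (t , a , b , e) = mem m in subst (_∈ S) (sym e) (proj₂ (inRun (≤-trans lo≤ a) (≤-trans b (<⇒≤ (<-trans jl l≤))))) }) (proj₂ R) (~-sym ul+)
          (λ { (here e) → off (suc l) (proj₁ R) (sym e) ; (there m) → let (t , a , b , e) = mem m in p≢ (≤-<-trans b (<-trans jl (n<1+n l))) (proj₁ R) e })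
          (λ m r → let (t , a , b , e) = mem m in far (≤-<-trans (s≤s b) (n<1+n l)) (proj₁ R) (~-sym (subst (p (suc l) ~_) e r)))
        where R = inRun (≤-trans lo≤ (<⇒≤ (<-trans ij (<-trans jl (n<1+n l))))) l≤
      ...   | yes refl | no ul+ = at {a = p l} {p j ∷ u ∷ []} record
              { ip = cons (~-sym uj) [ u ] (λ ()) ; a~x = ~-sym (next lN) ; a~y = ~-sym ul ; x≢y = λ e → off j (<-trans jl lN) (sym e)
              ; a∉ = λ { (here e) → p≢ jl lN e ; (there (here e)) → off l lN (sym e) } ; inner = λ { (here e) _ → inj₁ e ; (there (here e)) _ → inj₂ e } }
              (λ { (here refl) → proj₂ (inRun (≤-trans lo≤ (<⇒≤ (<-trans ij jl))) (<⇒≤ l≤)) ; (there (here refl)) → proj₂ (inRun (≤-trans lo≤ (<⇒≤ ij)) (<⇒≤ (<-trans jl l≤))) ; (there (there (here refl))) → u∈ })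
              (proj₂ R) (~-sym (next (proj₁ R)))
              (λ { (here e) → p≢ (n<1+n l) (proj₁ R) e ; (there (here e)) → p≢ (<-trans jl (n<1+n l)) (proj₁ R) e ; (there (there (here e))) → off (suc l) (proj₁ R) (sym e) })
              (λ { (here refl) r → far (n<1+n l) (proj₁ R) (~-sym r) ; (there (here refl)) r → ul+ (~-sym r) })
        where
        lN = proj₁ (inRun (≤-trans lo≤ (<⇒≤ (<-trans ij jl))) (<⇒≤ l≤))
        R = inRun (≤-trans lo≤ (<⇒≤ (<-trans ij (<-trans jl (n<1+n l))))) l≤

      few : ∀ {u} → u ∈ S → Few lo hi u ⊎ Result
      few {u} u∈ with on? u
      ... | inj₁ (s , lt , refl) = inj₁ (few-on (<⇒≤ (proj₁ (inRun (m≤m+n lo 26) ≤-refl))) lt)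
      ... | inj₂ off with first (λ t → u ~? p t) lo 26
      ...   | inj₂ none = inj₁ ([] , z≤n , λ { a b (inj₁ e) → ⊥-elim (off _ (proj₁ (inRun a (<⇒≤ b))) e) ; a b (inj₂ r) → ⊥-elim (none a b r) })
      ...   | inj₁ (i , lo≤ , i< , ui , f₁) with first (λ t → u ~? p t) (suc i) (hi ∸ suc i)
      ...     | inj₂ none = inj₁ (i ∷ [] , s≤s z≤n , h)
        where
        h : ∀ {t} → lo ≤ t → t < hi → Near u t → t ∈ i ∷ []
        h a b (inj₁ e) = ⊥-elim (off _ (proj₁ (inRun a (<⇒≤ b))) e)
        h {t} a b (inj₂ r) with i ℕ.≟ t
        ... | yes refl = here refl
        ... | no ne with t <? i
        ...   | yes lt = ⊥-elim (f₁ a lt r)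
        ...   | no ge = ⊥-elim (none (≤∧≢⇒< (≮⇒≥ ge) ne) (≤-trans b (≤-reflexive (sym (m+[n∸m]≡n i<)))) r)
      ...     | inj₁ (j , i<j , j< , uj , f₂) with first (λ t → u ~? p t) (suc j) (hi ∸ suc j)
      ...       | inj₁ (l , j<l , l< , ul , f₃) = inj₂ (panFrom u∈ off lo≤ i<j j<l (≤-trans l< (≤-reflexive (m+[n∸m]≡n (≤-trans j< (≤-reflexive (m+[n∸m]≡n i<)))))) ui uj ul f₂ f₃)
      ...       | inj₂ none = inj₁ (i ∷ j ∷ [] , s≤s (s≤s z≤n) , h)
        where
        h : ∀ {t} → lo ≤ t → t < hi → Near u t → t ∈ i ∷ j ∷ []
        h a b (inj₁ e) = ⊥-elim (off _ (proj₁ (inRun a (<⇒≤ b))) e)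
        h {t} a b (inj₂ r) with i ℕ.≟ t | j ℕ.≟ t
        ... | yes refl | _ = here refl
        ... | _ | yes refl = there (here refl)
        ... | no ne | no ne′ with t <? i | t <? j
        ...   | yes lt | _ = ⊥-elim (f₁ a lt r)
        ...   | no ge | yes lt = ⊥-elim (f₂ (≤∧≢⇒< (≮⇒≥ ge) ne) lt r)
        ...   | no _ | no ge = ⊥-elim (none (≤∧≢⇒< (≮⇒≥ ge) ne′) (≤-trans b (≤-reflexive (sym (m+[n∸m]≡n (≤-trans j< (≤-reflexive (m+[n∸m]≡n i<))))))) r)

      fewAll : ∀ us → us ⊆ S → All (Few lo hi) us ⊎ Result
      fewAll [] _ = inj₁ []
      fewAll (u ∷ us) s with few (s (here refl)) | fewAll us (λ m → s (there m))
      ... | inj₂ o | _ = inj₂ o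
      ... | _ | inj₂ o = inj₂ o
      ... | inj₁ f | inj₁ fs = inj₁ (f ∷ fs)

      -- Some vertex of the run is far from the cycle; the walk from it to the cycle yields the tail.
      smallCycle : ∀ {a P} → ICycle a P → (a ∷ P) ⊆ S → length P ≤ 3 → Result
      smallCycle {a} {P} c C⊆ le with fewAll (a ∷ P) C⊆
      ... | inj₂ o = o
      ... | inj₁ fs with awayPair 13 (a ∷ P) fs (s≤s (*-monoˡ-≤ 3 (s≤s le))) ≤-refl
        where open import Data.Nat.Properties using (*-monoˡ-≤)
      ...   | t , lo≤ , t< , away = go (enterNear (nearC? (a ∷ P)) (two-connected {e₀} (proj₂ R) (C⊆ (here refl)) t≢ a≢) notNear (inj₁ (here refl)))
        where
        R = inRun lo≤ (<⇒≤ (<-trans (n<1+n t) t<))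
        e₀ = ICycle.x c
        x∈ = head∈ (ipath⇒path (ICycle.ip c))
        a≢ : a ≢ e₀
        a≢ = ~⇒≢ (ICycle.a~x c)
        t≢ : p t ≢ e₀
        t≢ e = proj₁ (away (there x∈)) (inj₁ (sym e))
        notNear : ¬ NearC (a ∷ P) (p t)
        notNear (inj₁ m) = proj₁ (away m) (inj₁ refl)
        notNear (inj₂ an) = let (v , v∈ , r) = find an in proj₁ (away v∈) (inj₂ (~-sym r))
        go : _ → Result
        go (z , w , re , zw , inj₁ w∈ , _) = ⊥-elim (proj₂ (reach-end re) (inj₂ (lose w∈ zw)))
        go (z , w , re , zw , inj₂ tw , w∈S , _) with w ∈? a ∷ P
        ... | yes w∈ = ⊥-elim (proj₂ (reach-end re) (inj₂ (lose w∈ zw)))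
        ... | no w∉ with onCycle c tw
        ...   | one c′ s s′ _ ww f = at c′ (λ m → C⊆ (s m)) w∈S ww (λ m → w∉ (s m)) f
        ...   | two c′ s _ ww b∈ wb with through c′ (λ m → w∉ (s m)) ww b∈ wb
        ...     | Q , c″ , s″ , _ = at c″ (λ { (here refl) → w∈S ; (there m) → C⊆ (s (s″ m)) }) (proj₁ (proj₁ (reach-end re))) zw
                  (λ { (here refl) → ~-irrefl zw ; (there m) → proj₂ (reach-end re) (inj₁ (s (s″ m))) }) (λ m r → proj₂ (reach-end re) (inj₂ (lose (s (s″ m)) r)))

      fromCycle : ∀ bound {a P} → ICycle a P → (a ∷ P) ⊆ S → length P ≤ bound → Result
      fromCycle bound {a} {P} c C⊆ le with 4 ≤? length P
      ... | no n = smallCycle c C⊆ (≤-pred (≰⇒> n))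
      fromCycle zero c C⊆ le | yes 4≤ with ≤-trans 4≤ le
      ... | ()
      fromCycle (suc bound) {a} {P} c C⊆ le | yes 4≤ with outside c C⊆ g
      ... | z , w , z∈ , z∉ , zw , w∈ with onCycle c (lose w∈ zw)
      ...   | one c′ s _ _ zw′ f = at c′ (λ m → C⊆ (s m)) z∈ zw′ (λ m → z∉ (s m)) f
      ...   | two c′ s len zw′ b∈ zb with through c′ (λ m → z∉ (s m)) zw′ b∈ zb
      ...     | Q , c″ , s″ , sh = fromCycle bound c″ (λ { (here refl) → z∈ ; (there m) → C⊆ (s (s″ m)) })
                  (≤-pred (≤-trans (sh (subst (4 ≤_) (sym len) 4≤)) (≤-trans (≤-reflexive len) le)))

      result : Result
      result = let (a , P , c , s) = someCycle g in fromCycle (length P) c s ≤-refl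

    open Packing pan1 (graphSpine isPan1) (s≤s (s≤s z≤n)) using (Avoids; Choice; none; big)
    open Search pan1 G

    choose : ∀ X → Choice 0 2 30 X
    choose X with searchObject (all? (λ v → ¬? (v ∈? X)))
    ... | no ne = none (λ {c} a → ne (c , All.tabulate a))
    ... | yes (c , al) = big c (λ m → All.lookup al m) path (x ∷ y ∷ []) [] (s≤s (s≤s z≤n)) (λ m → split (image⊆ m)) verts⊆ (λ _ ()) (λ _ _ _ ()) (λ g _ → In.result g)
      where
      open ObjectPath (objectPath (s≤s (s≤s z≤n)) (graphSpine isPan1) c)
      verts⊆ : verts ⊆ image c
      verts⊆ m with ∈-applyUpTo⁻ p m
      ... | i , lt , refl = p∈ lt

  -- The 2-pan

  module Pan2 where

    open Objects pan2 G
    open Packing pan2 (graphSpine isPan2) (s≤s (s≤s z≤n)) using (Avoids; Choice; none; small; big; connected)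
    open Search pan2 G

    look : ∀ {w l e} → IPath w l e → w ≢ e → w ~ e ⊎ ∃ λ h → ∃ λ k → h ∈ l × k ∈ l × w ~ h × h ~ k × ¬ w ~ k × w ≢ k
    look [ _ ] ne = ⊥-elim (ne refl)
    look (cons r [ _ ] _) _ = inj₁ r
    look (cons r (cons r′ _ _) f) _ = inj₂ (_ , _ , there (here refl) , there (there (here refl)) , r , r′ , f (here refl))

    module Approaching (Pt : IndPath) where

      open OnPath Pt

      Free : List V → List V → V → Set
      Free S C v = v ∈ S × ¬ NearC C v

      Approach : List V → List V → ℕ → Set
      Approach S C t = ∃ λ w → w ∈ S × Touches w C × w ∉ C ×
        ((w ~ p t × w ~ p (suc t)) ⊎ ∃ λ h → ∃ λ k → Free S C h × Free S C k × w ~ h × h ~ k × ¬ w ~ k × w ≢ k)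

      far-off : ∀ {C t} → (∀ {u} → u ∈ C → ¬ Near u t) → ¬ NearC C (p t)
      far-off aw (inj₁ m) = aw m (inj₁ refl)
      far-off aw (inj₂ an) = let (v , v∈ , r) = find an in aw v∈ (inj₂ (~-sym r))

      -- One far vertex p t is not enough: w could be adjacent to it, a tail of one edge. With two
      -- consecutive vertices, either w is adjacent to both, which makes it dense, or an induced
      -- path from w to one of them starts with the two steps of a tail.
      approach : ∀ {S t a} C → GReach (_∈ S) (p t) a → a ∈ C → ¬ NearC C (p t) → ¬ NearC C (p (suc t)) → p (suc t) ∈ S → suc t < N → Approach S C t
      approach {S} {t} C walk a∈ n₀ n₁ p₁∈ lt with enterNear (nearC? C) walk n₀ (inj₁ a∈)
      ... | z , w , re , zw , inj₁ w∈ , _ = ⊥-elim (proj₂ (reach-end re) (inj₂ (lose w∈ zw)))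
      ... | z , w , re , zw , inj₂ tw , w∈S = w , w∈S , tw , w∉ , finish
        where
        w∉ : w ∉ C
        w∉ w∈ = proj₂ (reach-end re) (inj₂ (lose w∈ zw))
        w≢ : ∀ {v} → Free S C v → w ≢ v
        w≢ fr refl = proj₂ fr (inj₂ tw)
        pl = reach⇒path (reach-sym ~-sym re)
        l = proj₁ pl
        free₁ : ∀ {v} → v ∈ w ∷ l → w ≢ v → Free S C v
        free₁ (here e) ne = ⊥-elim (ne (sym e))
        free₁ (there m) _ = proj₂ (proj₂ pl) m
        free₂ : ∀ {v} → v ∈ w ∷ l ++ p (suc t) ∷ [] → w ≢ v → Free S C v
        free₂ (here e) ne = ⊥-elim (ne (sym e))
        free₂ (there m) ne with ∈-++⁻ l m
        ... | inj₁ k = proj₂ (proj₂ pl) k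
        ... | inj₂ (here refl) = p₁∈ , n₁
        i₁ = induce (~-sym zw ∷ proj₁ (proj₂ pl))
        i₂ = induce (~-sym zw ∷ ++-path (proj₁ (proj₂ pl)) (next lt) [ p (suc t) ])
        finish : (w ~ p t × w ~ p (suc t)) ⊎ ∃ λ h → ∃ λ k → Free S C h × Free S C k × w ~ h × h ~ k × ¬ w ~ k × w ≢ k
        finish with look (proj₁ (proj₂ i₁)) (w≢ (reach-start re)) | look (proj₁ (proj₂ i₂)) (w≢ (p₁∈ , n₁))
        ... | inj₁ r | inj₁ r′ = inj₁ (r , r′)
        ... | inj₂ (h , k , h∈ , k∈ , wh , hk , wk , w≢k) | _ =
          inj₂ (h , k , free₁ (proj₁ (proj₂ (proj₂ i₁)) h∈) (~⇒≢ wh) , free₁ (proj₁ (proj₂ (proj₂ i₁)) k∈) w≢k , wh , hk , wk , w≢k)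
        ... | inj₁ _ | inj₂ (h , k , h∈ , k∈ , wh , hk , wk , w≢k) =
          inj₂ (h , k , free₂ (proj₁ (proj₂ (proj₂ i₂)) h∈) (~⇒≢ wh) , free₂ (proj₁ (proj₂ (proj₂ i₂)) k∈) w≢k , wh , hk , wk , w≢k)

    -- If at least three vertices follow b, the arc before b is short enough even with z₂. Otherwise
    -- the other arc has at most four vertices, five with z₂, fewer than the six of P; this is the
    -- origin of the bound 6.
    detour : ∀ {z z₂ w P b} → ICycle w P → z ∉ w ∷ P → z ~ w → z ~ z₂ → z₂ ∉ w ∷ P → b ∈ P → z₂ ~ b → 6 ≤ length P →
      Σ (List V) λ Q → ICycle z Q × (∀ {v} → v ∈ Q → v ∈ w ∷ P ⊎ v ≡ z₂) × suc (length Q) ≤ length P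
    detour {z} {z₂} {w} {P} {b} cy z∉ zw zz₂ z₂∉ b∈ z₂b 6≤ with ∈-∃++ b∈
    ... | pre , post , refl with 3 ≤? length post
    ...   | yes 3≤ = let (Q , c′ , s , le) = closeCycle z (++-path (arc₁ pre cy) (~-sym z₂b) [ z₂ ]) (λ m → no-z (s₁ m)) zw zz₂ (λ e → z₂∉ (here (sym e))) in
                 Q , c′ , (λ m → s₁ (s m)) , ≤-trans (≤-trans (s≤s le) (≤-reflexive len)) (≤-trans (+-monoʳ-≤ (length pre) (s≤s 3≤)) (≤-reflexive (sym (length-++ pre))))
      where
      s₁ : ∀ {v} → v ∈ (w ∷ pre ++ b ∷ []) ++ z₂ ∷ [] → v ∈ w ∷ pre ++ b ∷ post ⊎ v ≡ z₂
      s₁ m with ∈-++⁻ (w ∷ pre ++ b ∷ []) m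
      ... | inj₂ (here e) = inj₂ e
      ... | inj₁ (here e) = inj₁ (here e)
      ... | inj₁ (there k) with ∈-++⁻ pre k
      ...   | inj₁ j = inj₁ (there (∈-++⁺ˡ j))
      ...   | inj₂ (here e) = inj₁ (there (∈-++⁺ʳ pre (here e)))
      no-z : z ∈ w ∷ pre ++ b ∷ post ⊎ z ≡ z₂ → ⊥
      no-z (inj₁ m) = z∉ m
      no-z (inj₂ e) = ~⇒≢ zz₂ e
      len : suc (length ((w ∷ pre ++ b ∷ []) ++ z₂ ∷ [])) ≡ length pre + 4
      len = trans (cong suc (length-++ (w ∷ pre ++ b ∷ []))) (trans (cong (λ k → suc (suc (k + 1))) (length-++ pre)) (eq (length pre)))
        where
        open import Data.Nat.Tactic.RingSolver using (solve-∀)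
        eq : ∀ k → suc (suc (k + 1 + 1)) ≡ k + 4
        eq = solve-∀
    ...   | no ≱ = let (Q , c′ , s , le) = closeCycle z (z₂b ∷ arc₂ pre cy) (λ m → no-z (s₂ m)) zz₂ zw (λ e → z₂∉ (here e)) in
                 Q , c′ , (λ m → s₂ (s m)) , ≤-trans (s≤s (≤-trans le (≤-trans (≤-reflexive (cong (λ k → suc (suc k)) (trans (length-++ post) (+-comm (length post) 1)))) (s≤s (s≤s (≰⇒> ≱)))))) 6≤
      where
      s₂ : ∀ {v} → v ∈ z₂ ∷ b ∷ post ++ w ∷ [] → v ∈ w ∷ pre ++ b ∷ post ⊎ v ≡ z₂
      s₂ (here e) = inj₂ e
      s₂ (there (here e)) = inj₁ (there (∈-++⁺ʳ pre (here e)))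
      s₂ (there (there m)) with ∈-++⁻ post m
      ... | inj₁ k = inj₁ (there (∈-++⁺ʳ pre (there k)))
      ... | inj₂ (here e) = inj₁ (here e)
      no-z : z ∈ w ∷ pre ++ b ∷ post ⊎ z ≡ z₂ → ⊥
      no-z (inj₁ m) = z∉ m
      no-z (inj₂ e) = ~⇒≢ zz₂ e

    Shorter : List V → List V → Set
    Shorter S P = ∃ λ a → Σ (List V) λ Q → ICycle a Q × (a ∷ Q) ⊆ S × suc (length Q) ≤ length P

    PanIn : List V → Set
    PanIn S = Σ (InducedSubdiv pan2 G) λ o → image o ⊆ S

    -- The second neighbour z₂ of z prolongs the tail unless it touches the cycle. Then there is a
    -- shorter cycle: a detour if it touches P, a triangle if it is adjacent to w.
    escape : ∀ {S z z₂ w P} → ICycle w P → (w ∷ P) ⊆ S → 6 ≤ length P → z ∈ S → z ∉ w ∷ P → z ~ w → (∀ {u} → u ∈ P → ¬ z ~ u) →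
      z₂ ∈ S → z ~ z₂ → z₂ ≢ w → PanIn S ⊎ Shorter S P
    escape {S} {z} {z₂} {w} {P} cy C⊆ 6≤ z∈ z∉ zw f z₂∈ zz₂ z₂≢w = go (any? (z₂ ~?_) P) (z₂ ~? w)
      where
      z₂∉ : z₂ ∉ w ∷ P
      z₂∉ (here e) = z₂≢w e
      z₂∉ (there m) = f m zz₂
      inS : ∀ {v} → v ∈ z ∷ z₂ ∷ w ∷ P → v ∈ S
      inS (here refl) = z∈
      inS (there (here refl)) = z₂∈
      inS (there (there m)) = C⊆ m
      go : Dec (Touches z₂ P) → Dec (z₂ ~ w) → PanIn S ⊎ Shorter S P
      go (yes t) _ = let (b , b∈ , z₂b) = find t ; (Q , c′ , s , lt) = detour cy z∉ zw zz₂ z₂∉ b∈ z₂b 6≤ in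
        inj₂ (z , Q , c′ , (λ { (here e) → inS (here e) ; (there m) → Sum.[ (λ k → C⊆ k) , (λ e → inS (there (here e))) ] (s m) }) , lt)
      go (no _) (yes z₂w) = let (Q , c′ , s , le) = closeCycle z (~-sym z₂w ∷ [ z₂ ]) (λ { (here e) → z∉ (here e) ; (there (here e)) → ~⇒≢ zz₂ e }) zw zz₂ (λ e → z₂≢w (sym e)) in
        inj₂ (z , Q , c′ , (λ { (here e) → inS (here e) ; (there m) → tri (s m) }) , ≤-trans (s≤s le) (≤-trans (toWitness {a? = 3 ≤? 6} _) 6≤))
        where
        tri : ∀ {v} → v ∈ w ∷ z₂ ∷ [] → v ∈ S
        tri (here e) = C⊆ (here e)
        tri (there (here e)) = inS (there (here e))
      go (no nt) (no nw) = inj₁ (proj₁ o , λ m → inS (proj₂ o m))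
        where
        o = pan2At cy zw z∉ f (~-sym zz₂) z₂∉ λ { (here refl) e → nw e ; (there m) e → nt (lose m e) }

    progress : ∀ {S a P Pt r} → Good Pt r S → ICycle a P → (a ∷ P) ⊆ S → 6 ≤ length P → PanIn S ⊎ Shorter S P
    progress {S} {a} {P} g cy C⊆ 6≤ with outside cy C⊆ g
    ... | z , w , z∈ , z∉ , zw , w∈ = go (onCycle cy (lose w∈ zw))
      where
      longer : ∀ P′ → length P′ ≡ length P → PanIn S ⊎ Shorter S P′ → PanIn S ⊎ Shorter S P
      longer P′ e = Sum.map₂ λ { (b , Q , c′ , s , lt) → b , Q , c′ , s , ≤-trans lt (≤-reflexive e) }
      go : OnCycle z a P → PanIn S ⊎ Shorter S P
      go (two c′ s len zw′ b∈ zb) = let (Q , c″ , s″ , sh) = through c′ (λ m → z∉ (s m)) zw′ b∈ zb in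
        inj₂ (z , Q , c″ , (λ { (here refl) → z∈ ; (there m) → C⊆ (s (s″ m)) }) ,
              ≤-trans (sh (≤-trans (toWitness {a? = 4 ≤? 6} _) (≤-trans 6≤ (≤-reflexive (sym len))))) (≤-reflexive len))
      -- Without w′, its only neighbour on the cycle, z still reaches the cycle, so it has a further
      -- neighbour in S.
      go (one {w′} {P′} c′ s _ len zw′ f) = second (Good.two-connected g {w′} z∈ (C⊆ (s (there x∈))) (~⇒≢ zw′) (λ e → ~⇒≢ (ICycle.a~x c′) (sym e)))
        where
        x∈ : ICycle.x c′ ∈ P′
        x∈ = head∈ (ipath⇒path (ICycle.ip c′))
        second : GReach (Minus (_∈ S) w′) z (ICycle.x c′) → PanIn S ⊎ Shorter S P
        second (stop _) = ⊥-elim (z∉ (s (there x∈)))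
        second (step _ zz₂ r) = longer P′ len (escape c′ (λ m → C⊆ (s m)) (≤-trans 6≤ (≤-reflexive (sym len))) z∈ (λ m → z∉ (s m)) zw′ f (proj₁ (reach-start r)) zz₂ (proj₂ (reach-start r)))

    -- The bound 60 leaves room for the 2-pans on gaps of length at most 40 that refute
    -- vertices with two close neighbours; 40 in turn exceeds the 38 indices inspected in runAway.
    module Avoiding (X : List V) (nosmall : ∀ {o} → Avoids X o → ¬ length (image o) ≤ 60) where

      -- The base and the two tail vertices are added to the at most 57 vertices of P, which makes
      -- 60.
      tiny : ∀ {a P v w} → ICycle a P → v ~ a → v ∉ a ∷ P → (∀ {u} → u ∈ P → ¬ v ~ u) → w ~ v → w ∉ a ∷ P → (∀ {u} → u ∈ a ∷ P → ¬ w ~ u) →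
        length P ≤ 57 → (∀ {u} → u ∈ a ∷ P → u ∉ X) → v ∉ X → w ∉ X → ⊥
      tiny {a} {P} {v} {w} c va v∉ f wv w∉ g le cl vX wX with pan2At c va v∉ f wv w∉ g
      ... | o , s = nosmall {o} (λ m → clean (s m)) (≤-trans (card (image-unique o) (λ m → s m)) (s≤s (s≤s (s≤s le))))
        where
        clean : ∀ {u} → u ∈ v ∷ w ∷ a ∷ P → u ∉ X
        clean (here refl) = vX
        clean (there (here refl)) = wX
        clean (there (there m)) = cl m

      triTiny : ∀ {z r s v w} → r ~ s → z ~ r → z ~ s → v ~ z → ¬ v ~ r → ¬ v ~ s → v ≢ r → v ≢ s → w ~ v → ¬ w ~ z → ¬ w ~ r → ¬ w ~ s → w ≢ z → w ≢ r → w ≢ s →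
        z ∉ X → r ∉ X → s ∉ X → v ∉ X → w ∉ X → ⊥
      triTiny {z} {r} {s} rs zr zs vz vr vs v≢r v≢s wv wz wr ws w≢z w≢r w≢s zX rX sX vX wX = tiny {z} {r ∷ s ∷ []}
        record { ip = cons rs [ s ] (λ ()) ; a~x = zr ; a~y = zs ; x≢y = ~⇒≢ rs ; a∉ = λ { (here e) → ~⇒≢ zr e ; (there (here e)) → ~⇒≢ zs e }
               ; inner = λ { (here e) _ → inj₁ e ; (there (here e)) _ → inj₂ e } }
        vz (λ { (here e) → ~⇒≢ vz e ; (there (here e)) → v≢r e ; (there (there (here e))) → v≢s e })
        (λ { (here refl) → vr ; (there (here refl)) → vs }) wv
        (λ { (here e) → w≢z e ; (there (here e)) → w≢r e ; (there (there (here e))) → w≢s e })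
        (λ { (here refl) → wz ; (there (here refl)) → wr ; (there (there (here refl))) → ws })
        (s≤s (s≤s z≤n)) (λ { (here refl) → zX ; (there (here refl)) → rX ; (there (there (here refl))) → sX }) vX wX

      -- If w has one neighbour on the cycle, the tail is w, h. If it has more, w lies on a new
      -- cycle and the tail is h, k.
      smallTiny : ∀ {a P w h k} → ICycle a P → length P ≤ 5 → (∀ {u} → u ∈ a ∷ P → u ∉ X) → w ∉ X → h ∉ X → k ∉ X →
        Touches w (a ∷ P) → w ∉ a ∷ P → ¬ NearC (a ∷ P) h → ¬ NearC (a ∷ P) k → w ~ h → h ~ k → ¬ w ~ k → w ≢ k → ⊥
      smallTiny cy le cl wX hX kX tw w∉ hC kC wh hk wk w≢k with onCycle cy tw
      ... | one c′ s _ len ww f = tiny c′ ww (λ m → w∉ (s m)) f (~-sym wh) (λ m → hC (inj₁ (s m))) (λ m r → hC (inj₂ (lose (s m) r)))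
            (≤-trans (≤-reflexive len) (≤-trans le (toWitness {a? = 5 ≤? 57} _))) (λ m → cl (s m)) wX hX
      ... | two c′ s len ww b∈ wb with through c′ (λ m → w∉ (s m)) ww b∈ wb
      ...   | Q , c″ , s″ , _ = tiny c″ (~-sym wh) (λ { (here refl) → ~-irrefl wh ; (there m) → hC (inj₁ (s (s″ m))) }) (λ m r → hC (inj₂ (lose (s (s″ m)) r)))
            (~-sym hk) (λ { (here e) → w≢k (sym e) ; (there m) → kC (inj₁ (s (s″ m))) }) (λ { (here refl) r → wk (~-sym r) ; (there m) r → kC (inj₂ (lose (s (s″ m)) r)) })
            (≤-trans (card (ipath-unique (ICycle.ip c″)) (λ m → s (s″ m))) (≤-trans (s≤s le) (toWitness {a? = 6 ≤? 57} _)))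
            (λ { (here refl) → wX ; (there m) → cl (s (s″ m)) }) hX kX

      module Right (Pt : IndPath) (clean : ∀ {t} → t < IndPath.N Pt → IndPath.p Pt t ∉ X) where

        open OnPath Pt

        Away : ℕ → ℕ → Set
        Away t s = suc t < s ⊎ suc s < t

        away≁ : ∀ {t s} → t < N → s < N → Away t s → ¬ p t ~ p s
        away≁ tN sN (inj₁ lt) = far lt sN
        away≁ tN sN (inj₂ lt) e = far lt tN (~-sym e)

        away≢ : ∀ {t s} → t < N → s < N → Away t s → p t ≢ p s
        away≢ tN sN (inj₁ lt) e = p≢ (<-trans (n<1+n _) lt) sN (sym e)
        away≢ tN sN (inj₂ lt) e = p≢ (<-trans (n<1+n _) lt) tN e

        segTiny : ∀ {u i j s s′} → u ∉ X → Off u → i < j → j < N → j ∸ i ≤ 40 → u ~ p i → u ~ p j → (∀ {k} → i < k → k < j → ¬ u ~ p k) →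
          s < N → s′ < N → u ~ p s → ¬ u ~ p s′ → p s′ ~ p s → (∀ {t} → i ≤ t → t ≤ j → Away t s × Away t s′) → ⊥
        segTiny {u} {s = s} {s′} uX off ij jN le ui uj nb sN s′N us us′ e aw with segCycle off ij jN ui uj nb
        ... | P , c , (len , _) , mem = tiny c (~-sym us)
              (λ { (here e) → off _ sN (sym e) ; (there m) → let (t , a , b , e) = mem m in away≢ (≤-<-trans b jN) sN (proj₁ (aw a b)) (sym e) })
              (λ m r → let (t , a , b , e) = mem m in away≁ (≤-<-trans b jN) sN (proj₁ (aw a b)) (~-sym (subst (p s ~_) e r))) e
              (λ { (here e) → off _ s′N (sym e) ; (there m) → let (t , a , b , e) = mem m in away≢ (≤-<-trans b jN) s′N (proj₂ (aw a b)) (sym e) })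
              (λ { (here refl) r → us′ (~-sym r) ; (there m) r → let (t , a , b , e) = mem m in away≁ (≤-<-trans b jN) s′N (proj₂ (aw a b)) (~-sym (subst (p s′ ~_) e r)) })
              (≤-trans (≤-reflexive len) (≤-trans (s≤s le) (toWitness {a? = 41 ≤? 57} _)))
              (λ { (here refl) → uX ; (there m) → let (t , a , b , e) = mem m in subst (_∉ X) (sym e) (clean (≤-<-trans b jN)) }) (clean sN) (clean s′N)

        -- Let p m be the last neighbour of u before p j. If u misses p (j + 1), its adjacencies to
        -- the next three vertices decide where a small 2-pan is found; hence the path has to
        -- continue up to p (j + 4).
        closeRight : ∀ {u i j} → u ∉ X → Off u → i < j → j ≤ i + 40 → 4 + j < N → u ~ p i → u ~ p j → u ~ p (suc j)
        closeRight {u} {i} {suc j₀} uX off ij le jN ui uj with u ~? p (suc (suc j₀)) | last (λ t → u ~? p t) ij ui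
        ... | yes r | _ = r
        ... | no n₁ | m , im , mj , um , nb = ⊥-elim (go (u ~? p (suc j₁)) (u ~? p (suc (suc j₁))) (u ~? p (suc (suc (suc j₁)))))
          where
          j = suc j₀
          j₁ = suc j
          4N : suc (suc (suc j₁)) < N
          4N = jN
          3N : suc (suc j₁) < N
          3N = <-trans (n<1+n _) 4N
          2N : suc j₁ < N
          2N = <-trans (n<1+n _) 3N
          1N : j₁ < N
          1N = <-trans (n<1+n _) 2N
          jN′ : j < N
          jN′ = <-trans (n<1+n _) 1N
          gap : j ∸ m ≤ 40
          gap = m≤n+o⇒m∸n≤o j m (≤-trans le (+-monoˡ-≤ 40 im))
          unit-gap : ∀ k → suc k ∸ k ≤ 40
          unit-gap k = m≤n+o⇒m∸n≤o (suc k) k (≤-trans (≤-reflexive (+-comm 1 k)) (+-monoʳ-≤ k (s≤s z≤n)))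
          no-between : ∀ {k l : ℕ} → l < k → k < suc l → ⊥
          no-between a b = <-irrefl refl (<-≤-trans a (≤-pred b))
          go : Dec (u ~ p (suc j₁)) → Dec (u ~ p (suc (suc j₁))) → Dec (u ~ p (suc (suc (suc j₁)))) → ⊥
          -- The tail p (j + 1), p (j + 2) hangs at p j, which is made the base of the cycle.
          go (no n₂) _ _ with segCycle off mj jN′ um uj nb
          ... | P , c , (len , j∈) , mem with rotate c (there j∈)
          ...   | P′ , c′ , s , _ , len′ = tiny c′ (~-sym (next 1N))
                  (λ m → [1 (s m) ]≢) (λ m → [1 (s (there m)) ]≁ λ e → ICycle.a∉ c′ (subst (_∈ P′) e m)) (~-sym (next 2N)) (λ m → [2 (s m) ]≢) (λ m → [2 (s m) ]≁)
                  (≤-trans (≤-reflexive (trans len′ len)) (≤-trans (s≤s gap) (toWitness {a? = 41 ≤? 57} _))) (λ m → cl (s m)) (clean 1N) (clean 2N)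
            where
            cl : ∀ {v} → v ∈ u ∷ P → v ∉ X
            cl (here refl) = uX
            cl (there m) = let (t , a , b , e) = mem m in subst (_∉ X) (sym e) (clean (≤-<-trans b jN′))
            [1_]≢ : p j₁ ∈ u ∷ P → ⊥
            [1 here e ]≢ = off _ 1N (sym e)
            [1 there m ]≢ = let (t , a , b , e) = mem m in p≢ (s≤s b) 1N e
            [2_]≢ : p (suc j₁) ∈ u ∷ P → ⊥
            [2 here e ]≢ = off _ 2N (sym e)
            [2 there m ]≢ = let (t , a , b , e) = mem m in p≢ (s≤s (m≤n⇒m≤1+n b)) 2N e
            [1_]≁ : ∀ {v} → v ∈ u ∷ P → v ≢ p j → ¬ p j₁ ~ v
            [1_]≁ (here refl) _ r = n₁ (~-sym r)
            [1_]≁ (there m) ne r with mem m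
            ... | t , a , b , refl with t ℕ.≟ j
            ...   | yes refl = ne refl
            ...   | no t≢ = far (s≤s (≤∧≢⇒< b t≢)) 1N (~-sym r)
            [2_]≁ : ∀ {v} → v ∈ u ∷ P → ¬ p (suc j₁) ~ v
            [2_]≁ (here refl) r = n₂ (~-sym r)
            [2_]≁ (there m) r = let (t , a , b , e) = mem m in far (s≤s (s≤s b)) 2N (~-sym (subst (p (suc j₁) ~_) e r))
          -- From here on the tail hangs at u. On the cycle through p m and p j it leads to the
          -- right; on a triangle further to the right it is p j followed by p (j - 1) or p (j + 1),
          -- whichever u is known to miss.
          go (yes u₂) (no n₃) _ = segTiny uX off mj jN′ gap um uj nb 2N 3N u₂ n₃ (~-sym (next 3N)) λ _ b → inj₁ (s≤s (s≤s b)) , inj₁ (s≤s (s≤s (m≤n⇒m≤1+n b)))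
          go (yes u₂) (yes u₃) d₄ with m ℕ.≟ j₀ | d₄
          ... | no ne | _ = segTiny uX off (n<1+n _) 3N (unit-gap (suc j₁)) u₂ u₃ (λ a b _ → no-between a b) jN′ (<-trans (n<1+n _) jN′) uj (nb (≤∧≢⇒< (≤-pred mj) ne) (n<1+n _)) (next jN′)
                λ a _ → inj₂ a , inj₂ (<⇒≤ a)
          ... | yes refl | no n₄ = segTiny uX off mj jN′ gap um uj nb 3N 4N u₃ n₄ (~-sym (next 4N)) λ _ b → inj₁ (s≤s (s≤s (m≤n⇒m≤1+n b))) , inj₁ (s≤s (s≤s (m≤n⇒m≤1+n (m≤n⇒m≤1+n b))))
          ... | yes refl | yes u₄ = segTiny uX off (n<1+n _) 4N (unit-gap (suc (suc j₁))) u₃ u₄ (λ a b _ → no-between a b) jN′ 1N uj n₁ (~-sym (next 1N))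
                λ a _ → inj₂ (<⇒≤ a) , inj₂ a

        -- The vertices p j and p (j + 1) are again two close neighbours of u, so `closeRight` can
        -- be repeated.
        rightRun : ∀ {u} → u ∉ X → Off u → ∀ k {i j} → i < j → j ≤ i + 40 → k + (3 + j) < N → u ~ p i → u ~ p j → u ~ p (k + j)
        rightRun uX off zero ij le lt ui uj = uj
        rightRun {u} uX off (suc k) {i} {j} ij le lt ui uj = subst (λ m → u ~ p m) (+-suc k j)
          (rightRun uX off k (n<1+n j) (≤-trans (≤-reflexive (+-comm 1 j)) (+-monoʳ-≤ j (s≤s z≤n))) (≤-trans (s≤s (≤-reflexive (+-suc k (3 + j)))) lt) uj
            (closeRight uX off ij le (≤-<-trans (s≤s (m≤n+m (3 + j) k)) lt) ui uj))

        right : ∀ {u i j t} → u ∉ X → Off u → i < j → j ≤ i + 40 → u ~ p i → u ~ p j → j ≤ t → 3 + t < N → u ~ p t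
        right {u} {i} {j} {t} uX off ij le ui uj jt lt = subst (λ m → u ~ p m) (m∸n+n≡m jt) (rightRun uX off (t ∸ j) ij le (subst (_< N) eq lt) ui uj)
          where
          eq : 3 + t ≡ t ∸ j + (3 + j)
          eq = trans (cong (3 +_) (sym (m∸n+n≡m jt))) (sym (trans (+-suc (t ∸ j) _) (cong suc (trans (+-suc (t ∸ j) _) (cong suc (+-suc (t ∸ j) j))))))

      record LongPath : Set where
        field
          Pt : IndPath
          clean : ∀ {t} → t < IndPath.N Pt → IndPath.p Pt t ∉ X
          59≤N : 59 ≤ IndPath.N Pt

      module Along (long : LongPath) where

        open LongPath long public
        open OnPath Pt public
        private
          module R = Right Pt clean
          module L = Right reversed (λ {t} lt → clean (≤-trans (≤-reflexive (sym (+-∸-assoc 1 lt))) (m∸n≤m N t)))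

        -- This is `right` on the reversed path; `mirror` translates the indices back.
        left : ∀ {u i j t} → u ∉ X → Off u → i < j → j < N → j ≤ i + 40 → u ~ p i → u ~ p j → 3 ≤ t → t ≤ i → u ~ p t
        left {u} {i} {j} {t} uX off ij jN le ui uj 3≤ ti = subst (λ m → u ~ p m) (mirror t<N)
            (L.right uX (λ k lt → off _ (≤-trans (≤-reflexive (sym (+-∸-assoc 1 lt))) (m∸n≤m N k))) (∸-monoʳ-< (s≤s ij) jN) gap
              (subst (λ m → u ~ p m) (sym (mirror jN)) uj) (subst (λ m → u ~ p m) (sym (mirror (<-trans ij jN))) ui) (∸-monoʳ-≤ N (s≤s ti)) bound)
          where
          t<N : t < N
          t<N = ≤-<-trans ti (<-trans ij jN)
          mirror : ∀ {t} → t < N → N ∸ suc (N ∸ suc t) ≡ t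
          mirror {t} lt = trans (cong (N ∸_) (sym (+-∸-assoc 1 lt))) (m∸[m∸n]≡n (<⇒≤ lt))
          gap : N ∸ suc i ≤ N ∸ suc j + 40
          gap = m≤n+o⇒m∸n≤o N (suc i) (≤-trans (≤-reflexive (sym (m∸n+n≡m jN))) (≤-trans (+-monoʳ-≤ (N ∸ suc j) (s≤s le)) (≤-reflexive (eq (N ∸ suc j) i))))
            where
            open import Data.Nat.Tactic.RingSolver using (solve-∀)
            eq : ∀ a i → a + suc (i + 40) ≡ suc i + (a + 40)
            eq = solve-∀
          bound : 3 + (N ∸ suc t) < N
          bound = ≤-trans (s≤s (+-monoˡ-≤ (N ∸ suc t) 3≤)) (≤-reflexive (m+[n∸m]≡n t<N))

        -- The three vertices at either end are exempted, because closeRight needs room to its right.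
        Dense : V → Set
        Dense u = ∀ t → t < N → 3 ≤ t → 3 + t < N → u ~ p t

        dense? : ∀ u → Dec (Dense u)
        dense? u = map′ (λ f t → f {t}) (λ f {t} → f t) (allUpTo? (λ t → (3 ≤? t) →-dec ((3 + t <? N) →-dec (u ~? p t))) N)

        -- Away from the right end, the pair i, j propagates to the right, and j with j + 1 to the
        -- left. Near the right end there is no room for this; then the indices 3 and 4 are reached
        -- from the right first, and they propagate to the right. The length 59 and the gap of at
        -- most 40 leave 4 ≤ i.
        closeDense : ∀ {u i j} → u ∉ X → Off u → i < j → j < N → j ≤ i + 40 → u ~ p i → u ~ p j → Dense u
        closeDense {u} {i} {j} uX off ij jN le ui uj t tN 3≤ lt with 4 + j <? N
        ... | yes 4N with ≤-total t j
        ...   | inj₂ jt = R.right uX off ij le ui uj jt lt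
        ...   | inj₁ tj = left uX off (n<1+n j) (<-trans (s≤s (s≤s (≤-trans (n≤1+n j) (n≤1+n _)))) 4N) (≤-trans (≤-reflexive (+-comm 1 j)) (+-monoʳ-≤ j (s≤s z≤n))) uj (R.closeRight uX off ij le 4N ui uj) 3≤ tj
        closeDense {u} {i} {j} uX off ij jN le ui uj t tN 3≤ lt | no n4 with 4 ℕ.≟ t | 3 ℕ.≟ t
        ... | _ | yes refl = left uX off ij jN le ui uj ≤-refl (≤-trans (n≤1+n 3) 4≤i)
          where
          4≤i : 4 ≤ i
          4≤i = +-cancelˡ-≤ 44 4 i (≤-trans (≤-trans (toWitness {a? = 48 ≤? 59} _) 59≤N) (≤-trans (≮⇒≥ n4) (≤-trans (+-monoʳ-≤ 4 le) (≤-reflexive (cong (4 +_) (+-comm i 40))))))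
        ... | _ | no ne = R.right uX off (n<1+n 3) (toWitness {a? = 4 ≤? 43} _) (left uX off ij jN le ui uj ≤-refl (≤-trans (n≤1+n 3) 4≤i)) (left uX off ij jN le ui uj (n≤1+n 3) 4≤i) (≤∧≢⇒< 3≤ ne) lt
          where
          4≤i : 4 ≤ i
          4≤i = +-cancelˡ-≤ 44 4 i (≤-trans (≤-trans (toWitness {a? = 48 ≤? 59} _) 59≤N) (≤-trans (≮⇒≥ n4) (≤-trans (+-monoʳ-≤ 4 le) (≤-reflexive (cong (4 +_) (+-comm i 40))))))

        -- Two neighbours off by at most 40 would make u dense, so a vertex off P has at most one in
        -- a window of 41 indices.
        few : ∀ {u} → u ∉ X → ¬ Dense u → ∀ lo k → k ≤ 41 → lo + k ≤ N → Few lo (lo + k) u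
        few {u} uX nd lo k k≤ le with on? u
        ... | inj₁ (s , lt , refl) = few-on le lt
        ... | inj₂ off with first (λ t → u ~? p t) lo k
        ...   | inj₂ nil = [] , z≤n , λ { a b (inj₁ e) → ⊥-elim (off _ (<-≤-trans b le) e) ; a b (inj₂ r) → ⊥-elim (nil a b r) }
        ...   | inj₁ (i , lo≤ , i< , ui , f) = i ∷ [] , s≤s z≤n , h
          where
          h : ∀ {t} → lo ≤ t → t < lo + k → Near u t → t ∈ i ∷ []
          h a b (inj₁ e) = ⊥-elim (off _ (<-≤-trans b le) e)
          h {t} a b (inj₂ r) with i ℕ.≟ t
          ... | yes refl = here refl
          ... | no ne with t <? i
          ...   | yes lt = ⊥-elim (f a lt r)
          ...   | no ge = ⊥-elim (nd (closeDense uX off (≤∧≢⇒< (≮⇒≥ ge) ne) (<-≤-trans b le) (≤-pred (≤-trans b (≤-trans (+-monoʳ-≤ lo k≤) (≤-trans (+-monoˡ-≤ 41 lo≤) (≤-reflexive (+-suc i 40)))))) ui r))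

        record Window (t : ℕ) : Set where
          field
            3≤t : 3 ≤ t
            bound : 4 + t < N

          suc<N : suc t < N
          suc<N = <-trans (s≤s (s≤s (≤-trans (n≤1+n t) (n≤1+n _)))) bound

          t<N : t < N
          t<N = <-trans (n<1+n t) suc<N

        onDense : ∀ {u t} → Dense u → Window t → u ~ p t
        onDense d w = d _ t<N 3≤t (<-trans (n<1+n _) bound)
          where open Window w

        onDense′ : ∀ {u t} → Dense u → Window t → u ~ p (suc t)
        onDense′ d w = d _ suc<N (m≤n⇒m≤1+n 3≤t) bound
          where open Window w

        EdgeAway : V → V → Set
        EdgeAway u v = ∃ λ t → Window t × ¬ Near u t × ¬ Near u (suc t) × ¬ Near v t × ¬ Near v (suc t)

        edgeAway : ∀ {u v} → u ∉ X → v ∉ X → ¬ Dense u → ¬ Dense v → EdgeAway u v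
        edgeAway {u} {v} uX vX nu nv =
          -- Two vertices rule out at most six indices, so seven pairs suffice; they start at 3, the
          -- first index that density speaks of.
          let (t , a , b , f) = awayPair 7 (u ∷ v ∷ []) (few uX nu 3 14 14≤ 17≤ ∷ few vX nv 3 14 14≤ 17≤ ∷ []) ≤-refl ≤-refl in
          t , record { 3≤t = a ; bound = ≤-trans (+-monoʳ-≤ 3 b) (≤-trans (toWitness {a? = 20 ≤? 59} _) 59≤N) } ,
          proj₁ (f (here refl)) , proj₂ (f (here refl)) , proj₁ (f (there (here refl))) , proj₂ (f (there (here refl)))
          where
          14≤ : 14 ≤ 41
          14≤ = toWitness {a? = 14 ≤? 41} _
          17≤ : 17 ≤ N
          17≤ = ≤-trans (toWitness {a? = 17 ≤? 59} _) 59≤N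

      -- An object avoiding X has at least 61 vertices, which leaves 59 without the ends of its
      -- spine.
      record LongObject (c : InducedSubdiv pan2 G) : Set where
        field
          av : Avoids X c
          op : ObjectPath c
          long : 59 ≤ ObjectPath.N op

      abstract
        longObject : ∀ c → Avoids X c → LongObject c
        longObject c av = record { av = av ; op = op ; long =
            ≤-pred (≤-pred (≤-trans (≰⇒> (λ le → nosmall {c} av (≤-trans (≤-reflexive (length-tabulate (φ (emb c)))) le))) (≤-reflexive (ObjectPath.size op)))) }
          where
          op : ObjectPath c
          op = objectPath (s≤s (s≤s z≤n)) (graphSpine isPan2) c

      longPath : ∀ {c} → LongObject c → LongPath
      longPath L = record { Pt = ObjectPath.path op ; clean = λ lt → av (ObjectPath.p∈ op lt) ; 59≤N = long }
        where open LongObject L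

      module OfObject {c : InducedSubdiv pan2 G} (L : LongObject c) where

        open LongObject L public using (av; op)
        open ObjectPath op public using (path; x; y; a; b; image⊆; split; near-x; near-y; p∈)
        open Along (longPath L) public

        <N : ∀ {k} → k ≤ 58 → k < N
        <N le = ≤-trans (s≤s le) 59≤N

        at3 : ∀ {u} → Dense u → u ~ p 3
        at3 d = d 3 (<N (toWitness {a? = 3 ≤? 58} _)) ≤-refl (<N (toWitness {a? = 6 ≤? 58} _))

        at4 : ∀ {u} → Dense u → u ~ p 4
        at4 d = d 4 (<N (toWitness {a? = 4 ≤? 58} _)) (n≤1+n 3) (<N (toWitness {a? = 7 ≤? 58} _))

        at10 : ∀ {u} → Dense u → u ~ p 10
        at10 d = d 10 (<N (toWitness {a? = 10 ≤? 58} _)) (toWitness {a? = 3 ≤? 10} _) (<N (toWitness {a? = 13 ≤? 58} _))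

        p3≢p4 : p 3 ≢ p 4
        p3≢p4 e = <-irrefl (p-inj (<N (toWitness {a? = 3 ≤? 58} _)) (<N (toWitness {a? = 4 ≤? 58} _)) e) ≤-refl

        -- A dense vertex is adjacent to p 3, p 4 and p 10. A vertex of P is too far from p 3 or
        -- from p 10, and an end of the spine has at most its chord into the middle of P, so it
        -- misses p 3 or p 4.
        thin : ∀ {u} → u ∈ image c → ¬ Dense u
        thin {u} u∈ d = place (split (image⊆ u∈))
          where
          at-x : 3 ≡ 0 ⊎ p 3 ≡ a → 4 ≡ 0 ⊎ p 4 ≡ a → ⊥
          at-x (inj₂ e) (inj₂ e′) = p3≢p4 (trans e (sym e′))
          at-y : 4 ≡ N ⊎ p 3 ≡ b → 5 ≡ N ⊎ p 4 ≡ b → ⊥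
          at-y (inj₁ e) _ = <-irrefl e (<N (toWitness {a? = 4 ≤? 58} _))
          at-y (inj₂ _) (inj₁ e) = <-irrefl e (<N (toWitness {a? = 5 ≤? 58} _))
          at-y (inj₂ e) (inj₂ e′) = p3≢p4 (trans e (sym e′))
          at-p : ∀ {s} → s < N → u ≡ p s → Dec (suc s < 10) → ⊥
          at-p lt e (yes s<) = far s< (<N (toWitness {a? = 10 ≤? 58} _)) (subst (_~ p 10) e (at10 d))
          at-p lt e (no s≥) = far (≤-trans (toWitness {a? = 5 ≤? 9} _) (≤-pred (≮⇒≥ s≥))) lt (~-sym (subst (_~ p 3) e (at3 d)))
          place : u ∈ x ∷ y ∷ verts → ⊥
          place (here e) = at-x (near-x (<N (toWitness {a? = 3 ≤? 58} _)) (subst (_~ p 3) e (at3 d))) (near-x (<N (toWitness {a? = 4 ≤? 58} _)) (subst (_~ p 4) e (at4 d)))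
          place (there (here e)) = at-y (near-y (<N (toWitness {a? = 3 ≤? 58} _)) (subst (_~ p 3) e (at3 d))) (near-y (<N (toWitness {a? = 4 ≤? 58} _)) (subst (_~ p 4) e (at4 d)))
          place (there (there m)) = let (s , lt , e) = ∈-applyUpTo⁻ p m in at-p lt e (suc s <? 10)

        -- Adjacency to z spreads along the edges of the object. If z saw y but not its neighbour u,
        -- then z with an edge of P away from both would be a triangle with the tail y, u, a 2-pan
        -- on five vertices.
        complete : ∀ {z v} → z ∉ X → Dense z → v ∈ image c → z ~ v
        complete {z} zX d v∈ = spread (connected c (p∈ 3N) v∈) (at3 d)
          where
          3N : 3 < N
          3N = <N (toWitness {a? = 3 ≤? 58} _)
          blocked : ∀ {y u} → y ∈ image c → u ∈ image c → y ~ u → z ~ y → ¬ z ~ u → EdgeAway u y → ⊥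
          blocked y∈ u∈ yu zy zu (t , w , nu , nu′ , ny , ny′) =
            triTiny (next (Window.suc<N w)) (onDense d w) (onDense′ d w) (~-sym zy) (λ e → ny (inj₂ e)) (λ e → ny′ (inj₂ e)) (λ e → ny (inj₁ e)) (λ e → ny′ (inj₁ e))
              (~-sym yu) (λ e → zu (~-sym e)) (λ e → nu (inj₂ e)) (λ e → nu′ (inj₂ e)) (λ e → thin (subst (_∈ image c) e u∈) d) (λ e → nu (inj₁ e)) (λ e → nu′ (inj₁ e))
              zX (clean (Window.t<N w)) (clean (Window.suc<N w)) (av y∈) (av u∈)
          spread : ∀ {u v} → GReach (_∈ image c) u v → z ~ u → z ~ v
          spread (stop _) e = e
          spread (step {y = u} y∈ yu r) zy = go (z ~? u)
            where
            u∈ = reach-start r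
            go : Dec (z ~ u) → z ~ _
            go (yes zu) = spread r zu
            go (no zu) = ⊥-elim (blocked y∈ u∈ yu zy zu (edgeAway (av u∈) (av y∈) (thin u∈) (thin y∈)))

        A : List V
        A = filter (λ u → dense? u ×-dec ¬? (u ∈? X)) (allFin (n G))

        A⁺ : ∀ {u} → Dense u → u ∉ X → u ∈ A
        A⁺ {u} d uX = ∈-filter⁺ _ (∈-allFin u) (d , uX)

        A⁻ : ∀ {u} → u ∈ A → Dense u × u ∉ X
        A⁻ m = proj₂ (∈-filter⁻ (λ u → dense? u ×-dec ¬? (u ∈? X)) {xs = allFin (n G)} m)

        A! : Unique A
        A! = filter⁺ _ (allFin⁺ (n G))

      module Compare {c c′ : InducedSubdiv pan2 G} (L : LongObject c) (L′ : LongObject c′) where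

        module F = OfObject L
        module F′ = OfObject L′

        av′ : Avoids X c′
        av′ = F′.av

        -- If q missed some suitable p t, then q with an edge of the path of c′ would be a triangle
        -- with the tail v, p t: q sees v by `complete`, and v sees p t by density.
        denser : ∀ {v s q} → v ∈ image c′ → F.Dense v → s < F.N → F.p s ∈ image c′ → q ∉ X → F′.Dense q → F.Dense q
        denser {v} {s} {q} v∈ dv sN s∈ qX dq = go (F.dense? q)
          where
          -- p t is adjacent to v but not to q, and it is not dense for c′, being non-adjacent to p s
          contra : F.EdgeAway q (F.p s) → ⊥
          contra (t , w , nq , _ , ns , _) = go′ (F′.dense? (F.p t))
            where
            zX : F.p t ∉ X
            zX = F.clean (F.Window.t<N w)
            tri : F′.EdgeAway v (F.p t) → ⊥
            tri (t′ , w′ , nv , nv′ , nz , nz′) =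
              triTiny (F′.next (F′.Window.suc<N w′)) (F′.onDense dq w′) (F′.onDense′ dq w′) (~-sym (F′.complete qX dq v∈))
                (λ e → nv (inj₂ e)) (λ e → nv′ (inj₂ e)) (λ e → nv (inj₁ e)) (λ e → nv′ (inj₁ e)) (~-sym (F.onDense dv w)) (λ e → nq (inj₂ (~-sym e))) (λ e → nz (inj₂ e)) (λ e → nz′ (inj₂ e))
                (λ e → nq (inj₁ (sym e))) (λ e → nz (inj₁ e)) (λ e → nz′ (inj₁ e)) qX (F′.clean (F′.Window.t<N w′)) (F′.clean (F′.Window.suc<N w′)) (av′ v∈) zX
            go′ : Dec (F′.Dense (F.p t)) → ⊥
            go′ (yes d) = ns (inj₂ (~-sym (F′.complete zX d s∈)))
            go′ (no nd) = tri (F′.edgeAway (av′ v∈) zX (F′.thin v∈) nd)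
          go : Dec (F.Dense q) → F.Dense q
          go (yes d) = d
          go (no nd) = ⊥-elim (contra (F.edgeAway qX (F.clean sN) nd (F.thin (F.p∈ sN))))

        -- The inequality is strict because v is dense for c, but as a vertex of c′ not for c′.
        fewer : ∀ {v s} → v ∈ image c′ → v ∈ F.A → s < F.N → F.p s ∈ image c′ → suc (length F′.A) ≤ length F.A
        fewer {v} v∈ vA sN s∈ = card (All.tabulate (λ m e → F′.thin v∈ (subst F′.Dense (sym e) (proj₁ (F′.A⁻ m)))) ∷ F′.A!)
          λ { (here refl) → vA ; (there m) → let (d , qX) = F′.A⁻ m in F.A⁺ (denser v∈ (proj₁ (F.A⁻ vA)) sN s∈ qX d) qX }

      module InLadder {c : InducedSubdiv pan2 G} (L : LongObject c) where

        open OfObject L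
        open Approaching path using (Approach; approach; far-off)

        -- Three vertices are cut off at either end, so that dense vertices are adjacent to all of
        -- `Mid`. With the two ends of the spine they form D, which has eight entries.
        N′ : ℕ
        N′ = N ∸ 6

        N≡ : N ≡ 6 + N′
        N≡ = sym (m+[n∸m]≡n (≤-trans (toWitness {a? = 6 ≤? 59} _) 59≤N))

        inside : ∀ {t} → t < N′ → 3 + t < N × 3 + (3 + t) < N
        inside {t} lt = <-trans (s≤s (m≤n+m (3 + t) 2)) w , w
          where
          w : 3 + (3 + t) < N
          w = ≤-trans (s≤s (s≤s (s≤s (s≤s (s≤s (s≤s lt)))))) (≤-reflexive (sym N≡))

        Mid : IndPath
        Mid = record { p = λ t → p (3 + t) ; N = N′ ; next = λ lt → next (proj₁ (inside lt)) ; far = λ lt tN → far (s≤s (s≤s (s≤s lt))) (proj₁ (inside tN))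
                     ; p-inj = λ a b e → suc-injective (suc-injective (suc-injective (p-inj (proj₁ (inside a)) (proj₁ (inside b)) e))) }

        D : List V
        D = x ∷ y ∷ p 0 ∷ p 1 ∷ p 2 ∷ p (3 + N′) ∷ p (4 + N′) ∷ p (5 + N′) ∷ []

        cover : image c ⊆ D ++ IndPath.verts Mid
        cover m with split (image⊆ m)
        ... | here refl = here refl
        ... | there (here refl) = there (here refl)
        ... | there (there k) with ∈-applyUpTo⁻ p k
        ...   | t , lt , refl = index t lt
          where
          index : ∀ t → t < N → p t ∈ D ++ IndPath.verts Mid
          index 0 _ = there (there (here refl))
          index 1 _ = there (there (there (here refl)))
          index 2 _ = there (there (there (there (here refl))))
          index (suc (suc (suc t))) lt with t <? N′
          ... | yes t< = ∈-++⁺ʳ D (∈-applyUpTo⁺ (λ t → p (3 + t)) t<)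
          ... | no t≥ = there (there (there (there (there (tail (m+[n∸m]≡n (≮⇒≥ t≥)))))))
            where
            tail : ∀ {k} → N′ + k ≡ t → p (3 + t) ∈ p (3 + N′) ∷ p (4 + N′) ∷ p (5 + N′) ∷ IndPath.verts Mid
            tail {0} refl = here (cong (λ m → p (3 + m)) (+-identityʳ N′))
            tail {1} refl = there (here (cong (λ m → p (3 + m)) (trans (+-suc N′ 0) (cong suc (+-identityʳ N′)))))
            tail {2} refl = there (there (here (cong (λ m → p (3 + m)) (trans (+-suc N′ 1) (cong suc (trans (+-suc N′ 0) (cong suc (+-identityʳ N′))))))))
            tail {suc (suc (suc k))} refl = ⊥-elim (<-irrefl refl (<-≤-trans lt (≤-trans (≤-reflexive N≡) (s≤s (s≤s (s≤s (≤-trans (s≤s (s≤s (s≤s (m≤m+n N′ k))))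
                (≤-reflexive (sym (trans (+-suc N′ _) (cong suc (trans (+-suc N′ _) (cong suc (+-suc N′ k)))))))))))))) 

        mid⊆ : IndPath.verts Mid ⊆ image c
        mid⊆ m with ∈-applyUpTo⁻ (λ t → p (3 + t)) m
        ... | t , lt , refl = p∈ (proj₁ (inside lt))

        midA : Disjoint (IndPath.verts Mid) A
        midA m a = thin (mid⊆ m) (proj₁ (A⁻ a))

        module In {S : List V} (g : Good Mid 40 S) (ok : ∀ {v} → v ∈ S → v ∉ X × v ∉ A × (v ∈ image c → v ∈ IndPath.verts Mid)) where

          open Good g using (two-connected; start; run<; run∈)

          Result : Set
          Result = PanIn S

          cleanS : ∀ {v} → v ∈ S → v ∉ X
          cleanS m = proj₁ (ok m)

          sparse : ∀ {v} → v ∈ S → ¬ Dense v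
          sparse m d = proj₁ (proj₂ (ok m)) (A⁺ d (cleanS m))

          lo : ℕ
          lo = 3 + start

          fewS : ∀ us → us ⊆ S → All (Few lo (lo + 38)) us
          fewS [] _ = []
          fewS (u ∷ us) s = few (cleanS (s (here refl))) (sparse (s (here refl))) lo 38 (toWitness {a? = 38 ≤? 41} _) le ∷ fewS us (λ m → s (there m))
            where
            le : lo + 38 ≤ N
            le = ≤-trans (s≤s (s≤s (s≤s (≤-trans (+-monoʳ-≤ start (toWitness {a? = 38 ≤? 40} _)) run<)))) (≤-trans (m≤n+m (3 + N′) 3) (≤-reflexive (sym N≡)))

          runAt : ∀ {t} → lo ≤ t → t < lo + 38 → p t ∈ S × t < N
          runAt {suc (suc (suc t))} (s≤s (s≤s (s≤s a))) (s≤s (s≤s (s≤s b))) = run∈ a b′ , proj₁ (inside (<-≤-trans b′ run<))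
            where b′ = <-≤-trans b (+-monoʳ-≤ start (toWitness {a? = 38 ≤? 40} _))

          notBoth : ∀ {w t} → w ∈ S → suc t < N → w ~ p t → w ~ p (suc t) → ⊥
          notBoth {w} {t} w∈ tN r r′ with on? w
          ... | inj₂ off = sparse w∈ (closeDense (cleanS w∈) off (n<1+n t) tN (≤-trans (≤-reflexive (+-comm 1 t)) (+-monoʳ-≤ t (s≤s z≤n))) r r′)
          ... | inj₁ (s , sN , refl) with <-cmp s t | s ℕ.≟ suc t
          ...   | tri< lt _ _ | _ = far (s≤s lt) tN r′
          ...   | tri≈ _ refl _ | _ = ~-irrefl r
          ...   | tri> _ _ gt | yes refl = ~-irrefl r′
          ...   | tri> _ _ gt | no ne = far (≤∧≢⇒< gt (λ e → ne (sym e))) sN (~-sym r)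

          RunAway : List V → ℕ → Set
          RunAway C t = lo ≤ t × suc t < lo + 38 × (∀ {u} → u ∈ C → ¬ Near u t × ¬ Near u (suc t))

          -- At most six vertices rule out at most 18 indices, so 19 pairs suffice: 38 indices of
          -- the run of 40.
          runAway : ∀ C → C ⊆ S → length C ≤ 6 → ∃ (RunAway C)
          runAway C C⊆ le = awayPair 19 C (fewS C C⊆) (s≤s (*-monoˡ-≤ 3 le)) ≤-refl

          walkTo : ∀ {a P t} → ICycle a P → (a ∷ P) ⊆ S → RunAway (a ∷ P) t → GReach (_∈ S) (p t) a
          walkTo {a} {P} {t} cy C⊆ (lo≤ , t< , away) = reach-mono proj₁ (two-connected {ICycle.x cy} (proj₁ (runAt lo≤ (<-trans (n<1+n t) t<))) (C⊆ (here refl))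
              (λ e → proj₁ (away (there (head∈ (ipath⇒path (ICycle.ip cy))))) (inj₁ (sym e))) (~⇒≢ (ICycle.a~x cy)))

          noApproach : ∀ {a P t} → ICycle a P → (a ∷ P) ⊆ S → length P ≤ 5 → suc t < N → Approach S (a ∷ P) t → ⊥
          noApproach cy C⊆ le lt (w , w∈ , tw , w∉ , inj₁ (r , r′)) = notBoth w∈ lt r r′
          noApproach cy C⊆ le lt (w , w∈ , tw , w∉ , inj₂ (h , k , (h∈ , hC) , (k∈ , kC) , wh , hk , wk , w≢k)) =
            smallTiny cy le (λ m → cleanS (C⊆ m)) (cleanS w∈) (cleanS h∈) (cleanS k∈) tw w∉ hC kC wh hk wk w≢k

          -- The cycle and the tail from `approach` would form a 2-pan that is too small to exist.
          -- So every cycle in the ladder is long enough for `progress`.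
          smallCycle : ∀ {a P} → ICycle a P → (a ∷ P) ⊆ S → length P ≤ 5 → ⊥
          smallCycle {a} {P} cy C⊆ le = go (runAway (a ∷ P) C⊆ (s≤s le))
            where
            go : ∃ (RunAway (a ∷ P)) → ⊥
            go (t , r@(lo≤ , t< , away)) = noApproach cy C⊆ le (proj₂ (runAt (m≤n⇒m≤1+n lo≤) t<))
              (approach (a ∷ P) (walkTo cy C⊆ r) (here refl) (far-off (λ m → proj₁ (away m))) (far-off (λ m → proj₂ (away m)))
                (proj₁ (runAt (m≤n⇒m≤1+n lo≤) t<)) (proj₂ (runAt (m≤n⇒m≤1+n lo≤) t<)))

          fromCycle : ∀ bound {a P} → ICycle a P → (a ∷ P) ⊆ S → length P ≤ bound → Result

          shorten : ∀ bound {P} → length P ≤ suc bound → Result ⊎ Shorter S P → Result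
          shorten bound le (inj₁ o) = o
          shorten bound le (inj₂ (_ , _ , c′ , s , lt)) = fromCycle bound c′ s (≤-pred (≤-trans lt le))

          fromCycle bound {P = P} cy C⊆ le with 6 ≤? length P
          ... | no n6 = ⊥-elim (smallCycle cy C⊆ (≤-pred (≰⇒> n6)))
          fromCycle zero cy C⊆ le | yes 6≤ with ≤-trans 6≤ le
          ... | ()
          fromCycle (suc bound) {P = P} cy C⊆ le | yes 6≤ = shorten bound {P} le (progress g cy C⊆ 6≤)

          result : Result
          result = let (a , P , cy , s) = someCycle g in fromCycle (length P) cy s ≤-refl

      DenselyMet : ∀ {c} → LongObject c → List V → Set
      DenselyMet L l = All (_∉ X) l × Any (_∈ IndPath.verts (InLadder.Mid L)) l × Any (_∈ OfObject.A L) l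

      descend : ∀ {c c′} (L : LongObject c) (L′ : LongObject c′) → DenselyMet L (image c′) → suc (length (OfObject.A L′)) ≤ length (OfObject.A L)
      descend L L′ (_ , an , an′) =
        let (v , v∈ , vM) = find an ; (u , u∈ , uA) = find an′ ; (t , t< , e) = ∈-applyUpTo⁻ (λ t → OfObject.p L (3 + t)) vM in
        Compare.fewer L L′ u∈ uA (proj₁ (InLadder.inside L t<)) (subst (_∈ _) e v∈)

      -- Among the long objects pass to one with fewer dense vertices as long as some object
      -- meets both the path and the set of dense vertices.
      loop : ∀ k {c} (L : LongObject c) → length (OfObject.A L) ≤ k → Choice 60 8 40 X
      loop k {c} L le = go k le (searchObject (λ l → all? (λ v → ¬? (v ∈? X)) l ×-dec (any? (_∈? IndPath.verts (InLadder.Mid L)) l ×-dec any? (_∈? OfObject.A L) l)))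
        where
        open InLadder L
        open OfObject L using (A; av)
        go : ∀ k → length A ≤ k → Dec (Σ (InducedSubdiv pan2 G) λ c′ → DenselyMet L (image c′)) → Choice 60 8 40 X
        go k le (no ne) = big c av Mid D A (toWitness {a? = 8 ≤? 8} _) cover mid⊆ midA
            (λ {c′} av′ (v , v∈ , vM) {u} u∈ uA → ne (c′ , All.tabulate av′ , lose v∈ vM , lose u∈ uA)) (λ g ok → In.result g ok)
        go zero le (yes (c′ , d)) with ≤-trans (descend L (longObject c′ (λ m → All.lookup (proj₁ d) m)) d) le
        ... | ()
        go (suc k) le (yes (c′ , d)) = loop k (longObject c′ (λ m → All.lookup (proj₁ d) m)) (≤-pred (≤-trans (descend L (longObject c′ (λ m → All.lookup (proj₁ d) m)) d) le))

    choose : ∀ X → Choice 60 8 40 X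
    choose X with searchObject (λ l → all? (λ v → ¬? (v ∈? X)) l ×-dec (length l ≤? 60))
    ... | yes (c , al , le) = small c (λ m → All.lookup al m) le
    ... | no nosmall with searchObject (all? (λ v → ¬? (v ∈? X)))
    ...   | no ne = none (λ {c} a → ne (c , All.tabulate a))
    ...   | yes (c , al) = Avoiding.loop X (λ {o} → ns {o}) _ (Avoiding.longObject X (λ {o} → ns {o}) c (λ m → All.lookup al m)) ≤-refl
      where
      ns : ∀ {o} → Avoids X o → ¬ length (image o) ≤ 60
      ns {o} a le = nosmall (o , All.tabulate a , le)

-- The polynomial bound

module Polynomial (H : Graph) (spine : Spine H) (2≤ : 2 ≤ n H) (s₀ d₀ r : ℕ) (3≤r : 3 ≤ r)
  (choose : ∀ G (simple : IsSimple G) X → Packing.Choice G simple H spine 2≤ s₀ d₀ r X) where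

  -- From k times `cost` with 2^J ≤ 2k: the product of k, 2k and 2r(2k)^2 is 16 r k^4, the one
  -- vertex of P per peeling adds 2k^2, and s₀ + d₀ is paid k times.
  coefficient : ℕ
  coefficient = s₀ + d₀ + 16 * r + 2

  erdősPósa : ∀ G → IsSimple G → ∀ k → 1 ≤ k →
    DisjointPacking H G k ⊎ Σ (List (Fin (n G))) λ X → length X ≤ coefficient * k ^ 4 × Hits H G X
  erdősPósa G simple k 1≤k with powerAbove k 1≤k
  ... | J , k≤ , ≤2k with Packing.Main.solve G simple H spine 2≤ s₀ d₀ r 3≤r (choose G simple) J k [] k≤
  ...   | inj₁ (cs , refl , ap , _) = inj₁ (lookup cs , λ a b ne i j e →
            allPairs-index (λ {a} {b} → Packing.apart-sym G simple H spine 2≤ {a} {b}) ap a b ne (∈-tabulate⁺ i) (subst (_∈ Objects.image H G (lookup cs b)) (sym e) (∈-tabulate⁺ j)))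
  ...   | inj₂ (Z , le , h) = inj₂ (Z , ≤-trans le bound , λ c → hits c (h {c} (λ _ ())))
    where
    open Packing.Main G simple H spine 2≤ s₀ d₀ r 3≤r (choose G simple) J using (cost; need)
    hits : ∀ c → (∃ λ v → v ∈ Objects.image H G c × v ∈ Z) → ∃ λ i → φ (emb c) i ∈ Z
    hits c (v , v∈ , z) = let (i , e) = ∈-tabulate⁻ v∈ in i , subst (_∈ Z) e z
    need≤ : need ≤ r * ((2 * k) * (2 * k))
    need≤ = ≤-trans (≤-reflexive (Boxes.need-eq {Fin (n G)} (λ _ → 0) (λ _ → 0) r J)) (*-monoʳ-≤ r (*-mono-≤ ≤2k ≤2k))
    open import Data.Nat.Tactic.RingSolver using (solve-∀)
    cost≤ : cost ≤ s₀ + (d₀ + (2 * k) * (r * ((2 * k) * (2 * k)) + suc (r * ((2 * k) * (2 * k)))))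
    cost≤ = +-monoʳ-≤ s₀ (+-monoʳ-≤ d₀ (*-mono-≤ ≤2k (+-mono-≤ need≤ (s≤s need≤))))
    bound : k * cost ≤ coefficient * k ^ 4
    bound = grow k 1≤k (≤-trans (*-monoʳ-≤ k cost≤) (≤-reflexive (eq s₀ d₀ r k)))
      where
      eq : ∀ s d r k → k * (s + (d + (2 * k) * (r * ((2 * k) * (2 * k)) + suc (r * ((2 * k) * (2 * k)))))) ≡
           (s + d) * k + 16 * r * (k * k * k * k) + 2 * (k * k)
      eq = solve-∀
      eq′ : ∀ s d r q → (s + d) * q + 16 * r * q + 2 * q ≡ (s + d + 16 * r + 2) * q
      eq′ = solve-∀
      grow : ∀ k → 1 ≤ k → k * cost ≤ (s₀ + d₀) * k + 16 * r * (k * k * k * k) + 2 * (k * k) → k * cost ≤ coefficient * k ^ 4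
      grow k@(suc _) _ le = ≤-trans le (≤-trans (+-mono-≤ (+-mono-≤ (*-monoʳ-≤ (s₀ + d₀) k≤k⁴) (≤-refl {16 * r * (k * k * k * k)})) (*-monoʳ-≤ 2 k²≤k⁴))
          (≤-reflexive (trans (eq′ s₀ d₀ r (k * k * k * k)) (cong (coefficient *_) (pow k)))))
        where
        k²≤k⁴ : k * k ≤ k * k * k * k
        k²≤k⁴ = ≤-trans (m≤m*n (k * k) k) (m≤m*n (k * k * k) k)
          where open import Data.Nat.Properties using (m≤m*n)
        k≤k⁴ : k ≤ k * k * k * k
        k≤k⁴ = ≤-trans (m≤m*n k k) k²≤k⁴
          where open import Data.Nat.Properties using (m≤m*n)
        pow : ∀ k → k * k * k * k ≡ k * (k * (k * (k * 1)))
        pow = solve-∀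

  polynomialBound : Σ ℕ λ c → Σ ℕ λ d → ∀ G → IsSimple G → ∀ k → 1 ≤ k →
    DisjointPacking H G k ⊎ Σ (List (Fin (n G))) λ X → length X ≤ c * k ^ d × Hits H G X
  polynomialBound = coefficient , 4 , erdősPósa

theorem1p4 : (w : WhichH) →
    Σ ℕ λ c → Σ ℕ λ d →
    ∀ (G : Graph) → IsSimple G → ∀ (k : ℕ) → 1 ≤ k →
    DisjointPacking (graphOf w) G k
    ⊎ Σ (List (Fin' G)) λ X → (length X ≤ c * k ^ d) × Hits (graphOf w) G X
theorem1p4 isDiamond = Polynomial.polynomialBound diamond (graphSpine isDiamond) (s≤s (s≤s z≤n)) 0 2 3 ≤3 Theta.choose
  where ≤3 = toWitness {a? = 3 ≤? 3} _
theorem1p4 isPan1 = Polynomial.polynomialBound pan1 (graphSpine isPan1) (s≤s (s≤s z≤n)) 0 2 30 ≤30 Pan1.choose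
  where ≤30 = toWitness {a? = 3 ≤? 30} _
theorem1p4 isPan2 = Polynomial.polynomialBound pan2 (graphSpine isPan2) (s≤s (s≤s z≤n)) 60 8 40 ≤40 Pan2.choose
  where ≤40 = toWitness {a? = 3 ≤? 40} _
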